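{- Let $n=\prod_i p_i^{r_i}$ be a composite positive integer, with distinct primes $p_i$ and $r_i\ge1$. For each $i$ set $$g_i=\gcd(n-1,p_i-1),\qquad h_i=\gcd(n-1,p_i^2-1),$$ $$A_i=\tfrac12\left(g_i^2-g_i\right),\qquad B_i=\tfrac12\left(h_i-g_i\right).$$ Then $$L_2^+(n)=\frac12\prod_i (A_i+B_i)+\frac12\prod_{i:\,2\mid r_i}(A_i+B_i)\prod_{i:\,2\nmid r_i}(A_i-B_i).$$
   Context: For a positive integer $m$ and monic $g_1,g_2,h\in(\mathbb{Z}/m\mathbb{Z})[x]$, $\mathrm{gcmd}(g_1,g_2)=h$ means that the ideal generated by $g_1,g_2$ in $(\mathbb{Z}/m\mathbb{Z})[x]$ equals the ideal generated by $h$. A composite $n$ is a degree-2 Frobenius pseudoprime with respect to a monic quadratic $f$ with discriminant $\Delta$ (equivalently, $f$ is a liar for $n$) if all of the following hold: (1) $\gcd(n,f(0)\Delta)=1$; (2) modulo $n$, the polynomials $F_1=\mathrm{gcmd}(x^n-x,f)$, $f_1=f/F_1$, $F_2=\mathrm{gcmd}(x^{n^2}-x,f_1)$ and $f_2=f_1/F_2$ all exist, and $f_2=1$; (3) $F_2(x)\mid F_2(x^n)$; (4) $(-1)^{\deg(F_2)/2}=\left(\frac{\Delta}{n}\right)$ (Jacobi symbol). These conditions depend only on $f$ modulo $n$. $L_2^+(n)$ is the number of monic quadratic polynomials $f\in(\mathbb{Z}/n\mathbb{Z})[x]$ that are liars for $n$ and satisfy $\left(\frac{\Delta}{n}\right)=+1$.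 -}

module Defs where

open import Data.Nat as ℕ using (ℕ; zero; suc)
import Data.Nat.Primality as P
open import Data.Integer as ℤ using (ℤ; +_; _-_)
open import Data.Integer.Divisibility using (_∣_)
import Data.Integer.GCD as ℤG
import Data.Nat.GCD as ℕG
open import Data.Fin using (Fin; toℕ)
open import Data.List using (List; []; _∷_; foldr; length; map)
open import Data.List.Relation.Unary.Unique.Propositional using (Unique)
open import Data.List.Membership.Propositional using (_∈_)
open import Data.Product using (Σ; ∃; ∃-syntax; _×_; _,_)
open import Relation.Binary.PropositionalEquality using (_≡_; _≢_)
open import Relation.Nullary using (¬_)
open import Function.Bundles using (_⇔_)
import Data.Sum
import Data.List.Relation.Unary.All
import Data.Product

infix 4 _≡_[mod_]
_≡_[mod_] : ℤ → ℤ → ℕ → Set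
a ≡ b [mod n ] = (+ n) ∣ (a - b)

-- Polynomials over ℤ/nℤ, represented by integer coefficient lists
-- (lowest degree first); two lists denote the same element of
-- (ℤ/nℤ)[x] iff all their coefficients agree mod n.

Poly : Set
Poly = List ℤ

coeff : Poly → ℕ → ℤ
coeff []       _       = + 0
coeff (a ∷ p)  zero    = a
coeff (a ∷ p)  (suc i) = coeff p i

infix 4 _≈_[mod_]
_≈_[mod_] : Poly → Poly → ℕ → Set
p ≈ q [mod n ] = ∀ i → coeff p i ≡ coeff q i [mod n ]

infixl 6 _+ₚ_ _-ₚ_
infixl 7 _*ₚ_
infixr 9 _∘ₚ_

_+ₚ_ : Poly → Poly → Poly
[]      +ₚ q       = q
(a ∷ p) +ₚ []      = a ∷ p
(a ∷ p) +ₚ (b ∷ q) = (a ℤ.+ b) ∷ (p +ₚ q)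

scale : ℤ → Poly → Poly
scale a = map (a ℤ.*_)

_*ₚ_ : Poly → Poly → Poly
[]      *ₚ q = []
(a ∷ p) *ₚ q = scale a q +ₚ (+ 0 ∷ (p *ₚ q))

-ₚ_ : Poly → Poly
-ₚ_ = map (λ a → ℤ.- a)

_-ₚ_ : Poly → Poly → Poly
p -ₚ q = p +ₚ (-ₚ q)

oneₚ : Poly
oneₚ = + 1 ∷ []

X^ : ℕ → Poly
X^ zero    = + 1 ∷ []
X^ (suc k) = + 0 ∷ X^ k

_∘ₚ_ : Poly → Poly → Poly
p ∘ₚ q = foldr (λ a acc → (a ∷ []) +ₚ (q *ₚ acc)) [] p

MonicDeg : ℕ → Poly → ℕ → Set
MonicDeg n p d = (coeff p d ≡ + 1 [mod n ]) × (∀ i → d ℕ.< i → coeff p i ≡ + 0 [mod n ])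

Monic : ℕ → Poly → Set
Monic n p = ∃[ d ] MonicDeg n p d

InIdeal₁ : ℕ → Poly → Poly → Set
InIdeal₁ n g h = ∃[ a ] ((a *ₚ g) ≈ h [mod n ])

InIdeal₂ : ℕ → Poly → Poly → Poly → Set
InIdeal₂ n g₁ g₂ h = ∃[ a ] ∃[ b ] (((a *ₚ g₁) +ₚ (b *ₚ g₂)) ≈ h [mod n ])

-- gcmd(g₁, g₂) = h in (ℤ/nℤ)[x]: h monic and (g₁, g₂) = (h) as ideals
Gcmd : ℕ → Poly → Poly → Poly → Set
Gcmd n g₁ g₂ h = Monic n h × InIdeal₂ n g₁ g₂ h × InIdeal₁ n h g₁ × InIdeal₁ n h g₂

IsQuot : ℕ → Poly → Poly → Poly → Set
IsQuot n p d q = p ≈ (d *ₚ q) [mod n ]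

PolyDvd : ℕ → Poly → Poly → Set
PolyDvd n g h = InIdeal₁ n g h

-- Kronecker symbol (a / n) for n ≥ 1, given as a relation
-- KronRel a n s  meaning  (a / n) = s.  For odd n this is the Jacobi
-- symbol (product of Legendre symbols over the prime factorisation).

-- the symbol (a / p) for a prime p: Legendre symbol for odd p,
-- Kronecker's convention for p = 2
data PrimeSym (a : ℤ) (p : ℕ) : ℤ → Set where
  odd-div  : p ≢ 2 → (+ p) ∣ a → PrimeSym a p (+ 0)
  odd-res  : p ≢ 2 → ¬ ((+ p) ∣ a) → (∃[ x ] (x ℤ.* x ≡ a [mod p ])) → PrimeSym a p (+ 1)
  odd-nres : p ≢ 2 → ¬ ((+ p) ∣ a) → ¬ (∃[ x ] (x ℤ.* x ≡ a [mod p ])) → PrimeSym a p (ℤ.- (+ 1))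
  two-even : p ≡ 2 → (+ 2) ∣ a → PrimeSym a p (+ 0)
  two-pm1  : p ≡ 2 → (a ≡ + 1 [mod 8 ]) Data.Sum.⊎ (a ≡ + 7 [mod 8 ]) → PrimeSym a p (+ 1)
  two-pm3  : p ≡ 2 → (a ≡ + 3 [mod 8 ]) Data.Sum.⊎ (a ≡ + 5 [mod 8 ]) → PrimeSym a p (ℤ.- (+ 1))

data KronRel (a : ℤ) : ℕ → ℤ → Set where
  kr-one  : KronRel a 1 (+ 1)
  kr-step : ∀ {p m s t} → P.Prime p → PrimeSym a p s → KronRel a m t →
            KronRel a (p ℕ.* m) (s ℤ.* t)

negOnePow : ℕ → ℤ
negOnePow zero    = + 1
negOnePow (suc m) = ℤ.- negOnePow m

quadPoly : ℤ → ℤ → Poly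
quadPoly b c = c ∷ b ∷ + 1 ∷ []

disc : ℤ → ℤ → ℤ
disc b c = b ℤ.* b - (+ 4) ℤ.* c

Liar : ℕ → ℤ → ℤ → Set
Liar n b c =
  let f = quadPoly b c ; Δ = disc b c in
  (ℤG.gcd (+ n) (c ℤ.* Δ) ≡ + 1) ×
  (∃[ F₁ ] ∃[ f₁ ] ∃[ F₂ ] ∃[ f₂ ]
     ( Gcmd n (X^ n -ₚ X^ 1) f F₁
     × IsQuot n f F₁ f₁
     × Gcmd n (X^ (n ℕ.* n) -ₚ X^ 1) f₁ F₂
     × IsQuot n f₁ F₂ f₂
     × (f₂ ≈ oneₚ [mod n ])
     × PolyDvd n F₂ (F₂ ∘ₚ X^ n)
     × (∃[ d ] ∃[ m ] (MonicDeg n F₂ d × d ≡ 2 ℕ.* m × KronRel Δ n (negOnePow m)))))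

L2+Member : (n : ℕ) → Fin n × Fin n → Set
L2+Member n (b , c) =
  Liar n (+ toℕ b) (+ toℕ c) × KronRel (disc (+ toℕ b) (+ toℕ c)) n (+ 1)

HasCard : {A : Set} → (A → Set) → ℕ → Set
HasCard {A} P k = ∃[ xs ] (Unique xs × (∀ (x : A) → (x ∈ xs) ⇔ P x) × length xs ≡ k)

IsFactorisation : ℕ → List (ℕ × ℕ) → Set
IsFactorisation n fs =
  Data.List.Relation.Unary.All.All (λ { (p , r) → P.Prime p × 1 ℕ.≤ r }) fs
  × Unique (map Data.Product.proj₁ fs)
  × n ≡ foldr (λ { (p , r) acc → (p ℕ.^ r) ℕ.* acc }) 1 fs

gᵢ : ℕ → ℕ → ℕ
gᵢ n p = ℕG.gcd (n ℕ.∸ 1) (p ℕ.∸ 1)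

hᵢ : ℕ → ℕ → ℕ
hᵢ n p = ℕG.gcd (n ℕ.∸ 1) (p ℕ.* p ℕ.∸ 1)

Aᵢ : ℕ → ℕ → ℕ
Aᵢ n p = (gᵢ n p ℕ.* gᵢ n p ℕ.∸ gᵢ n p) ℕ./ 2

Bᵢ : ℕ → ℕ → ℕ
Bᵢ n p = (hᵢ n p ℕ.∸ gᵢ n p) ℕ./ 2

prodAB : ℕ → List (ℕ × ℕ) → ℤ
prodAB n = foldr (λ { (p , r) acc → (+ (Aᵢ n p ℕ.+ Bᵢ n p)) ℤ.* acc }) (+ 1)

parityFactor : ℕ → ℕ → ℕ → ℤ
parityFactor n p r with r ℕ.% 2
... | zero  = + (Aᵢ n p) ℤ.+ + (Bᵢ n p)
... | suc _ = + (Aᵢ n p) - + (Bᵢ n p)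

prodParity : ℕ → List (ℕ × ℕ) → ℤ
prodParity n = foldr (λ { (p , r) acc → parityFactor n p r ℤ.* acc }) (+ 1)

{-# OPTIONS --safe #-}
module Submission where

-- If the symbol of Δ is +1 then deg F₂ is divisible by 4, hence F₂ = 1, and f is a liar exactly
-- when X^n = X in (ℤ/n)[X]/(f).  Writing P and Q for the numbers of such f with symbol +1 and -1,
-- P + Q and P - Q are multiplicative in the modulus by the Chinese remainder theorem, and
-- 2P = (P + Q) + (P - Q).
--
-- Modulo p^r the solutions reduce bijectively to the solutions modulo p.  A lift exists because
-- X, X^n, X^(n²), … stabilise modulo p^r; it is unique because the trace and norm of X^n, as
-- functions of the coefficients of f, have derivatives divisible by n and hence by p.
--
-- Modulo an odd prime p, a solution with square discriminant is (X - α)(X - β) for distinct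
-- α, β ∈ 𝔽_p with α^(n-1) = β^(n-1) = 1, and one with non-square discriminant is the minimal
-- polynomial of some α ∈ 𝔽_p² \ 𝔽_p with α^(n-1) = 1.  A field with E units contains gcd (n-1) E
-- solutions of x^(n-1) = 1.

open import Defs
open import Algebra.Bundles using (CommutativeRing)
import Algebra.Properties.Group as GroupProperties
import Algebra.Solver.Ring.NaturalCoefficients.Default as SemiringSolver
open import Data.Empty using (⊥; ⊥-elim)
open import Data.Fin as Fin using (Fin; toℕ)
import Data.Fin.Properties as Finₚ
open import Data.Integer as ℤ using (ℤ; +_; _+_; _-_; -_; ∣_∣) renaming (_*_ to _·_)
import Data.Integer.Divisibility as ℤ∣
import Data.Integer.Divisibility.Signed as Signed
import Data.Integer.DivMod as ℤDivMod
import Data.Integer.Properties as ℤₚ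
open import Data.Integer.Tactic.RingSolver using (solve-∀)
open import Data.List using (List; []; _∷_; _++_; map; filter; length; cartesianProduct; allFin)
import Data.List.Properties as Listₚ
open import Data.List.Relation.Binary.Permutation.Propositional using (_↭_; ↭-refl; ↭-trans; prep)
import Data.List.Relation.Binary.Permutation.Propositional.Properties as ↭ₚ
open import Data.List.Membership.Propositional using (_∈_)
import Data.List.Membership.Propositional.Properties as ∈ₚ
open import Data.List.Relation.Unary.All as All using (All; []; _∷_)
open import Data.List.Relation.Unary.AllPairs using ([]; _∷_)
open import Data.List.Relation.Unary.Any using (here; there)
open import Data.List.Relation.Unary.Unique.Propositional using (Unique)
import Data.List.Relation.Unary.Unique.Propositional.Properties as Uniqueₚ
open import Data.Nat as ℕ using (ℕ; zero; suc; _*_; _≤_; _<_; z≤n; s≤s)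
import Data.Nat.Coprimality as Coprime
import Data.Nat.Divisibility as ℕ∣
import Data.Nat.DivMod as ℕDivMod
import Data.Nat.GCD as ℕGCD
open import Data.Nat.Primality using (Prime; Composite)
import Data.Nat.Primality as Primality
import Data.Nat.Properties as ℕₚ
open import Data.Product using (_×_; _,_; proj₁; proj₂; ∃-syntax)
open import Data.Sum as Sum using (_⊎_; inj₁; inj₂)
open import Data.Unit using (⊤; tt)
open import Function.Base using (_∘_; id)
open import Function.Bundles using (_⇔_; mk⇔; Equivalence)
open import Level using (0ℓ)
open import Relation.Binary.Definitions using (tri<; tri≈; tri>)
open import Relation.Binary.PropositionalEquality
  using (_≡_; _≢_; refl; sym; trans; cong; cong₂; subst; subst₂; module ≡-Reasoning)
import Relation.Binary.Reasoning.Setoid as SetoidReasoning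
open import Relation.Nullary using (¬_; Dec; yes; no; contradiction; ¬?)
import Relation.Nullary.Decidable as Dec

-- Congruences and quadratic extensions of ℤ/m

-- The step to F₂ = 1 needs deg F₂ ≤ 2, which holds because F₁ F₂ = f.
--
-- Quadratics are counted modulo divisors m of n while the exponent stays n. What is left of n
-- modulo a power of p is that p divides the exponent, and both halves of the lifting argument live
-- on this: taking n-th powers sharpens congruences p-adically.
--
-- The symbol modulo p^r is the r-th power of the symbol modulo p, so for even r every solution has
-- symbol +1. This is the origin of the parity condition in the second product.
--
-- The prime 2 is treated apart, because roots cannot be found by halving there and the Kronecker
-- symbol at 2 depends on Δ modulo 8. The only quadratic over 𝔽₂ with cΔ ≠ 0 is X² + X + 1, and each
-- of its integer lifts has Δ ≡ 5 modulo 8, hence symbol -1. This agrees with the formulas, which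
-- give A = 0 and B = (gcd(n - 1, 3) - 1)/2 at p = 2.

infix 4 _≋_[_]

-- The quotient is kept as data: matching on it turns a congruence into an equation between
-- integers, which the ring solver can finish. As a record it also lets `a`, `b` and `m` be
-- inferred, unlike divisibility of an absolute value.
record _≋_[_] (a b : ℤ) (m : ℕ) : Set where
  constructor by
  field
    quotient : ℤ
    equation : a ≡ b + quotient · + m

≡⇒≋ : ∀ {m a b} → a ≡ b → a ≋ b [ m ]
≡⇒≋ {m} {a} refl = by (+ 0) (lemma a (+ m))
  where
  lemma : ∀ x y → x ≡ x + + 0 · y
  lemma = solve-∀

≋-sym : ∀ {m a b} → a ≋ b [ m ] → b ≋ a [ m ]
≋-sym {m} {a} {b} (by q refl) = by (- q) (lemma b q (+ m))
  where
  lemma : ∀ x y z → x ≡ x + y · z + - y · z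
  lemma = solve-∀

≋-trans : ∀ {m a b c} → a ≋ b [ m ] → b ≋ c [ m ] → a ≋ c [ m ]
≋-trans {m} {c = c} (by q refl) (by r refl) = by (r + q) (lemma c r q (+ m))
  where
  lemma : ∀ x y z w → x + y · w + z · w ≡ x + (y + z) · w
  lemma = solve-∀

+-cong-≋ : ∀ {m a a′ b b′} → a ≋ a′ [ m ] → b ≋ b′ [ m ] → a + b ≋ a′ + b′ [ m ]
+-cong-≋ {m} {a′ = a} {b′ = b} (by q refl) (by r refl) = by (q + r) (lemma a b q r (+ m))
  where
  lemma : ∀ x y z t w → (x + z · w) + (y + t · w) ≡ x + y + (z + t) · w
  lemma = solve-∀

·-cong-≋ : ∀ {m a a′ b b′} → a ≋ a′ [ m ] → b ≋ b′ [ m ] → a · b ≋ a′ · b′ [ m ]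
·-cong-≋ {m} {a′ = a} {b′ = b} (by q refl) (by r refl) =
  by (a · r + q · b + q · r · + m) (lemma a b q r (+ m))
  where
  lemma : ∀ x y z t w → (x + z · w) · (y + t · w) ≡ x · y + (x · t + z · y + z · t · w) · w
  lemma = solve-∀

neg-cong-≋ : ∀ {m a b} → a ≋ b [ m ] → - a ≋ - b [ m ]
neg-cong-≋ {m} {b = b} (by q refl) = by (- q) (lemma b q (+ m))
  where
  lemma : ∀ x y z → - (x + y · z) ≡ - x + - y · z
  lemma = solve-∀

minus-cong-≋ : ∀ {m a a′ b b′} → a ≋ a′ [ m ] → b ≋ b′ [ m ] → a - b ≋ a′ - b′ [ m ]
minus-cong-≋ e f = +-cong-≋ e (neg-cong-≋ f)

-- For m = 0 this is ℤ with propositional equality.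
modRing : ℕ → CommutativeRing 0ℓ 0ℓ
modRing m = record
  { Carrier = ℤ ; _≈_ = _≋_[ m ] ; _+_ = _+_ ; _*_ = _·_ ; -_ = -_ ; 0# = + 0 ; 1# = + 1
  ; isCommutativeRing = record
    { isRing = record
      { +-isAbelianGroup = record
        { isGroup = record
          { isMonoid = record
            { isSemigroup = record
              { isMagma = record
                { isEquivalence = record { refl = ≡⇒≋ refl ; sym = ≋-sym ; trans = ≋-trans }
                ; ∙-cong = +-cong-≋ }
              ; assoc = λ a b c → ≡⇒≋ (ℤₚ.+-assoc a b c) }
            ; identity = (λ a → ≡⇒≋ (ℤₚ.+-identityˡ a)) , λ a → ≡⇒≋ (ℤₚ.+-identityʳ a) }
          ; inverse = (λ a → ≡⇒≋ (ℤₚ.+-inverseˡ a)) , λ a → ≡⇒≋ (ℤₚ.+-inverseʳ a)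
          ; ⁻¹-cong = neg-cong-≋ }
        ; comm = λ a b → ≡⇒≋ (ℤₚ.+-comm a b) }
      ; *-cong = ·-cong-≋
      ; *-assoc = λ a b c → ≡⇒≋ (ℤₚ.*-assoc a b c)
      ; *-identity = (λ a → ≡⇒≋ (ℤₚ.*-identityˡ a)) , λ a → ≡⇒≋ (ℤₚ.*-identityʳ a)
      ; distrib = (λ a b c → ≡⇒≋ (ℤₚ.*-distribˡ-+ a b c)) , λ a b c → ≡⇒≋ (ℤₚ.*-distribʳ-+ a b c) }
    ; *-comm = λ a b → ≡⇒≋ (ℤₚ.*-comm a b) } }

infix 4 _≋₂_[_]
infixl 6 _+₂_

_≋₂_[_] : ℤ × ℤ → ℤ × ℤ → ℕ → Set
(u , v) ≋₂ (u′ , v′) [ m ] = (u ≋ u′ [ m ]) × (v ≋ v′ [ m ])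

_+₂_ : ℤ × ℤ → ℤ × ℤ → ℤ × ℤ
(u , v) +₂ (u′ , v′) = (u + u′) , (v + v′)

-₂_ : ℤ × ℤ → ℤ × ℤ
-₂ (u , v) = - u , - v

-- The pair (u , v) stands for u X + v modulo X² + b X + c.
mulQ : ℤ → ℤ → ℤ × ℤ → ℤ × ℤ → ℤ × ℤ
mulQ b c (u , v) (u′ , v′) = (u · v′ + v · u′ - b · (u · u′)) , (v · v′ - c · (u · u′))

≡⇒≋₂ : ∀ {m x y} → x ≡ y → x ≋₂ y [ m ]
≡⇒≋₂ refl = ≡⇒≋ refl , ≡⇒≋ refl

mulQ-assoc : ∀ b c x y z → mulQ b c (mulQ b c x y) z ≡ mulQ b c x (mulQ b c y z)
mulQ-assoc b c (u , v) (u′ , v′) (u″ , v″) = cong₂ _,_ (first b c u v u′ v′ u″ v″) (second b c u v u′ v′ u″ v″)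
  where
  first : ∀ b c u v u′ v′ u″ v″ →
    (u · v′ + v · u′ - b · (u · u′)) · v″ + (v · v′ - c · (u · u′)) · u″ - b · ((u · v′ + v · u′ - b · (u · u′)) · u″)
    ≡ u · (v′ · v″ - c · (u′ · u″)) + v · (u′ · v″ + v′ · u″ - b · (u′ · u″)) - b · (u · (u′ · v″ + v′ · u″ - b · (u′ · u″)))
  first = solve-∀
  second : ∀ b c u v u′ v′ u″ v″ →
    (v · v′ - c · (u · u′)) · v″ - c · ((u · v′ + v · u′ - b · (u · u′)) · u″)
    ≡ v · (v′ · v″ - c · (u′ · u″)) - c · (u · (u′ · v″ + v′ · u″ - b · (u′ · u″)))
  second = solve-∀

mulQ-comm : ∀ b c x y → mulQ b c x y ≡ mulQ b c y x
mulQ-comm b c (u , v) (u′ , v′) = cong₂ _,_ (first b u v u′ v′) (second c u v u′ v′)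
  where
  first : ∀ b u v u′ v′ → u · v′ + v · u′ - b · (u · u′) ≡ u′ · v + v′ · u - b · (u′ · u)
  first = solve-∀
  second : ∀ c u v u′ v′ → v · v′ - c · (u · u′) ≡ v′ · v - c · (u′ · u)
  second = solve-∀

mulQ-identityˡ : ∀ b c x → mulQ b c (+ 0 , + 1) x ≡ x
mulQ-identityˡ b c (u , v) = cong₂ _,_ (first b u v) (second c u v)
  where
  first : ∀ b u v → + 0 · v + + 1 · u - b · (+ 0 · u) ≡ u
  first = solve-∀
  second : ∀ c u v → + 1 · v - c · (+ 0 · u) ≡ v
  second = solve-∀

mulQ-distribˡ : ∀ b c x y z → mulQ b c x (y +₂ z) ≡ mulQ b c x y +₂ mulQ b c x z
mulQ-distribˡ b c (u , v) (u′ , v′) (u″ , v″) = cong₂ _,_ (first b u v u′ v′ u″ v″) (second c u v u′ v′ u″ v″)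
  where
  first : ∀ b u v u′ v′ u″ v″ → u · (v′ + v″) + v · (u′ + u″) - b · (u · (u′ + u″))
    ≡ u · v′ + v · u′ - b · (u · u′) + (u · v″ + v · u″ - b · (u · u″))
  first = solve-∀
  second : ∀ c u v u′ v′ u″ v″ → v · (v′ + v″) - c · (u · (u′ + u″)) ≡ v · v′ - c · (u · u′) + (v · v″ - c · (u · u″))
  second = solve-∀

mulQ-cong : ∀ {m} b c {x x′ y y′} → x ≋₂ x′ [ m ] → y ≋₂ y′ [ m ] → mulQ b c x y ≋₂ mulQ b c x′ y′ [ m ]
mulQ-cong b c (u , v) (u′ , v′) =
  minus-cong-≋ (+-cong-≋ (·-cong-≋ u v′) (·-cong-≋ v u′)) (·-cong-≋ (≡⇒≋ {b = b} refl) (·-cong-≋ u u′)) ,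
  minus-cong-≋ (·-cong-≋ v v′) (·-cong-≋ (≡⇒≋ {b = c} refl) (·-cong-≋ u u′))

quadRing : ℕ → ℤ → ℤ → CommutativeRing 0ℓ 0ℓ
quadRing m b c = record
  { Carrier = ℤ × ℤ ; _≈_ = _≋₂_[ m ] ; _+_ = _+₂_ ; _*_ = mulQ b c ; -_ = -₂_
  ; 0# = + 0 , + 0 ; 1# = + 0 , + 1
  ; isCommutativeRing = record
    { isRing = record
      { +-isAbelianGroup = record
        { isGroup = record
          { isMonoid = record
            { isSemigroup = record
              { isMagma = record
                { isEquivalence = record
                  { refl = ≡⇒≋₂ refl
                  ; sym = λ (e , f) → ≋-sym e , ≋-sym f
                  ; trans = λ (e , f) (e′ , f′) → ≋-trans e e′ , ≋-trans f f′ }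
                ; ∙-cong = λ (e , f) (e′ , f′) → +-cong-≋ e e′ , +-cong-≋ f f′ }
              ; assoc = λ (u , v) (u′ , v′) (u″ , v″) → ≡⇒≋ (ℤₚ.+-assoc u u′ u″) , ≡⇒≋ (ℤₚ.+-assoc v v′ v″) }
            ; identity = (λ (u , v) → ≡⇒≋ (ℤₚ.+-identityˡ u) , ≡⇒≋ (ℤₚ.+-identityˡ v))
                       , λ (u , v) → ≡⇒≋ (ℤₚ.+-identityʳ u) , ≡⇒≋ (ℤₚ.+-identityʳ v) }
          ; inverse = (λ (u , v) → ≡⇒≋ (ℤₚ.+-inverseˡ u) , ≡⇒≋ (ℤₚ.+-inverseˡ v))
                    , λ (u , v) → ≡⇒≋ (ℤₚ.+-inverseʳ u) , ≡⇒≋ (ℤₚ.+-inverseʳ v)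
          ; ⁻¹-cong = λ (e , f) → neg-cong-≋ e , neg-cong-≋ f }
        ; comm = λ (u , v) (u′ , v′) → ≡⇒≋ (ℤₚ.+-comm u u′) , ≡⇒≋ (ℤₚ.+-comm v v′) }
      ; *-cong = mulQ-cong b c
      ; *-assoc = λ x y z → ≡⇒≋₂ (mulQ-assoc b c x y z)
      ; *-identity = (λ x → ≡⇒≋₂ (mulQ-identityˡ b c x))
                   , λ x → ≡⇒≋₂ (trans (mulQ-comm b c x _) (mulQ-identityˡ b c x))
      ; distrib = (λ x y z → ≡⇒≋₂ (mulQ-distribˡ b c x y z))
                , λ x y z → ≡⇒≋₂ (trans (mulQ-comm b c (y +₂ z) x)
                    (trans (mulQ-distribˡ b c x y z) (cong₂ _+₂_ (mulQ-comm b c x y) (mulQ-comm b c x z)))) }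
    ; *-comm = λ x y → ≡⇒≋₂ (mulQ-comm b c x y) } }

-- Only the operation and its unit enter, so a power in `modRing m` or `quadRing m b c` is the same
-- term for every `m`, and one power can be compared modulo several numbers.
pow : ∀ {A : Set} → (A → A → A) → A → A → ℕ → A
pow _∙_ ε x zero    = ε
pow _∙_ ε x (suc k) = x ∙ pow _∙_ ε x k

module Powers (R : CommutativeRing 0ℓ 0ℓ) where
  open CommutativeRing R renaming (_+_ to _⊕_; _*_ to _⊛_; refl to ≈-refl; sym to ≈-sym; trans to ≈-trans)
    hiding (_-_; -_)
  open SemiringSolver commutativeSemiring using (solve; _:=_; _:+_; _:*_)
  open SetoidReasoning setoid

  infixr 8 _^_
  _^_ : Carrier → ℕ → Carrier
  _^_ = pow _⊛_ 1#

  ^-cong : ∀ {x y} → x ≈ y → ∀ k → x ^ k ≈ y ^ k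
  ^-cong e zero    = ≈-refl
  ^-cong e (suc k) = *-cong e (^-cong e k)

  ^-+ : ∀ x j k → x ^ (j ℕ.+ k) ≈ x ^ j ⊛ x ^ k
  ^-+ x zero    k = ≈-sym (*-identityˡ _)
  ^-+ x (suc j) k = ≈-trans (*-congˡ (^-+ x j k)) (≈-sym (*-assoc _ _ _))

  1^ : ∀ k → 1# ^ k ≈ 1#
  1^ zero    = ≈-refl
  1^ (suc k) = ≈-trans (*-identityˡ _) (1^ k)

  ^-* : ∀ x j k → x ^ (j * k) ≈ (x ^ k) ^ j
  ^-* x zero    k = ≈-refl
  ^-* x (suc j) k = ≈-trans (^-+ x k (j * k)) (*-congˡ (^-* x j k))

  fromℕ : ℕ → Carrier
  fromℕ zero    = 0#
  fromℕ (suc k) = 1# ⊕ fromℕ k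

  private
    -- Taylor expansion of the power at `b` with increment `q ⊛ z`: only the linear term is
    -- explicit, and `y` absorbs all terms of higher order, which contain one more factor `q`.
    binomial-second-order : ∀ {a b q z} → a ≈ b ⊕ q ⊛ z → ∀ k →
      ∃[ y ] (a ^ suc k ≈ b ^ suc k ⊕ (fromℕ (suc k) ⊛ b ^ k ⊕ q ⊛ y) ⊛ (q ⊛ z))
    binomial-second-order {a} {b} {q} {z} e zero = 0# , (begin
      a ⊛ 1#                                              ≈⟨ *-identityʳ a ⟩
      a                                                   ≈⟨ e ⟩
      b ⊕ q ⊛ z                                           ≈⟨ +-cong (*-identityʳ b) unit ⟨
      b ⊛ 1# ⊕ ((1# ⊕ 0#) ⊛ 1# ⊕ q ⊛ 0#) ⊛ (q ⊛ z)        ∎)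
      where
      unit : ((1# ⊕ 0#) ⊛ 1# ⊕ q ⊛ 0#) ⊛ (q ⊛ z) ≈ q ⊛ z
      unit = ≈-trans (*-congʳ (≈-trans (+-cong (≈-trans (*-identityʳ _) (+-identityʳ _)) (zeroʳ q)) (+-identityʳ _)))
                     (*-identityˡ _)
    binomial-second-order {a} {b} {q} {z} e (suc k) with binomial-second-order e k
    ... | y , ih = b ⊛ y ⊕ z ⊛ (n ⊛ b ^ k ⊕ q ⊛ y) , (begin
      a ⊛ a ^ suc k
        ≈⟨ *-cong e ih ⟩
      (b ⊕ q ⊛ z) ⊛ (b ⊛ b ^ k ⊕ (n ⊛ b ^ k ⊕ q ⊛ y) ⊛ (q ⊛ z))
        ≈⟨ solve 6 (λ b p n q y z →
             (b :+ q :* z) :* (b :* p :+ (n :* p :+ q :* y) :* (q :* z))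
             := b :* (b :* p) :+ (b :* p :+ n :* (b :* p) :+ q :* (b :* y :+ z :* (n :* p :+ q :* y))) :* (q :* z))
             ≈-refl b (b ^ k) n q y z ⟩
      b ⊛ b ^ suc k ⊕ (b ^ suc k ⊕ n ⊛ b ^ suc k ⊕ q ⊛ (b ⊛ y ⊕ z ⊛ (n ⊛ b ^ k ⊕ q ⊛ y))) ⊛ (q ⊛ z)
        ≈⟨ +-congˡ (*-congʳ (+-congʳ (≈-trans (+-congʳ (≈-sym (*-identityˡ _))) (≈-sym (distribʳ _ _ _))))) ⟩
      b ^ suc (suc k) ⊕ (fromℕ (suc (suc k)) ⊛ b ^ suc k ⊕ q ⊛ (b ⊛ y ⊕ z ⊛ (n ⊛ b ^ k ⊕ q ⊛ y))) ⊛ (q ⊛ z) ∎)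
      where
      n = fromℕ (suc k)

  -- The linear term gains a factor `π` from the exponent, the higher terms gain it from the extra
  -- `q`. The statement is over any commutative ring because it is applied both to ℤ and to its
  -- quadratic extensions.
  ^-lift : ∀ {a b q q′ z π w} N → fromℕ N ≈ π ⊛ w → q ≈ π ⊛ q′ → a ≈ b ⊕ q ⊛ z →
           ∃[ y ] (a ^ N ≈ b ^ N ⊕ (q ⊛ π) ⊛ y)
  ^-lift zero Nπ qπ e = 0# , ≈-sym (≈-trans (+-congˡ (zeroʳ _)) (+-identityʳ _))
  ^-lift {a} {b} {q} {q′} {z} {π} {w} (suc k) Nπ qπ e with binomial-second-order e k
  ... | y , eq = (w ⊛ b ^ k ⊕ q′ ⊛ y) ⊛ z , (begin
      a ^ suc k
        ≈⟨ eq ⟩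
      b ^ suc k ⊕ (fromℕ (suc k) ⊛ b ^ k ⊕ q ⊛ y) ⊛ (q ⊛ z)
        ≈⟨ +-congˡ (*-congʳ (+-cong (*-congʳ Nπ) (*-congʳ qπ))) ⟩
      b ^ suc k ⊕ ((π ⊛ w) ⊛ b ^ k ⊕ (π ⊛ q′) ⊛ y) ⊛ (q ⊛ z)
        ≈⟨ +-congˡ (solve 7 (λ w p q′ y q z π →
             ((π :* w) :* p :+ (π :* q′) :* y) :* (q :* z) := (q :* π) :* ((w :* p :+ q′ :* y) :* z))
             ≈-refl w (b ^ k) q′ y q z π) ⟩
      b ^ suc k ⊕ (q ⊛ π) ⊛ ((w ⊛ b ^ k ⊕ q′ ⊛ y) ⊛ z) ∎)

-- Cardinalities

abstract
  -- Keeping the leftover `zs` serves both pigeonhole arguments below: its length bounds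
  -- `length xs`, and if the lengths agree it is empty.
  unique-⊆⇒↭ : ∀ {A : Set} {xs ys : List A} → Unique xs → (∀ {x} → x ∈ xs → x ∈ ys) → ∃[ zs ] ys ↭ xs ++ zs
  unique-⊆⇒↭ {xs = []} {ys} [] _ = ys , ↭-refl
  unique-⊆⇒↭ {xs = x ∷ xs} (x∉ ∷ u) ⊆ with unique-⊆⇒↭ u (⊆ ∘ there)
  ... | zs , p with ∈ₚ.∈-++⁻ xs (↭ₚ.∈-resp-↭ p (⊆ (here refl)))
  ... | inj₁ x∈xs = contradiction refl (All.lookup x∉ x∈xs)
  ... | inj₂ x∈zs with ∈ₚ.∈-∃++ x∈zs
  ... | as , bs , refl = as ++ bs ,
    ↭-trans p (↭-trans (↭ₚ.++⁺ˡ xs (↭ₚ.shift x as bs)) (↭ₚ.shift x xs (as ++ bs)))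

  unique-⊆-length : ∀ {A : Set} {xs ys : List A} → Unique xs → (∀ {x} → x ∈ xs → x ∈ ys) → length xs ≤ length ys
  unique-⊆-length {xs = xs} u ⊆ with unique-⊆⇒↭ u ⊆
  ... | zs , p = subst (length xs ≤_) (sym (trans (↭ₚ.↭-length p) (Listₚ.length-++ xs))) (ℕₚ.m≤m+n _ _)

  unique-⊆-≥⇒↭ : ∀ {A : Set} {xs ys : List A} → Unique xs → (∀ {x} → x ∈ xs → x ∈ ys) →
                 length ys ≤ length xs → ys ↭ xs
  unique-⊆-≥⇒↭ {xs = xs} {ys} u ⊆ len with unique-⊆⇒↭ u ⊆
  ... | [] , p = ↭-trans p (↭ₚ.++-identityʳ xs)
  ... | z ∷ zs , p = contradiction len (ℕₚ.<⇒≱ (subst (length xs <_)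
    (sym (trans (↭ₚ.↭-length p) (Listₚ.length-++ xs))) (ℕₚ.m<m+n (length xs) (s≤s z≤n))))

  unique-map⁺ : ∀ {A B : Set} {f : A → B} {xs} →
    (∀ {x y} → x ∈ xs → y ∈ xs → f x ≡ f y → x ≡ y) → Unique xs → Unique (map f xs)
  unique-map⁺ inj [] = []
  unique-map⁺ {f = f} inj (_∷_ {x = x} {xs} x∉ u) = All.tabulate head ∷ unique-map⁺ (λ p q → inj (there p) (there q)) u
    where
    head : ∀ {y} → y ∈ map f xs → f x ≢ y
    head y∈ eq with ∈ₚ.∈-map⁻ f y∈
    ... | z , z∈ , refl = All.lookup x∉ z∈ (inj (here refl) (there z∈) eq)

  card-map : ∀ {A B : Set} {P : A → Set} {Q : B → Set} {k} (f : A → B) →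
    (∀ {x} → P x → Q (f x)) → (∀ {x y} → P x → P y → f x ≡ f y → x ≡ y) →
    (∀ {y} → Q y → ∃[ x ] (P x × f x ≡ y)) → HasCard P k → HasCard Q k
  card-map {Q = Q} f resp inj surj (xs , u , mem , len) = map f xs ,
    unique-map⁺ (λ p q → inj (to (mem _) p) (to (mem _) q)) u ,
    (λ y → mk⇔ (forth y) (back y)) , trans (Listₚ.length-map f xs) len
    where
    open Equivalence
    forth : ∀ y → y ∈ map f xs → Q y
    forth y y∈ with ∈ₚ.∈-map⁻ f y∈
    ... | x , x∈ , refl = resp (to (mem x) x∈)
    back : ∀ y → Q y → y ∈ map f xs
    back y qy with surj qy
    ... | x , px , refl = ∈ₚ.∈-map⁺ f (from (mem x) px)

  card-resp-⇔ : ∀ {A : Set} {P Q : A → Set} {k} → (∀ {x} → P x → Q x) → (∀ {x} → Q x → P x) → HasCard P k → HasCard Q k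
  card-resp-⇔ f g = card-map id f (λ _ _ e → e) (λ q → _ , g q , refl)

  card-⊎ : ∀ {A : Set} {P Q : A → Set} {j k} → (∀ {x} → P x → Q x → ⊥) →
    HasCard P j → HasCard Q k → HasCard (λ x → P x ⊎ Q x) (j ℕ.+ k)
  card-⊎ disj (xs , u , mem , refl) (ys , v , mem′ , refl) = xs ++ ys ,
    Uniqueₚ.++⁺ u v (λ (p , q) → disj (to (mem _) p) (to (mem′ _) q)) ,
    (λ x → mk⇔ (λ p → Sum.map (to (mem x)) (to (mem′ x)) (∈ₚ.∈-++⁻ xs p))
               Sum.[ (λ p → ∈ₚ.∈-++⁺ˡ (from (mem x) p)) , (λ q → ∈ₚ.∈-++⁺ʳ xs (from (mem′ x) q)) ]) ,
    Listₚ.length-++ xs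
    where open Equivalence

  length-cartesianProduct : ∀ {A B : Set} (xs : List A) (ys : List B) →
    length (cartesianProduct xs ys) ≡ length xs * length ys
  length-cartesianProduct []       ys = refl
  length-cartesianProduct (x ∷ xs) ys = trans (Listₚ.length-++ (map (x ,_) ys))
    (cong₂ ℕ._+_ (Listₚ.length-map (x ,_) ys) (length-cartesianProduct xs ys))

  card-× : ∀ {A B : Set} {P : A → Set} {Q : B → Set} {j k} →
    HasCard P j → HasCard Q k → HasCard (λ ((x , y) : A × B) → P x × Q y) (j * k)
  card-× (xs , u , mem , refl) (ys , v , mem′ , refl) = cartesianProduct xs ys ,
    Uniqueₚ.cartesianProduct⁺ u v ,
    (λ (x , y) → mk⇔
      (λ p → let q , r = ∈ₚ.∈-cartesianProduct⁻ xs ys p in to (mem x) q , to (mem′ y) r)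
      (λ (p , q) → ∈ₚ.∈-cartesianProduct⁺ (from (mem x) p) (from (mem′ y) q))) ,
    length-cartesianProduct xs ys
    where open Equivalence

  card-≤ : ∀ {A : Set} {P Q : A → Set} {j k} → HasCard P j → HasCard Q k → (∀ {x} → P x → Q x) → j ≤ k
  card-≤ (xs , u , mem , refl) (ys , v , mem′ , refl) f =
    unique-⊆-length u (λ p → from (mem′ _) (f (to (mem _) p)))
    where open Equivalence

  card-unique : ∀ {A : Set} {P : A → Set} {j k} → HasCard P j → HasCard P k → j ≡ k
  card-unique p q = ℕₚ.≤-antisym (card-≤ p q id) (card-≤ q p id)

  card-⊆-≡ : ∀ {A : Set} {P Q : A → Set} {k} → HasCard P k → HasCard Q k → (∀ {x} → P x → Q x) → ∀ {x} → Q x → P x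
  card-⊆-≡ (xs , u , mem , refl) (ys , v , mem′ , len) f q =
    to (mem _) (↭ₚ.∈-resp-↭ (unique-⊆-≥⇒↭ u (λ p → from (mem′ _) (f (to (mem _) p))) (ℕₚ.≤-reflexive len))
      (from (mem′ _) q))
    where open Equivalence

  card-empty : ∀ {A : Set} {P : A → Set} → (∀ {x} → ¬ P x) → HasCard P 0
  card-empty e = [] , [] , (λ x → mk⇔ (λ ()) (⊥-elim ∘ e)) , refl

  card-singleton : ∀ {A : Set} {P : A → Set} a → P a → (∀ {x} → P x → x ≡ a) → HasCard P 1
  card-singleton {P = P} a pa uniq = a ∷ [] , [] ∷ [] , (λ x → mk⇔ (λ { (here refl) → pa }) (here ∘ uniq)) , refl

  card-Fin : ∀ m → HasCard {Fin m} (λ _ → ⊤) m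
  card-Fin m = allFin m , Uniqueₚ.allFin⁺ m , (λ x → mk⇔ (λ _ → tt) (λ _ → ∈ₚ.∈-allFin x)) , Listₚ.length-tabulate id

  card-filter : ∀ {A : Set} {P Q : A → Set} {k} → HasCard P k → (∀ x → Dec (Q x)) → ∃[ j ] HasCard (λ x → P x × Q x) j
  card-filter {P = P} {Q} (xs , u , mem , len) Q? = _ , filter Q? xs , Uniqueₚ.filter⁺ Q? u ,
    (λ x → mk⇔ (λ p → let q , r = ∈ₚ.∈-filter⁻ Q? p in to (mem x) q , r)
               (λ (p , q) → ∈ₚ.∈-filter⁺ Q? (from (mem x) p) q)) , refl
    where open Equivalence

  card-split : ∀ {A : Set} {P Q : A → Set} {k} → HasCard P k → (∀ x → Dec (Q x)) →
    ∃[ i ] ∃[ j ] (HasCard (λ x → P x × Q x) i × HasCard (λ x → P x × ¬ Q x) j × i ℕ.+ j ≡ k)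
  card-split {P = P} {Q} p Q? with card-filter p Q? | card-filter p (λ x → ¬? (Q? x))
  ... | i , pi | j , pj = i , j , pi , pj ,
    card-unique (card-resp-⇔ Sum.[ proj₁ , proj₁ ] back (card-⊎ (λ (_ , q) (_ , ¬q) → ¬q q) pi pj)) p
    where
    back : ∀ {x} → P x → (P x × Q x) ⊎ (P x × ¬ Q x)
    back {x} px with Q? x
    ... | yes q = inj₁ (px , q)
    ... | no ¬q = inj₂ (px , ¬q)

  -- The involution `σ` is a bijection between the elements with `H` and those without, so `H`
  -- selects one element of each orbit. This counts unordered pairs, classes up to sign and
  -- conjugate pairs.
  card-half : ∀ {A : Set} {P H : A → Set} {k} (σ : A → A) → (∀ x → Dec (H x)) →
    (∀ {x} → P x → P (σ x)) → (∀ {x} → P x → σ (σ x) ≡ x) →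
    (∀ {x} → P x → H x → ¬ H (σ x)) → (∀ {x} → P x → ¬ H x → H (σ x)) →
    HasCard P k → ∃[ j ] (HasCard (λ x → P x × H x) j × 2 * j ≡ k)
  card-half {P = P} {H} σ H? resp invol to-¬H to-H p with card-split p H?
  ... | i , j , pi , pj , refl = i , pi ,
    cong₂ ℕ._+_ {i} refl (trans (ℕₚ.+-identityʳ i) (card-unique
      (card-map {P = λ x → P x × H x} {Q = λ x → P x × ¬ H x} σ
        (λ (px , h) → resp px , to-¬H px h)
        (λ (px , _) (py , _) e → trans (sym (invol px)) (trans (cong σ e) (invol py)))
        (λ {y} (py , ¬h) → σ y , (resp py , to-H py ¬h) , invol py)
        pi) pj))

  card-off-diagonal : ∀ {A : Set} {P : A → Set} {k} → (∀ (x y : A) → Dec (x ≡ y)) → HasCard P k →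
    HasCard (λ ((x , y) : A × A) → (P x × P y) × x ≢ y) (k * k ℕ.∸ k)
  card-off-diagonal {P = P} {k} _≟_ h with card-split (card-× h h) (λ (x , y) → x ≟ y)
  ... | i , j , hi , hj , i+j = subst (HasCard _)
    (trans (sym (ℕₚ.m+n∸m≡n i j)) (cong₂ ℕ._∸_ i+j (card-unique hi (card-map (λ x → x , x)
      (λ p → (p , p) , refl) (λ _ _ → cong proj₁) (λ { {x , .x} ((p , _) , refl) → x , p , refl }) h)))) hj

double⇒half : ∀ {k t} → 2 * k ≡ t → k ≡ t ℕ./ 2
double⇒half {k} refl = sym (trans (cong (ℕ._/ 2) (ℕₚ.*-comm 2 k)) (ℕDivMod.m*n/n≡m k 2))

-- Residues and units

≋-refl : ∀ {m a} → a ≋ a [ m ]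
≋-refl = ≡⇒≋ refl

≋⇒mod : ∀ {m a b} → a ≋ b [ m ] → a ≡ b [mod m ]
≋⇒mod {m} {a} {b} (by q e) = Signed.∣⇒∣ᵤ (Signed.divides q (trans (cong (_- b) e) (lemma b (q · + m))))
  where
  lemma : ∀ x y → x + y - x ≡ y
  lemma = solve-∀

mod⇒≋ : ∀ {m} a b → a ≡ b [mod m ] → a ≋ b [ m ]
mod⇒≋ {m} a b d with Signed.∣ᵤ⇒∣ {+ m} {a - b} d
... | Signed.divides q e = by q (trans (lemma a b) (cong (λ x → b + x) e))
  where
  lemma : ∀ x y → x ≡ y + (x - y)
  lemma = solve-∀

infix 4 _≋?_[_]
_≋?_[_] : ∀ a b m → Dec (a ≋ b [ m ])
a ≋? b [ m ] = Dec.map′ (mod⇒≋ a b) ≋⇒mod (m ℕ∣.∣? ∣ a - b ∣)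

≋-mod-∣ : ∀ {m m′ a b} → m ℕ∣.∣ m′ → a ≋ b [ m′ ] → a ≋ b [ m ]
≋-mod-∣ {m} {b = b} (ℕ∣.divides k refl) (by q e) = by (q · + k) (trans e (cong (λ x → b + x)
  (trans (cong (q ·_) (ℤₚ.pos-* k m)) (sym (ℤₚ.*-assoc q (+ k) (+ m))))))

≋₁ : ∀ {a b} → a ≋ b [ 1 ]
≋₁ {a} {b} = by (a - b) (lemma a b)
  where
  lemma : ∀ x y → x ≡ y + (x - y) · + 1
  lemma = solve-∀

∣⇒≋0 : ∀ {m a} → (+ m) ℤ∣.∣ a → a ≋ + 0 [ m ]
∣⇒≋0 {m} {a} d with Signed.∣ᵤ⇒∣ {+ m} {a} d
... | Signed.divides q e = by q (trans e (sym (ℤₚ.+-identityˡ _)))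

≋0⇒∣ : ∀ {m a} → a ≋ + 0 [ m ] → (+ m) ℤ∣.∣ a
≋0⇒∣ (by q e) = Signed.∣⇒∣ᵤ (Signed.divides q (trans e (ℤₚ.+-identityˡ _)))

m≋0 : ∀ m → + m ≋ + 0 [ m ]
m≋0 m = ∣⇒≋0 {m} {+ m} ℕ∣.∣-refl

minus≋0⇒≋ : ∀ {m a b} → a - b ≋ + 0 [ m ] → a ≋ b [ m ]
minus≋0⇒≋ {a = a} {b} e = ≋-trans (≡⇒≋ (lemma a b)) (≋-trans (+-cong-≋ e (≋-refl {a = b})) (≡⇒≋ (ℤₚ.+-identityˡ b)))
  where
  lemma : ∀ x y → x ≡ x - y + y
  lemma = solve-∀

≋⇒minus≋0 : ∀ {m a b} → a ≋ b [ m ] → a - b ≋ + 0 [ m ]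
≋⇒minus≋0 {b = b} e = ≋-trans (minus-cong-≋ e (≋-refl {a = b})) (≡⇒≋ (ℤₚ.+-inverseʳ b))

ι : ∀ {m} → Fin m → ℤ
ι i = + toℕ i

residue : ∀ m .{{_ : ℕ.NonZero m}} → ℤ → Fin m
residue m a = Fin.fromℕ< (ℤDivMod.n%ℕd<d a m)

ι-residue : ∀ m .{{_ : ℕ.NonZero m}} a → ι (residue m a) ≋ a [ m ]
ι-residue m a = ≋-sym (by (a ℤDivMod./ℕ m)
  (trans (ℤDivMod.a≡a%ℕn+[a/ℕn]*n a m)
         (cong (λ x → + x + (a ℤDivMod./ℕ m) · + m) (sym (Finₚ.toℕ-fromℕ< (ℤDivMod.n%ℕd<d a m))))))

private
  toℕ-≤-∣⇒≡ : ∀ {m} (i j : Fin m) → toℕ j ≤ toℕ i → m ℕ∣.∣ ∣ ι i - ι j ∣ → toℕ i ≡ toℕ j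
  toℕ-≤-∣⇒≡ {m} i j j≤i d with toℕ i ℕ.∸ toℕ j in eq
  ... | zero = ℕₚ.≤-antisym (ℕₚ.m∸n≡0⇒m≤n eq) j≤i
  ... | suc k = contradiction (subst (m ℕ∣.∣_) abs d) (ℕ∣.>⇒∤ (subst (_< m) eq
    (ℕₚ.≤-<-trans (ℕₚ.m∸n≤m (toℕ i) (toℕ j)) (Finₚ.toℕ<n i))))
    where
    abs : ∣ ι i - ι j ∣ ≡ suc k
    abs = trans (cong ∣_∣ (trans (ℤₚ.m-n≡m⊖n (toℕ i) (toℕ j)) (ℤₚ.⊖-≥ j≤i))) eq

ι-injective : ∀ {m} {i j : Fin m} → ι i ≋ ι j [ m ] → i ≡ j
ι-injective {m} {i} {j} e with ℕₚ.≤-total (toℕ j) (toℕ i)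
... | inj₁ j≤i = Finₚ.toℕ-injective (toℕ-≤-∣⇒≡ i j j≤i (≋⇒mod e))
... | inj₂ i≤j = Finₚ.toℕ-injective (sym (toℕ-≤-∣⇒≡ j i i≤j (≋⇒mod (≋-sym e))))

-- Invertibility stands in for coprimality to `m`, since an explicit inverse passes to congruent
-- numbers, products and divisors of `m` by plain algebra.
record Unit (m : ℕ) (a : ℤ) : Set where
  constructor unit
  field
    inverse   : ℤ
    inverse-· : inverse · a ≋ + 1 [ m ]

Unit-resp-≋ : ∀ {m a b} → a ≋ b [ m ] → Unit m a → Unit m b
Unit-resp-≋ e (unit x h) = unit x (≋-trans (·-cong-≋ (≋-refl {a = x}) (≋-sym e)) h)

Unit-1 : ∀ {m} → Unit m (+ 1)
Unit-1 = unit (+ 1) ≋-refl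

Unit-· : ∀ {m a b} → Unit m a → Unit m b → Unit m (a · b)
Unit-· {a = a} {b} (unit x h) (unit y k) = unit (x · y) (≋-trans (≡⇒≋ (lemma x y a b)) (·-cong-≋ h k))
  where
  lemma : ∀ x y a b → x · y · (a · b) ≡ (x · a) · (y · b)
  lemma = solve-∀

Unit-·ˡ : ∀ {m} a b → Unit m (a · b) → Unit m a
Unit-·ˡ a b (unit x h) = unit (x · b) (≋-trans (≡⇒≋ (lemma x a b)) h)
  where
  lemma : ∀ x a b → x · b · a ≡ x · (a · b)
  lemma = solve-∀

Unit-·ʳ : ∀ {m} a b → Unit m (a · b) → Unit m b
Unit-·ʳ {m} a b u = Unit-·ˡ b a (subst (Unit m) (ℤₚ.*-comm a b) u)

Unit-mod-∣ : ∀ {m m′ a} → m ℕ∣.∣ m′ → Unit m′ a → Unit m a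
Unit-mod-∣ d (unit x h) = unit x (≋-mod-∣ d h)

-- If x a = 1 + q m and y a = 1 + r m′ then (1 - x a)(1 - y a) = 0 modulo m m′.
Unit-mod-* : ∀ {m m′ a} → Unit m a → Unit m′ a → Unit (m * m′) a
Unit-mod-* {m} {m′} {a} (unit x (by q e)) (unit y (by r f)) = unit (x + y - x · (y · a)) (by (- (q · r)) (begin
  (x + y - x · (y · a)) · a                     ≡⟨ expand x y a ⟩
  x · a + y · a - (x · a) · (y · a)             ≡⟨ cong₂ (λ s t → s + t - s · t) e f ⟩
  (+ 1 + q · + m) + (+ 1 + r · + m′) - (+ 1 + q · + m) · (+ 1 + r · + m′)
                                                ≡⟨ collect q r (+ m) (+ m′) ⟩
  + 1 + - (q · r) · (+ m · + m′)                ≡⟨ cong (λ z → + 1 + - (q · r) · z) (ℤₚ.pos-* m m′) ⟨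
  + 1 + - (q · r) · + (m * m′)                  ∎))
  where
  open ≡-Reasoning
  expand : ∀ x y a → (x + y - x · (y · a)) · a ≡ x · a + y · a - (x · a) · (y · a)
  expand = solve-∀
  collect : ∀ q r m n → (+ 1 + q · m) + (+ 1 + r · n) - (+ 1 + q · m) · (+ 1 + r · n) ≡ + 1 + - (q · r) · (m · n)
  collect = solve-∀

Unit-mod-^ : ∀ {m a} r → Unit m a → Unit (m ℕ.^ r) a
Unit-mod-^ zero    u = unit (+ 0) ≋₁
Unit-mod-^ (suc r) u = Unit-mod-* u (Unit-mod-^ r u)

·-cancelˡ-≋ : ∀ {m a} x y → Unit m a → a · x ≋ a · y [ m ] → x ≋ y [ m ]
·-cancelˡ-≋ {m} {a} x y (unit a⁻¹ h) e = ≋-trans (≋-sym (simplify x)) (≋-trans (·-cong-≋ (≋-refl {a = a⁻¹}) e) (simplify y))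
  where
  simplify : ∀ z → a⁻¹ · (a · z) ≋ z [ m ]
  simplify z = ≋-trans (≡⇒≋ (sym (ℤₚ.*-assoc a⁻¹ a z)))
    (≋-trans (·-cong-≋ h (≋-refl {a = z})) (≡⇒≋ (ℤₚ.*-identityˡ z)))

·-cancelˡ-≋0 : ∀ {m a} x → Unit m a → a · x ≋ + 0 [ m ] → x ≋ + 0 [ m ]
·-cancelˡ-≋0 {a = a} x u e = ·-cancelˡ-≋ x (+ 0) u (≋-trans e (≡⇒≋ (sym (ℤₚ.*-zeroʳ a))))

private
  Unit-+∣∣ : ∀ {m} a → Unit m (+ ∣ a ∣) → Unit m a
  Unit-+∣∣ (+ n) u = u
  Unit-+∣∣ {m} a@(ℤ.-[1+ n ]) (unit x h) = unit (- x) (≋-trans (≡⇒≋ (lemma x (+ suc n))) h)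
    where
    lemma : ∀ x y → - x · - y ≡ x · y
    lemma = solve-∀

  bézout⇒Unit : ∀ {m n} → ℕGCD.Bézout.Identity 1 m n → Unit m (+ n)
  bézout⇒Unit {m} {n} (ℕGCD.Bézout.+- x y eq) = unit (- (+ y)) (by (- (+ x)) (begin
    - (+ y) · + n             ≡⟨ lemma (+ y) (+ n) ⟩
    + 1 + - (+ 1 + + y · + n) ≡⟨ cong (λ z → + 1 + - z) lifted ⟩
    + 1 + - (+ x · + m)       ≡⟨ cong (λ z → + 1 + z) (ℤₚ.neg-distribˡ-* (+ x) (+ m)) ⟩
    + 1 + - (+ x) · + m       ∎))
    where
    open ≡-Reasoning
    lifted : + 1 + + y · + n ≡ + x · + m
    lifted = trans (cong (λ z → + 1 + z) (sym (ℤₚ.pos-* y n))) (trans (cong +_ eq) (ℤₚ.pos-* x m))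
    lemma : ∀ y n → - y · n ≡ + 1 + - (+ 1 + y · n)
    lemma = solve-∀
  bézout⇒Unit {m} {n} (ℕGCD.Bézout.-+ x y eq) = unit (+ y) (by (+ x) (begin
    + y · + n         ≡⟨ ℤₚ.pos-* y n ⟨
    + (y * n)         ≡⟨ cong +_ eq ⟨
    + 1 + + (x * m)   ≡⟨ cong (λ z → + 1 + z) (ℤₚ.pos-* x m) ⟩
    + 1 + + x · + m   ∎))
    where open ≡-Reasoning

coprime⇒Unit : ∀ {m} a → Coprime.Coprime m ∣ a ∣ → Unit m a
coprime⇒Unit a c = Unit-+∣∣ a (bézout⇒Unit (Coprime.coprime-Bézout c))

Unit⇒coprime : ∀ {m} a → Unit m a → Coprime.Coprime m ∣ a ∣
Unit⇒coprime {m} a (unit x (by q e)) {d} (d∣m , d∣a) = ℕ∣.∣1⇒≡1 (Signed.∣⇒∣ᵤ {+ d} {+ 1}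
  (subst (+ d Signed.∣_) (trans (cong (_- q · + m) e) (lemma (q · + m)))
    (Signed.∣m∣n⇒∣m-n (Signed.∣n⇒∣m*n x (Signed.∣ᵤ⇒∣ {+ d} {a} d∣a)) (Signed.∣n⇒∣m*n q (Signed.∣ᵤ⇒∣ {+ d} {+ m} d∣m)))))
  where
  lemma : ∀ y → + 1 + y - y ≡ + 1
  lemma = solve-∀

prime-∤⇒Unit : ∀ {p} → Prime p → ∀ a → ¬ (a ≋ + 0 [ p ]) → Unit p a
prime-∤⇒Unit {p} pp a ≢0 = coprime⇒Unit a cop
  where
  cop : Coprime.Coprime p ∣ a ∣
  cop {d} (d∣p , d∣a) with Primality.prime⇒irreducible pp d∣p
  ... | inj₁ d≡1  = d≡1
  ... | inj₂ refl = contradiction (∣⇒≋0 {p} {a} d∣a) ≢0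

Unit⇒≢0 : ∀ {p a} → Prime p → Unit p a → ¬ (a ≋ + 0 [ p ])
Unit⇒≢0 {p} pp (unit x h) e = Primality.¬prime[1] (subst Prime (ℕ∣.∣1⇒≡1 p∣1) pp)
  where
  p∣1 : p ℕ∣.∣ 1
  p∣1 = ≋0⇒∣ {p} {+ 1} (≋-trans (≋-sym h) (≋-trans (·-cong-≋ (≋-refl {a = x}) e) (≡⇒≋ (ℤₚ.*-zeroʳ x))))

module _ {m m′ : ℕ} (m-unit : Unit m′ (+ m)) where
  -- If a = b + q m, the second congruence says that m′ divides m q, and so q, because m is
  -- invertible modulo m′.
  ≋-mod-* : ∀ {a b} → a ≋ b [ m ] → a ≋ b [ m′ ] → a ≋ b [ m * m′ ]
  ≋-mod-* {a} {b} (by q e) f with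
    ·-cancelˡ-≋0 q m-unit (≋-trans (≡⇒≋ (trans (lemma b q (+ m)) (cong (_- b) (sym e)))) (≋⇒minus≋0 f))
    where
    lemma : ∀ b q m → m · q ≡ b + q · m - b
    lemma = solve-∀
  ... | by r refl = by r (trans e (cong (λ x → b + x) (trans (lemma r (+ m) (+ m′)) (cong (r ·_) (sym (ℤₚ.pos-* m m′))))))
    where
    lemma : ∀ r m n → (+ 0 + r · n) · m ≡ r · (m · n)
    lemma = solve-∀

  -- x m ≡ 1 modulo m′, so a + (b - a) x m is a modulo m and b modulo m′.
  crt : ℤ → ℤ → ℤ
  crt a b = a + (b - a) · (Unit.inverse m-unit · + m)

  crt-≋ˡ : ∀ a b → crt a b ≋ a [ m ]
  crt-≋ˡ a b = by ((b - a) · Unit.inverse m-unit) (cong (λ x → a + x) (sym (ℤₚ.*-assoc (b - a) _ (+ m))))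

  crt-≋ʳ : ∀ a b → crt a b ≋ b [ m′ ]
  crt-≋ʳ a b = ≋-trans (+-cong-≋ (≋-refl {a = a}) (·-cong-≋ (≋-refl {a = b - a}) (Unit.inverse-· m-unit))) (≡⇒≋ (lemma a b))
    where
    lemma : ∀ a b → a + (b - a) · + 1 ≡ b
    lemma = solve-∀

-- Powers of X modulo a quadratic

-- X^k reduced modulo X² + b X + c.
X^mod : ℤ → ℤ → ℕ → ℤ × ℤ
X^mod b c zero    = + 0 , + 1
X^mod b c (suc k) = let u , v = X^mod b c k in v - b · u , - (c · u)

-- The exponent `N` is separate from the modulus `m`: it remains n while `m` runs through divisors
-- of n.
Fixed : ℕ → ℕ → ℤ → ℤ → Set
Fixed N m b c = X^mod b c N ≋₂ (+ 1 , + 0) [ m ]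

≋₂-trans : ∀ {m x y z} → x ≋₂ y [ m ] → y ≋₂ z [ m ] → x ≋₂ z [ m ]
≋₂-trans (e , f) (e′ , f′) = ≋-trans e e′ , ≋-trans f f′

≋₂-sym : ∀ {m x y} → x ≋₂ y [ m ] → y ≋₂ x [ m ]
≋₂-sym (e , f) = ≋-sym e , ≋-sym f

≋₂-mod-∣ : ∀ {m m′ x y} → m ℕ∣.∣ m′ → x ≋₂ y [ m′ ] → x ≋₂ y [ m ]
≋₂-mod-∣ d (e , f) = ≋-mod-∣ d e , ≋-mod-∣ d f

X^mod-cong : ∀ {m b b′ c c′} → b ≋ b′ [ m ] → c ≋ c′ [ m ] → ∀ k → X^mod b c k ≋₂ X^mod b′ c′ k [ m ]
X^mod-cong eb ec zero    = ≋-refl , ≋-refl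
X^mod-cong eb ec (suc k) = let eu , ev = X^mod-cong eb ec k in
  minus-cong-≋ ev (·-cong-≋ eb eu) , neg-cong-≋ (·-cong-≋ ec eu)

Fixed-resp-≋ : ∀ {N m b b′ c c′} → b ≋ b′ [ m ] → c ≋ c′ [ m ] → Fixed N m b c → Fixed N m b′ c′
Fixed-resp-≋ {N} eb ec f = ≋₂-trans (≋₂-sym (X^mod-cong eb ec N)) f

trace : ℤ → ℤ × ℤ → ℤ
trace b (u , v) = + 2 · v - b · u

norm : ℤ → ℤ → ℤ × ℤ → ℤ
norm b c (u , v) = v · v - b · (u · v) + c · (u · u)

norm-cong : ∀ {m} b c {x y} → x ≋₂ y [ m ] → norm b c x ≋ norm b c y [ m ]
norm-cong b c (eu , ev) = +-cong-≋ (minus-cong-≋ (·-cong-≋ ev ev) (·-cong-≋ (≋-refl {a = b}) (·-cong-≋ eu ev)))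
  (·-cong-≋ (≋-refl {a = c}) (·-cong-≋ eu eu))

trace-cong : ∀ {m} b {x y} → x ≋₂ y [ m ] → trace b x ≋ trace b y [ m ]
trace-cong b (eu , ev) = minus-cong-≋ (·-cong-≋ (≋-refl {a = + 2}) ev) (·-cong-≋ (≋-refl {a = b}) eu)

powQ : ℤ → ℤ → ℤ × ℤ → ℕ → ℤ × ℤ
powQ b c = pow (mulQ b c) (+ 0 , + 1)

infixr 8 _^ᶻ_
_^ᶻ_ : ℤ → ℕ → ℤ
_^ᶻ_ = pow _·_ (+ 1)

X^mod-powQ : ∀ b c k → X^mod b c k ≡ powQ b c (+ 1 , + 0) k
X^mod-powQ b c zero    = refl
X^mod-powQ b c (suc k) rewrite sym (X^mod-powQ b c k) = let u , v = X^mod b c k in cong₂ _,_ (first b u v) (second c u v)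
  where
  first : ∀ b u v → v - b · u ≡ + 1 · v + + 0 · u - b · (+ 1 · u)
  first = solve-∀
  second : ∀ c u v → - (c · u) ≡ + 0 · v - c · (+ 1 · u)
  second = solve-∀

-- Cayley–Hamilton: α = u X + v is a root of T² - trace(α) T + norm(α).
powQ-X^mod : ∀ b c u v k → let e , f = X^mod (- trace b (u , v)) (norm b c (u , v)) k in
  powQ b c (u , v) k ≡ (u · e , v · e + f)
powQ-X^mod b c u v zero = cong₂ _,_ (sym (ℤₚ.*-zeroʳ u)) (lemma v)
  where
  lemma : ∀ v → + 1 ≡ v · + 0 + + 1
  lemma = solve-∀
powQ-X^mod b c u v (suc k) rewrite powQ-X^mod b c u v k =
  let e , f = X^mod (- trace b (u , v)) (norm b c (u , v)) k in cong₂ _,_ (first b u v e f) (second b c u v e f)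
  where
  first : ∀ b u v e f → u · (v · e + f) + v · (u · e) - b · (u · (u · e)) ≡ u · (f - - (+ 2 · v - b · u) · e)
  first = solve-∀
  second : ∀ b c u v e f → v · (v · e + f) - c · (u · (u · e))
    ≡ v · (f - - (+ 2 · v - b · u) · e) + - ((v · v - b · (u · v) + c · (u · u)) · e)
  second = solve-∀

-- For invertible `u` the elements 1 and α = u X + v form a basis, so α^N = α can be compared
-- coefficientwise with T^N = e T + f modulo the characteristic polynomial of α.
powQ-fixed⇒Fixed : ∀ {m} N b c u v → Unit m u → powQ b c (u , v) N ≋₂ (u , v) [ m ] →
  Fixed N m (- trace b (u , v)) (norm b c (u , v))
powQ-fixed⇒Fixed {m} N b c u v u-unit h with X^mod (- trace b (u , v)) (norm b c (u , v)) N
  | subst (_≋₂ (u , v) [ m ]) (powQ-X^mod b c u v N) h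
... | e , f | he , hf = e≋1 , f≋0
  where
  e≋1 : e ≋ + 1 [ m ]
  e≋1 = ·-cancelˡ-≋ e (+ 1) u-unit (≋-trans he (≡⇒≋ (sym (ℤₚ.*-identityʳ u))))
  lemma : ∀ v e f → f ≡ v · e + f - v · e
  lemma = solve-∀
  lemma′ : ∀ v → v - v · + 1 ≡ + 0
  lemma′ = solve-∀
  f≋0 : f ≋ + 0 [ m ]
  f≋0 = ≋-trans (≡⇒≋ (lemma v e f)) (≋-trans (minus-cong-≋ hf (·-cong-≋ (≋-refl {a = v}) e≋1)) (≡⇒≋ (lemma′ v)))

Fixed⇒powQ-fixed : ∀ {m} N b c u v → Fixed N m (- trace b (u , v)) (norm b c (u , v)) →
  powQ b c (u , v) N ≋₂ (u , v) [ m ]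
Fixed⇒powQ-fixed {m} N b c u v (he , hf) = subst (_≋₂ (u , v) [ m ]) (sym (powQ-X^mod b c u v N))
  ( ≋-trans (·-cong-≋ (≋-refl {a = u}) he) (≡⇒≋ (ℤₚ.*-identityʳ u))
  , ≋-trans (+-cong-≋ (·-cong-≋ (≋-refl {a = v}) he) hf) (≡⇒≋ (lemma v)))
  where
  lemma : ∀ v → v · + 1 + + 0 ≡ v
  lemma = solve-∀

-- A root θ defines the homomorphism X ↦ θ on the quotient ring; it is applied here to X^k = e X +
-- f.
root-pow : ∀ {m b c} θ → θ · θ + b · θ + c ≋ + 0 [ m ] → ∀ k →
  let e , f = X^mod b c k in θ ^ᶻ k ≋ e · θ + f [ m ]
root-pow {m} θ h zero = ≡⇒≋ (lemma θ)
  where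
  lemma : ∀ θ → + 1 ≡ + 0 · θ + + 1
  lemma = solve-∀
root-pow {m} {b} {c} θ h (suc k) = let e , f = X^mod b c k in
  ≋-trans (·-cong-≋ (≋-refl {a = θ}) (root-pow θ h k))
  (≋-trans (≡⇒≋ (lemma b c θ e f))
  (≋-trans (+-cong-≋ (·-cong-≋ (≋-refl {a = e}) h) (≋-refl {a = (f - b · e) · θ + - (c · e)}))
           (≡⇒≋ (lemma′ ((f - b · e) · θ + - (c · e)) e))))
  where
  lemma : ∀ b c θ e f → θ · (e · θ + f) ≡ e · (θ · θ + b · θ + c) + ((f - b · e) · θ + - (c · e))
  lemma = solve-∀
  lemma′ : ∀ x e → e · + 0 + x ≡ x
  lemma′ = solve-∀

norm-mulQ : ∀ b c x y → norm b c (mulQ b c x y) ≡ norm b c x · norm b c y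
norm-mulQ b c (u , v) (u′ , v′) = lemma b c u v u′ v′
  where
  lemma : ∀ b c u v u′ v′ →
    (v · v′ - c · (u · u′)) · (v · v′ - c · (u · u′))
      - b · ((u · v′ + v · u′ - b · (u · u′)) · (v · v′ - c · (u · u′)))
      + c · ((u · v′ + v · u′ - b · (u · u′)) · (u · v′ + v · u′ - b · (u · u′)))
    ≡ (v · v - b · (u · v) + c · (u · u)) · (v′ · v′ - b · (u′ · v′) + c · (u′ · u′))
  lemma = solve-∀

norm-powQ : ∀ b c x k → norm b c (powQ b c x k) ≡ norm b c x ^ᶻ k
norm-powQ b c x zero = lemma b c
  where
  lemma : ∀ b c → + 1 · + 1 - b · (+ 0 · + 1) + c · (+ 0 · + 0) ≡ + 1
  lemma = solve-∀
norm-powQ b c x (suc k) = trans (norm-mulQ b c x (powQ b c x k)) (cong (norm b c x ·_) (norm-powQ b c x k))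

-- The norm is multiplicative and X has norm `c`. Thus the norm of X^N depends on `c` alone and is
-- an integer power, to which `^-lift-≋` applies.
norm-X^mod : ∀ b c k → norm b c (X^mod b c k) ≡ c ^ᶻ k
norm-X^mod b c k = trans (cong (norm b c) (X^mod-powQ b c k))
  (trans (norm-powQ b c (+ 1 , + 0) k) (cong (_^ᶻ k) (lemma b c)))
  where
  lemma : ∀ b c → + 0 · + 0 - b · (+ 1 · + 0) + c · (+ 1 · + 1) ≡ c
  lemma = solve-∀

module ℤ^ = Powers (modRing 0)

fromℕ-ℤ : ∀ k → ℤ^.fromℕ k ≡ + k
fromℕ-ℤ zero    = refl
fromℕ-ℤ (suc k) = cong (λ x → + 1 + x) (fromℕ-ℤ k)

≋[0]⇒≡ : ∀ {a b} → a ≋ b [ 0 ] → a ≡ b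
≋[0]⇒≡ {b = b} (by q e) = trans e (trans (cong (λ x → b + x) (ℤₚ.*-zeroʳ q)) (ℤₚ.+-identityʳ b))

private
  ∣⇒pos-· : ∀ {π q} → (d : π ℕ∣.∣ q) → + q ≡ + π · + ℕ∣.quotient d
  ∣⇒pos-· {π} (ℕ∣.divides w refl) = trans (ℤₚ.pos-* w π) (ℤₚ.*-comm (+ w) (+ π))

module _ {π q N : ℕ} (π∣q : π ℕ∣.∣ q) (π∣N : π ℕ∣.∣ N) where
  private
    pos-*-comm : + q · + π ≡ + (π * q)
    pos-*-comm = trans (ℤₚ.*-comm (+ q) (+ π)) (sym (ℤₚ.pos-* π q))

  ^-lift-≋ : ∀ {a b} → a ≋ b [ q ] → a ^ᶻ N ≋ b ^ᶻ N [ π * q ]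
  ^-lift-≋ {a} {b} (by z e) with ℤ^.^-lift {a = a} {b} {+ q} {z = z} N
      (≡⇒≋ (trans (fromℕ-ℤ N) (∣⇒pos-· π∣N))) (≡⇒≋ (∣⇒pos-· π∣q))
      (≡⇒≋ (trans e (cong (λ x → b + x) (ℤₚ.*-comm z (+ q)))))
  ... | y , h = by y (trans (≋[0]⇒≡ h) (cong (λ x → b ^ᶻ N + x)
    (trans (ℤₚ.*-comm (+ q · + π) y) (cong (y ·_) pos-*-comm))))

  private
    scalar-mulQ : ∀ b c s u v → mulQ b c (+ 0 , s) (u , v) ≡ (s · u , s · v)
    scalar-mulQ b c s u v = cong₂ _,_ (first b s u v) (second c s u v)
      where
      first : ∀ b s u v → + 0 · v + s · u - b · (+ 0 · u) ≡ s · u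
      first = solve-∀
      second : ∀ c s u v → s · v - c · (+ 0 · u) ≡ s · v
      second = solve-∀

  -- The same gain of a factor π as for integers, now in ℤ[X]/(X² + bX + c), where an integer s
  -- enters as the pair (0 , s).
  powQ-lift-≋₂ : ∀ b c {x y} → x ≋₂ y [ q ] → powQ b c x N ≋₂ powQ b c y N [ π * q ]
  powQ-lift-≋₂ b c {x₁ , x₂} {y₁ , y₂} (by z₁ e₁ , by z₂ e₂) =
    let (w₁ , w₂) , h₁ , h₂ = Q^.^-lift {a = x₁ , x₂} {y₁ , y₂} {+ 0 , + q} {+ 0 , + ℕ∣.quotient π∣q} {z₁ , z₂} {+ 0 , + π} {+ 0 , + ℕ∣.quotient π∣N} N
          (≡⇒≋₂ (trans (fromℕ-Q N) (scalar≡ (+ π) (+ ℕ∣.quotient π∣N) (∣⇒pos-· π∣N)))) (≡⇒≋₂ (scalar≡ (+ π) (+ ℕ∣.quotient π∣q) (∣⇒pos-· π∣q)))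
          (≡⇒≋₂ (cong₂ _,_ (trans e₁ (cong (λ x → y₁ + x) (first z₁ z₂)))
                           (trans e₂ (cong (λ x → y₂ + x) (second z₁ z₂)))))
        result : ∀ w w′ → mulQ b c (mulQ b c (+ 0 , + q) (+ 0 , + π)) (w , w′) ≡ (w · + (π * q) , w′ · + (π * q))
        result w w′ = trans (cong (λ s → mulQ b c s (w , w′)) (sym (scalar≡ (+ q) (+ π) refl)))
          (trans (scalar-mulQ b c (+ q · + π) w w′)
            (cong₂ _,_ (trans (ℤₚ.*-comm (+ q · + π) w) (cong (w ·_) pos-*-comm))
                       (trans (ℤₚ.*-comm (+ q · + π) w′) (cong (w′ ·_) pos-*-comm))))
    in by w₁ (trans (≋[0]⇒≡ h₁) (cong (λ x → proj₁ (powQ b c (y₁ , y₂) N) + x) (cong proj₁ (result w₁ w₂)))) ,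
       by w₂ (trans (≋[0]⇒≡ h₂) (cong (λ x → proj₂ (powQ b c (y₁ , y₂) N) + x) (cong proj₂ (result w₁ w₂))))
    where
    module Q^ = Powers (quadRing 0 b c)
    fromℕ-Q : ∀ k → Q^.fromℕ k ≡ (+ 0 , + k)
    fromℕ-Q zero    = refl
    fromℕ-Q (suc k) = cong ((+ 0 , + 1) +₂_) (fromℕ-Q k)
    scalar≡ : ∀ {s} t r → s ≡ t · r → (+ 0 , s) ≡ mulQ b c (+ 0 , t) (+ 0 , r)
    scalar≡ t r refl = sym (trans (scalar-mulQ b c t (+ 0) r) (cong (_, t · r) (ℤₚ.*-zeroʳ t)))
    first : ∀ z₁ z₂ → z₁ · + q ≡ proj₁ (mulQ b c (+ 0 , + q) (z₁ , z₂))
    first z₁ z₂ = trans (ℤₚ.*-comm z₁ (+ q)) (sym (cong proj₁ (scalar-mulQ b c (+ q) z₁ z₂)))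
    second : ∀ z₁ z₂ → z₂ · + q ≡ proj₂ (mulQ b c (+ 0 , + q) (z₁ , z₂))
    second z₁ z₂ = trans (ℤₚ.*-comm z₂ (+ q)) (sym (cong proj₂ (scalar-mulQ b c (+ q) z₁ z₂)))

-- Lifting solutions to prime powers

-- The companion Lucas sequence V_k with parameters P = -b and Q = c, that is, the sum of the k-th
-- powers of the two roots. The first component of `X^mod b c k` is the sequence U_k.
lucasV : ℤ → ℤ → ℕ → ℤ
lucasV b c k = trace b (X^mod b c k)

lucasV-rec : ∀ b c k → lucasV b c (suc (suc k)) ≡ - (b · lucasV b c (suc k)) - c · lucasV b c k
lucasV-rec b c k = let e , f = X^mod b c k in lemma b c e f
  where
  lemma : ∀ b c e f → + 2 · - (c · (f - b · e)) - b · (- (c · e) - b · (f - b · e))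
    ≡ - (b · (+ 2 · - (c · e) - b · (f - b · e))) - c · (+ 2 · f - b · e)
  lemma = solve-∀

-- The derivative of lucasV at (b , c) in the direction (β , γ); that it is a multiple
-- of k is what makes lucasV, like the k-th power, contract congruences modulo divisors of k.
lucasV′ : ℤ → ℤ → ℤ → ℤ → ℕ → ℤ
lucasV′ b c β γ zero    = + 0
lucasV′ b c β γ (suc k) = - (+ suc k · (proj₁ (X^mod b c (suc k)) · β + proj₁ (X^mod b c k) · γ))

-- This is `lucasV-rec` differentiated along (β , γ). It justifies the closed form -k (U_k β +
-- U_(k-1) γ), from which divisibility by k can be read off.
lucasV′-rec : ∀ b c β γ k → lucasV′ b c β γ (suc (suc k)) ≡
  - (b · lucasV′ b c β γ (suc k)) - c · lucasV′ b c β γ k - β · lucasV b c (suc k) - γ · lucasV b c k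
lucasV′-rec b c β γ zero = lemma b c β γ
  where
  lemma : ∀ b c β γ → - (+ 2 · ((- (c · + 0) - b · (+ 1 - b · + 0)) · β + (+ 1 - b · + 0) · γ)) ≡
    - (b · - (+ 1 · ((+ 1 - b · + 0) · β + + 0 · γ))) - c · + 0
      - β · (+ 2 · - (c · + 0) - b · (+ 1 - b · + 0)) - γ · (+ 2 · + 1 - b · + 0)
  lemma = solve-∀
lucasV′-rec b c β γ (suc k) = let e , f = X^mod b c k in lemma b c β γ e f (+ k)
  where
  lemma : ∀ b c β γ e f n →
    - ((+ 3 + n) · ((- (c · (f - b · e)) - b · (- (c · e) - b · (f - b · e))) · β + (- (c · e) - b · (f - b · e)) · γ)) ≡
    - (b · - ((+ 2 + n) · ((- (c · e) - b · (f - b · e)) · β + (f - b · e) · γ)))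
      - c · - ((+ 1 + n) · ((f - b · e) · β + e · γ))
      - β · (+ 2 · - (c · (f - b · e)) - b · (- (c · e) - b · (f - b · e)))
      - γ · (+ 2 · - (c · e) - b · (f - b · e))
  lemma = solve-∀

module _ (b c β γ : ℤ) (q : ℕ) where
  private
    b′ = b + β · + q
    c′ = c + γ · + q

  -- The recurrences have order two, so consecutive indices are carried together. The products of
  -- two increments contain q², which is why the first-order expansion is exact modulo `q * q`.
  lucasV-first-order : ∀ k →
    lucasV b′ c′ k ≋ lucasV b c k + + q · lucasV′ b c β γ k [ q * q ] ×
    lucasV b′ c′ (suc k) ≋ lucasV b c (suc k) + + q · lucasV′ b c β γ (suc k) [ q * q ]
  lucasV-first-order zero = ≡⇒≋ (lemma₀ b′ b (+ q)) , ≡⇒≋ (lemma₁ b c β γ (+ q))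
    where
    lemma₀ : ∀ b′ b q → + 2 · + 1 - b′ · + 0 ≡ + 2 · + 1 - b · + 0 + q · + 0
    lemma₀ = solve-∀
    lemma₁ : ∀ b c β γ q → + 2 · - ((c + γ · q) · + 0) - (b + β · q) · (+ 1 - (b + β · q) · + 0) ≡
      + 2 · - (c · + 0) - b · (+ 1 - b · + 0) + q · - (+ 1 · ((+ 1 - b · + 0) · β + + 0 · γ))
    lemma₁ = solve-∀
  lucasV-first-order (suc k) with lucasV-first-order k
  ... | h₀ , h₁ = h₁ , ≋-trans (≡⇒≋ (lucasV-rec b′ c′ k))
    (≋-trans (minus-cong-≋ (neg-cong-≋ (·-cong-≋ (≋-refl {a = b′}) h₁)) (·-cong-≋ (≋-refl {a = c′}) h₀))
    (by (- (β · d₁) - γ · d₀)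
      (trans (lemma b c β γ (+ q) v₀ v₁ d₀ d₁)
        (cong₂ (λ s t → s + (- (β · d₁) - γ · d₀) · t)
          (cong₂ (λ s t → s + + q · t) (sym (lucasV-rec b c k)) (sym (lucasV′-rec b c β γ k)))
          (sym (ℤₚ.pos-* q q))))))
    where
    v₀ = lucasV b c k
    v₁ = lucasV b c (suc k)
    d₀ = lucasV′ b c β γ k
    d₁ = lucasV′ b c β γ (suc k)
    lemma : ∀ b c β γ q v₀ v₁ d₀ d₁ →
      - ((b + β · q) · (v₁ + q · d₁)) - (c + γ · q) · (v₀ + q · d₀) ≡
      - (b · v₁) - c · v₀ + q · (- (b · d₁) - c · d₀ - β · v₁ - γ · v₀) + (- (β · d₁) - γ · d₀) · (q · q)
    lemma = solve-∀

module _ {π q N : ℕ} (π∣q : π ℕ∣.∣ q) (π∣N : π ℕ∣.∣ N) where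
  -- Both corrections vanish modulo π q: the error q² because π divides q, and the linear term
  -- because the derivative is a multiple of N.
  lucasV-lift-≋ : ∀ {b b′ c c′} → b′ ≋ b [ q ] → c′ ≋ c [ q ] → lucasV b′ c′ N ≋ lucasV b c N [ π * q ]
  lucasV-lift-≋ {b} {c = c} (by β refl) (by γ refl) =
    ≋-trans (≋-mod-∣ (ℕ∣.*-monoˡ-∣ q π∣q) (proj₁ (lucasV-first-order b c β γ q N)))
    (≋-trans (+-cong-≋ (≋-refl {a = lucasV b c N}) (derivative≋0 π∣N)) (≡⇒≋ (ℤₚ.+-identityʳ _)))
    where
    derivative≋0 : ∀ {N} → π ℕ∣.∣ N → + q · lucasV′ b c β γ N ≋ + 0 [ π * q ]
    derivative≋0 {zero} _ = ≡⇒≋ (ℤₚ.*-zeroʳ (+ q))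
    derivative≋0 {suc k} (ℕ∣.divides w eq) = by (- (+ w · s)) (begin
      + q · - (+ suc k · s)             ≡⟨ cong (λ x → + q · - (x · s)) (trans (cong +_ eq) (ℤₚ.pos-* w π)) ⟩
      + q · - (+ w · + π · s)           ≡⟨ lemma (+ q) (+ w) (+ π) s ⟩
      + 0 + - (+ w · s) · (+ π · + q)   ≡⟨ cong (λ x → + 0 + - (+ w · s) · x) (ℤₚ.pos-* π q) ⟨
      + 0 + - (+ w · s) · + (π * q)     ∎)
      where
      open ≡-Reasoning
      s = proj₁ (X^mod b c (suc k)) · β + proj₁ (X^mod b c k) · γ
      lemma : ∀ q w π s → q · - (w · π · s) ≡ + 0 + - (w · s) · (π · q)
      lemma = solve-∀

private
  p∣p^suc : ∀ p j → p ℕ∣.∣ p ℕ.^ suc j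
  p∣p^suc p j = ℕ∣.m∣m*n (p ℕ.^ j)

^-mono-∣ : ∀ p {i j} → i ≤ j → p ℕ.^ i ℕ∣.∣ p ℕ.^ j
^-mono-∣ p {j = j} z≤n = ℕ∣.1∣ (p ℕ.^ j)
^-mono-∣ p (s≤s h)     = ℕ∣.*-monoʳ-∣ p (^-mono-∣ p h)

Fixed⇒lucasV : ∀ N {m} b c → Fixed N m b c → lucasV b c N ≋ - b [ m ]
Fixed⇒lucasV N b c h = ≋-trans (trace-cong b h) (≡⇒≋ (lemma b))
  where
  lemma : ∀ b → + 2 · + 0 - b · + 1 ≡ - b
  lemma = solve-∀

Fixed⇒norm : ∀ N {m} b c → Fixed N m b c → c ^ᶻ N ≋ c [ m ]
Fixed⇒norm N b c h = ≋-trans (≡⇒≋ (sym (norm-X^mod b c N))) (≋-trans (norm-cong b c h) (≡⇒≋ (lemma b c)))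
  where
  lemma : ∀ b c → + 0 · + 0 - b · (+ 1 · + 0) + c · (+ 1 · + 1) ≡ c
  lemma = solve-∀

≋-mod-^1 : ∀ {p a b} → a ≋ b [ p ] → a ≋ b [ p ℕ.^ 1 ]
≋-mod-^1 {p} = ≋-mod-∣ (ℕ∣.∣-reflexive (ℕₚ.*-identityʳ p))

module _ {p N : ℕ} (p∣N : p ℕ∣.∣ N) where
  -- For a fixed quadratic the trace and norm of X^N are -b and c themselves. They agree modulo one
  -- more power of p than the coefficients they are computed from, so agreement modulo p improves
  -- itself step by step up to the full power.
  Fixed-lift-unique : ∀ r {b b′ c c′} → Fixed N (p ℕ.^ suc r) b c → Fixed N (p ℕ.^ suc r) b′ c′ →
    b′ ≋ b [ p ] → c′ ≋ c [ p ] → b′ ≋ b [ p ℕ.^ suc r ] × c′ ≋ c [ p ℕ.^ suc r ]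
  Fixed-lift-unique r {b} {b′} {c} {c′} h h′ eb ec = go r ℕₚ.≤-refl
    where
    neg-injective-≋ : ∀ {m x y} → - x ≋ - y [ m ] → x ≋ y [ m ]
    neg-injective-≋ {x = x} {y} e = ≋-trans (≡⇒≋ (sym (ℤₚ.neg-involutive x)))
      (≋-trans (neg-cong-≋ e) (≡⇒≋ (ℤₚ.neg-involutive y)))
    go : ∀ j → j ≤ r → b′ ≋ b [ p ℕ.^ suc j ] × c′ ≋ c [ p ℕ.^ suc j ]
    go zero    _   = ≋-mod-^1 eb , ≋-mod-^1 ec
    go (suc j) j<r with go j (ℕₚ.<⇒≤ j<r)
    ... | eb , ec =
      neg-injective-≋ (≋-trans (≋-sym (≋-mod-∣ d (Fixed⇒lucasV N b′ c′ h′)))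
        (≋-trans (lucasV-lift-≋ (p∣p^suc p j) p∣N eb ec) (≋-mod-∣ d (Fixed⇒lucasV N b c h)))) ,
      ≋-trans (≋-sym (≋-mod-∣ d (Fixed⇒norm N b′ c′ h′)))
        (≋-trans (^-lift-≋ (p∣p^suc p j) p∣N ec) (≋-mod-∣ d (Fixed⇒norm N b c h)))
      where
      d = ^-mono-∣ p (s≤s j<r)

  -- The roots X, X^N, X^(N²), … of T^N = T converge p-adically; the lift is the
  -- characteristic polynomial of the limit.
  Fixed-lift-exists : ∀ r {b c} → Fixed N p b c →
    ∃[ b′ ] ∃[ c′ ] (Fixed N (p ℕ.^ suc r) b′ c′ × b′ ≋ b [ p ] × c′ ≋ c [ p ])
  Fixed-lift-exists r {b} {c} h with approximate r
    where
    approximate : ∀ j → ∃[ α ] (powQ b c α N ≋₂ α [ p ℕ.^ suc j ] × α ≋₂ (+ 1 , + 0) [ p ])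
    approximate zero = (+ 1 , + 0) ,
      ≋₂-mod-∣ (ℕ∣.∣-reflexive (ℕₚ.*-identityʳ p)) (subst (_≋₂ (+ 1 , + 0) [ p ]) (X^mod-powQ b c N) h) ,
      ≡⇒≋₂ refl
    approximate (suc j) with approximate j
    ... | α , fixed , α≋X = powQ b c α N , powQ-lift-≋₂ (p∣p^suc p j) p∣N b c fixed ,
      ≋₂-trans (≋₂-mod-∣ (p∣p^suc p j) fixed) α≋X
  ... | (u , v) , fixed , u≋1 , v≋0 = - trace b (u , v) , norm b c (u , v) ,
    -- Since u ≡ 1 modulo p, it is a unit modulo every power of p.
    powQ-fixed⇒Fixed N b c u v (Unit-mod-^ (suc r) (Unit-resp-≋ (≋-sym u≋1) Unit-1)) fixed ,
    ≋-trans (neg-cong-≋ (trace-cong b {y = + 1 , + 0} (u≋1 , v≋0))) (≡⇒≋ (lemma b)) ,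
    ≋-trans (norm-cong b c {y = + 1 , + 0} (u≋1 , v≋0)) (≡⇒≋ (lemma′ b c))
    where
    lemma : ∀ b → - (+ 2 · + 0 - b · + 1) ≡ b
    lemma = solve-∀
    lemma′ : ∀ b c → + 0 · + 0 - b · (+ 1 · + 0) + c · (+ 1 · + 1) ≡ c
    lemma′ = solve-∀

-- Roots of unity in finite fields

module FiniteField (R : CommutativeRing 0ℓ 0ℓ) where
  open CommutativeRing R renaming
    (_+_ to _⊕_; _*_ to _⊛_; -_ to ⊖_; refl to ≈-refl; sym to ≈-sym; trans to ≈-trans) hiding (_-_)
  open SemiringSolver commutativeSemiring using (solve; _:=_; _:+_; _:*_)
  open SetoidReasoning setoid
  open Powers R

  -- `HasCard` counts up to propositional equality while the ring has only a setoid equality, so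
  -- elements are counted through a type `A` of unique representatives. The instances are ℤ/p with
  -- `Fin p` and its quadratic extension with `Fin p × Fin p`.
  module Domain (1≉0 : ¬ 1# ≈ 0#) (_≈?_ : ∀ x y → Dec (x ≈ y))
    (no-zero-divisors : ∀ x y → ¬ x ≈ 0# → x ⊛ y ≈ 0# → y ≈ 0#)
    {A : Set} (el : A → Carrier) (el-injective : ∀ a b → el a ≈ el b → a ≡ b)
    (rep : Carrier → A) (el-rep : ∀ x → el (rep x) ≈ x)
    {E : ℕ} (card-units : HasCard (λ a → ¬ el a ≈ 0#) E)
    where

    *-cancelʳ : ∀ {x y z} → ¬ z ≈ 0# → x ⊛ z ≈ y ⊛ z → x ≈ y
    *-cancelʳ {x} {y} {z} z≉0 h = begin
      x                ≈⟨ +-identityʳ x ⟨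
      x ⊕ 0#           ≈⟨ +-congˡ (-‿inverseˡ y) ⟨
      x ⊕ (⊖ y ⊕ y)    ≈⟨ +-assoc x (⊖ y) y ⟨
      x ⊕ ⊖ y ⊕ y      ≈⟨ +-congʳ (no-zero-divisors _ _ z≉0 difference) ⟩
      0# ⊕ y           ≈⟨ +-identityˡ y ⟩
      y                ∎
      where
      difference : z ⊛ (x ⊕ ⊖ y) ≈ 0#
      difference = begin
        z ⊛ (x ⊕ ⊖ y)      ≈⟨ *-comm z _ ⟩
        (x ⊕ ⊖ y) ⊛ z      ≈⟨ distribʳ z x (⊖ y) ⟩
        x ⊛ z ⊕ ⊖ y ⊛ z    ≈⟨ +-congʳ h ⟩
        y ⊛ z ⊕ ⊖ y ⊛ z    ≈⟨ distribʳ z y (⊖ y) ⟨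
        (y ⊕ ⊖ y) ⊛ z      ≈⟨ *-congʳ (-‿inverseʳ y) ⟩
        0# ⊛ z             ≈⟨ zeroˡ z ⟩
        0#                 ∎

    *-distinct⇒0 : ∀ {x y z} → ¬ x ≈ y → x ⊛ z ≈ y ⊛ z → z ≈ 0#
    *-distinct⇒0 {z = z} x≉y h with z ≈? 0#
    ... | yes z≈0 = z≈0
    ... | no  z≉0 = contradiction (*-cancelʳ z≉0 h) x≉y

    -- Polynomial functions of degree < d, and monic ones of degree d, described by
    -- divided differences: f x - f α = (x - α) q x, written without subtraction.
    LowDegree : ℕ → (Carrier → Carrier) → Set
    LowDegree zero    f = ∀ x → f x ≈ 0#
    LowDegree (suc d) f = ∀ α → ∃[ q ] (LowDegree d q × ∀ x → f x ⊕ α ⊛ q x ≈ f α ⊕ x ⊛ q x)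

    MonicFunction : ℕ → (Carrier → Carrier) → Set
    MonicFunction zero    f = ∀ x → f x ≈ 1#
    MonicFunction (suc d) f = ∀ α → ∃[ q ] (MonicFunction d q × ∀ x → f x ⊕ α ⊛ q x ≈ f α ⊕ x ⊛ q x)

    private
      add-differences : ∀ x α {f g f′ g′ p q} → f ⊕ α ⊛ p ≈ f′ ⊕ x ⊛ p → g ⊕ α ⊛ q ≈ g′ ⊕ x ⊛ q →
        f ⊕ g ⊕ α ⊛ (p ⊕ q) ≈ f′ ⊕ g′ ⊕ x ⊛ (p ⊕ q)
      add-differences x α {f} {g} {f′} {g′} {p} {q} h k = begin
        f ⊕ g ⊕ α ⊛ (p ⊕ q)
          ≈⟨ solve 5 (λ f g α p q → f :+ g :+ α :* (p :+ q) := (f :+ α :* p) :+ (g :+ α :* q)) ≈-refl f g α p q ⟩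
        (f ⊕ α ⊛ p) ⊕ (g ⊕ α ⊛ q)
          ≈⟨ +-cong h k ⟩
        (f′ ⊕ x ⊛ p) ⊕ (g′ ⊕ x ⊛ q)
          ≈⟨ solve 5 (λ f g α p q → (f :+ α :* p) :+ (g :+ α :* q) := f :+ g :+ α :* (p :+ q)) ≈-refl f′ g′ x p q ⟩
        f′ ⊕ g′ ⊕ x ⊛ (p ⊕ q) ∎

    LowDegree-scale : ∀ d {f} a → LowDegree d f → LowDegree d (λ x → a ⊛ f x)
    LowDegree-scale zero    a h x = ≈-trans (*-congˡ (h x)) (zeroʳ a)
    LowDegree-scale (suc d) {f} a h α with h α
    ... | q , hq , e = (λ x → a ⊛ q x) , LowDegree-scale d a hq , λ x → begin
      a ⊛ f x ⊕ α ⊛ (a ⊛ q x)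
        ≈⟨ solve 4 (λ a f α q → a :* f :+ α :* (a :* q) := a :* (f :+ α :* q)) ≈-refl a (f x) α (q x) ⟩
      a ⊛ (f x ⊕ α ⊛ q x)
        ≈⟨ *-congˡ (e x) ⟩
      a ⊛ (f α ⊕ x ⊛ q x)
        ≈⟨ solve 4 (λ a f α q → a :* (f :+ α :* q) := a :* f :+ α :* (a :* q)) ≈-refl a (f α) x (q x) ⟩
      a ⊛ f α ⊕ x ⊛ (a ⊛ q x) ∎

    MonicFunction-+ : ∀ d {f g} → MonicFunction d f → LowDegree d g → MonicFunction d (λ x → f x ⊕ g x)
    MonicFunction-+ zero    hf hg x = ≈-trans (+-cong (hf x) (hg x)) (+-identityʳ 1#)
    MonicFunction-+ (suc d) hf hg α with hf α | hg α
    ... | p , hp , e | q , hq , e′ = (λ x → p x ⊕ q x) , MonicFunction-+ d hp hq ,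
      λ x → add-differences x α (e x) (e′ x)

    MonicFunction⇒LowDegree : ∀ d {f} → MonicFunction d f → LowDegree (suc d) f
    MonicFunction⇒LowDegree zero {f} h α = (λ _ → 0#) , (λ _ → ≈-refl) , λ x →
      +-cong (≈-trans (h x) (≈-sym (h α))) (≈-trans (zeroʳ α) (≈-sym (zeroʳ x)))
    MonicFunction⇒LowDegree (suc d) h α with h α
    ... | q , hq , e = q , MonicFunction⇒LowDegree d hq , e

    -- The divided difference f x + α q x comes from x f(x) - α f(α) = (x - α) f(x) + α (f(x) -
    -- f(α)). Its leading part is `f`, since α q has lower degree.
    MonicFunction-X* : ∀ d {f} a → MonicFunction d f → MonicFunction (suc d) (λ x → x ⊛ f x ⊕ a)
    MonicFunction-X* zero {f} a h α = (λ _ → 1#) , (λ _ → ≈-refl) , λ x → begin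
      x ⊛ f x ⊕ a ⊕ α ⊛ 1#
        ≈⟨ +-cong (+-congʳ (*-congˡ (h x))) (*-congˡ (≈-sym (h α))) ⟩
      x ⊛ 1# ⊕ a ⊕ α ⊛ f α
        ≈⟨ solve 3 (λ p a q → p :+ a :+ q := q :+ a :+ p) ≈-refl (x ⊛ 1#) a (α ⊛ f α) ⟩
      α ⊛ f α ⊕ a ⊕ x ⊛ 1# ∎
    MonicFunction-X* (suc d) {f} a h α with h α
    ... | q , hq , e = (λ x → f x ⊕ α ⊛ q x) ,
      MonicFunction-+ (suc d) h (LowDegree-scale (suc d) α (MonicFunction⇒LowDegree d hq)) , λ x → begin
      x ⊛ f x ⊕ a ⊕ α ⊛ (f x ⊕ α ⊛ q x)
        ≈⟨ +-congˡ (*-congˡ (e x)) ⟩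
      x ⊛ f x ⊕ a ⊕ α ⊛ (f α ⊕ x ⊛ q x)
        ≈⟨ solve 6 (λ x f a α f′ q → x :* f :+ a :+ α :* (f′ :+ x :* q) := α :* f′ :+ a :+ x :* (f :+ α :* q))
             ≈-refl x (f x) a α (f α) (q x) ⟩
      α ⊛ f α ⊕ a ⊕ x ⊛ (f x ⊕ α ⊛ q x) ∎

    MonicFunction-resp-≈ : ∀ d {f g} → (∀ x → f x ≈ g x) → MonicFunction d f → MonicFunction d g
    MonicFunction-resp-≈ zero    e h x = ≈-trans (≈-sym (e x)) (h x)
    MonicFunction-resp-≈ (suc d) e h α with h α
    ... | q , hq , e′ = q , hq , λ x → ≈-trans (+-congʳ (≈-sym (e x))) (≈-trans (e′ x) (+-congʳ (e α)))

    MonicFunction-X^* : ∀ k {d f} → MonicFunction d f → MonicFunction (k ℕ.+ d) (λ x → x ^ k ⊛ f x)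
    MonicFunction-X^* zero    {d} h = MonicFunction-resp-≈ d (λ x → ≈-sym (*-identityˡ _)) h
    MonicFunction-X^* (suc k) {d} h = MonicFunction-resp-≈ (suc k ℕ.+ d)
      (λ x → ≈-trans (+-identityʳ _) (≈-sym (*-assoc _ _ _)))
      (MonicFunction-X* (k ℕ.+ d) 0# (MonicFunction-X^* k h))

    MonicFunction-X^*+ : ∀ k {d f} a → MonicFunction d f → MonicFunction (suc k ℕ.+ d) (λ x → x ^ suc k ⊛ f x ⊕ a)
    MonicFunction-X^*+ k {d} a h = MonicFunction-resp-≈ (suc k ℕ.+ d)
      (λ x → +-congʳ (≈-sym (*-assoc _ _ _))) (MonicFunction-X* (k ℕ.+ d) a (MonicFunction-X^* k h))

    -- Every root of `f` other than `a` is a root of the divided difference at `a`, whose degree is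
    -- one less.
    roots-≤-degree : ∀ d {f} → MonicFunction d f → ∀ xs → Unique xs → (∀ {a} → a ∈ xs → f (el a) ≈ 0#) → length xs ≤ d
    roots-≤-degree d       h []       _        _     = z≤n
    roots-≤-degree zero    h (a ∷ xs) _        roots = contradiction (≈-trans (≈-sym (h (el a))) (roots (here refl))) 1≉0
    roots-≤-degree (suc d) {f} h (a ∷ xs) (a∉ ∷ u) roots with h (el a)
    ... | q , hq , e = s≤s (roots-≤-degree d hq xs u quotient-root)
      where
      quotient-root : ∀ {b} → b ∈ xs → q (el b) ≈ 0#
      quotient-root {b} b∈ = *-distinct⇒0 (λ h → All.lookup a∉ b∈ (el-injective _ _ h)) (begin
        el a ⊛ q (el b)                 ≈⟨ +-identityˡ _ ⟨
        0# ⊕ el a ⊛ q (el b)            ≈⟨ +-congʳ (roots (there b∈)) ⟨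
        f (el b) ⊕ el a ⊛ q (el b)      ≈⟨ e (el b) ⟩
        f (el a) ⊕ el b ⊛ q (el b)      ≈⟨ +-congʳ (roots (here refl)) ⟩
        0# ⊕ el b ⊛ q (el b)            ≈⟨ +-identityˡ _ ⟩
        el b ⊛ q (el b)                 ∎)

    card-roots-≤ : ∀ d {f} {P : A → Set} {k} → MonicFunction d f → HasCard P k → (∀ {a} → P a → f (el a) ≈ 0#) → k ≤ d
    card-roots-≤ d h (xs , u , mem , refl) roots = roots-≤-degree d h xs u (λ a∈ → roots (Equivalence.to (mem _) a∈))

    product : List A → Carrier
    product []       = 1#
    product (a ∷ xs) = el a ⊛ product xs

    product-↭ : ∀ {xs ys} → xs ↭ ys → product xs ≈ product ys
    product-↭ _↭_.refl          = ≈-refl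
    product-↭ (prep a p)        = *-congˡ (product-↭ p)
    product-↭ (_↭_.swap a b p)  = ≈-trans (*-congˡ (*-congˡ (product-↭ p)))
      (solve 3 (λ x y z → x :* (y :* z) := y :* (x :* z)) ≈-refl _ _ _)
    product-↭ (_↭_.trans p q)   = ≈-trans (product-↭ p) (product-↭ q)

    *-≉0 : ∀ {x y} → ¬ x ≈ 0# → ¬ y ≈ 0# → ¬ x ⊛ y ≈ 0#
    *-≉0 x≉0 y≉0 h = y≉0 (no-zero-divisors _ _ x≉0 h)

    product-≉0 : ∀ xs → (∀ {a} → a ∈ xs → ¬ el a ≈ 0#) → ¬ product xs ≈ 0#
    product-≉0 []       _ = 1≉0
    product-≉0 (a ∷ xs) h = *-≉0 (h (here refl)) (product-≉0 xs (h ∘ there))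

    -- Multiplication by x permutes the units.
    fermat : ∀ {x} → ¬ x ≈ 0# → x ^ E ≈ 1#
    fermat {x} x≉0 = let xs , u , mem , len = card-units in
      *-cancelʳ (product-≉0 xs (λ a∈ → Equivalence.to (mem _) a∈)) (begin
        x ^ E ⊛ product xs              ≡⟨ cong (λ n → x ^ n ⊛ product xs) len ⟨
        x ^ length xs ⊛ product xs      ≈⟨ product-map xs ⟨
        product (map times xs)          ≈⟨ product-↭ (permutes xs u mem) ⟨
        product xs                      ≈⟨ *-identityˡ _ ⟨
        1# ⊛ product xs                 ∎)
      where
      times : A → A
      times a = rep (x ⊛ el a)

      product-map : ∀ xs → product (map times xs) ≈ x ^ length xs ⊛ product xs
      product-map []       = ≈-sym (*-identityˡ 1#)
      product-map (a ∷ xs) = ≈-trans (*-cong (el-rep _) (product-map xs))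
        (solve 4 (λ x a p q → (x :* a) :* (p :* q) := (x :* p) :* (a :* q)) ≈-refl x (el a) (x ^ length xs) (product xs))

      times-injective : ∀ {a b} → times a ≡ times b → a ≡ b
      times-injective {a} {b} h = el-injective _ _ (*-cancelʳ x≉0 (begin
        el a ⊛ x          ≈⟨ *-comm _ x ⟩
        x ⊛ el a          ≈⟨ el-rep _ ⟨
        el (times a)      ≡⟨ cong el h ⟩
        el (times b)      ≈⟨ el-rep _ ⟩
        x ⊛ el b          ≈⟨ *-comm x _ ⟩
        el b ⊛ x          ∎))

      permutes : ∀ xs → Unique xs → (∀ a → (a ∈ xs) ⇔ (¬ el a ≈ 0#)) → xs ↭ map times xs
      permutes xs u mem = unique-⊆-≥⇒↭ (Uniqueₚ.map⁺ times-injective u) ⊆ (ℕₚ.≤-reflexive (sym (Listₚ.length-map times xs)))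
        where
        ⊆ : ∀ {b} → b ∈ map times xs → b ∈ xs
        ⊆ b∈ with ∈ₚ.∈-map⁻ times b∈
        ... | a , a∈ , refl = Equivalence.from (mem _)
          (λ h → *-≉0 x≉0 (Equivalence.to (mem a) a∈) (≈-trans (≈-sym (el-rep _)) h))

    -- The cofactor of x^d - 1 in x^(kd) - 1, a geometric sum with `k` terms in Horner form.
    power-sum : ℕ → ℕ → Carrier → Carrier
    power-sum d zero    x = 0#
    power-sum d (suc k) x = x ^ d ⊛ power-sum d k x ⊕ 1#

    power-sum-top : ∀ d k x → power-sum d (suc k) x ≈ power-sum d k x ⊕ x ^ (k * d)
    power-sum-top d zero    x = +-congʳ (zeroʳ _)
    power-sum-top d (suc k) x = begin
      x ^ d ⊛ power-sum d (suc k) x ⊕ 1#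
        ≈⟨ +-congʳ (*-congˡ (power-sum-top d k x)) ⟩
      x ^ d ⊛ (power-sum d k x ⊕ x ^ (k * d)) ⊕ 1#
        ≈⟨ solve 4 (λ p s q o → p :* (s :+ q) :+ o := p :* s :+ o :+ p :* q) ≈-refl
             (x ^ d) (power-sum d k x) (x ^ (k * d)) 1# ⟩
      x ^ d ⊛ power-sum d k x ⊕ 1# ⊕ x ^ d ⊛ x ^ (k * d)
        ≈⟨ +-congˡ (^-+ x d (k * d)) ⟨
      power-sum d (suc k) x ⊕ x ^ (suc k * d) ∎

    power-sum-monic : ∀ d k → MonicFunction (k * suc d) (power-sum (suc d) (suc k))
    power-sum-monic d zero    x = ≈-trans (+-congʳ (zeroʳ _)) (+-identityˡ 1#)
    power-sum-monic d (suc k) = MonicFunction-X^*+ d 1# (power-sum-monic d k)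

    -- Extending the sum S at either end gives x^d S + 1 = S + x^(kd). If x^(kd) = 1 this leaves x^d
    -- S = 1 S, and distinct factors force S = 0.
    power-sum-root : ∀ d k {x} → x ^ (k * d) ≈ 1# → ¬ x ^ d ≈ 1# → power-sum d k x ≈ 0#
    power-sum-root d k {x} top h = *-distinct⇒0 h (+-cancelʳ (≈-trans (power-sum-top d k x)
      (+-cong (≈-sym (*-identityˡ _)) top)))
      where
      open GroupProperties +-group using () renaming (∙-cancelʳ to cancel)
      +-cancelʳ : ∀ {x y z} → x ⊕ z ≈ y ⊕ z → x ≈ y
      +-cancelʳ {x} {y} {z} = cancel z x y

    root-of-unity-≉0 : ∀ e {x} → x ^ suc e ≈ 1# → ¬ x ≈ 0#
    root-of-unity-≉0 e h x≈0 = 1≉0 (≈-trans (≈-sym h) (≈-trans (*-congʳ x≈0) (zeroˡ _)))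

    -- Each of the E units is a root of x^(d+1) - 1, which has at most d + 1 roots, or of its
    -- cofactor, which has at most k (d + 1). The two bounds add up to E, so both are attained.
    card-roots-of-unity-∣ : ∀ d k → E ≡ suc k * suc d → HasCard (λ a → el a ^ suc d ≈ 1#) (suc d)
    card-roots-of-unity-∣ d k E≡ with card-split card-units (λ a → (el a ^ suc d) ≈? 1#)
    ... | i , j , hi , hj , i+j = subst (HasCard _) i≡ (card-resp-⇔ proj₂ (λ h → root-of-unity-≉0 d h , h) hi)
      where
      i≤ : i ≤ suc d
      i≤ = subst (i ≤_) (ℕₚ.+-identityʳ (suc d)) (card-roots-≤ (suc d ℕ.+ 0)
        (MonicFunction-X^*+ d {0} {λ _ → 1#} (⊖ 1#) (λ _ → ≈-refl)) hi
        (λ (_ , h) → ≈-trans (+-congʳ (≈-trans (*-identityʳ _) h)) (-‿inverseʳ 1#)))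
      j≤ : j ≤ k * suc d
      j≤ = card-roots-≤ (k * suc d) (power-sum-monic d k) hj
        (λ {a} (a≉0 , h) → power-sum-root (suc d) (suc k) (subst (λ n → el a ^ n ≈ 1#) E≡ (fermat a≉0)) h)
      i≡ : i ≡ suc d
      i≡ = ℕₚ.≤-antisym i≤ (ℕₚ.+-cancelʳ-≤ (k * suc d) (suc d) i
        (subst (_≤ i ℕ.+ k * suc d) (trans i+j E≡) (ℕₚ.+-monoʳ-≤ i j≤)))

    private
      ^-multiple : ∀ {x} d → x ^ d ≈ 1# → ∀ k → x ^ (k * d) ≈ 1#
      ^-multiple {x} d h k = ≈-trans (^-* x k d) (≈-trans (^-cong h k) (1^ k))

      cancel-multiple : ∀ {x} i j k → x ^ i ≈ 1# → x ^ j ≈ 1# → k ℕ.+ i ≡ j → x ^ k ≈ 1#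
      cancel-multiple {x} i j k hi hj refl = begin
        x ^ k            ≈⟨ *-identityʳ _ ⟨
        x ^ k ⊛ 1#       ≈⟨ *-congˡ hi ⟨
        x ^ k ⊛ x ^ i    ≈⟨ ^-+ x k i ⟨
        x ^ (k ℕ.+ i)    ≈⟨ hj ⟩
        1#               ∎

    ^-gcd : ∀ {x} i j → x ^ i ≈ 1# → x ^ j ≈ 1# → x ^ ℕGCD.gcd i j ≈ 1#
    ^-gcd {x} i j hi hj with ℕGCD.Bézout.identity (ℕGCD.gcd-GCD i j)
    ... | ℕGCD.Bézout.+- p q eq = cancel-multiple (q * j) (p * i) _ (^-multiple j hj q) (^-multiple i hi p) eq
    ... | ℕGCD.Bézout.-+ p q eq = cancel-multiple (p * i) (q * j) _ (^-multiple i hi p) (^-multiple j hj q) eq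

    -- Every unit satisfies x^E = 1, so by Bézout the exponent may be replaced by its gcd with E,
    -- which divides E as the previous count demands.
    card-roots-of-unity : ∀ e → 0 < E → HasCard (λ a → el a ^ suc e ≈ 1#) (ℕGCD.gcd (suc e) E)
    card-roots-of-unity e 0<E with ℕGCD.gcd (suc e) E in eq
    ... | zero  = contradiction (ℕGCD.gcd[m,n]≡0⇒m≡0 {suc e} {E} eq) (λ ())
    ... | suc d with subst (ℕ∣._∣ E) eq (ℕGCD.gcd[m,n]∣n (suc e) E)
                   | subst (ℕ∣._∣ suc e) eq (ℕGCD.gcd[m,n]∣m (suc e) E)
    ... | ℕ∣.divides zero    E≡ | _ = contradiction E≡ (ℕₚ.>⇒≢ 0<E)
    ... | ℕ∣.divides (suc k) E≡ | ℕ∣.divides l e≡ = card-resp-⇔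
      (λ {a} h → subst (λ n → el a ^ n ≈ 1#) (sym e≡) (^-multiple (suc d) h l))
      (λ {a} h → subst (λ n → el a ^ n ≈ 1#) eq (^-gcd (suc e) E h (fermat (root-of-unity-≉0 e h))))
      (card-roots-of-unity-∣ d k E≡)

-- Quadratics modulo a prime

module ModPrime {p : ℕ} (p-prime : Prime p) where
  instance
    p-nonZero : ℕ.NonZero p
    p-nonZero = Primality.prime⇒nonZero p-prime

  ≢0⇒Unit : ∀ {a} → ¬ a ≋ + 0 [ p ] → Unit p a
  ≢0⇒Unit {a} = prime-∤⇒Unit p-prime a

  Unit⇒≢0ₚ : ∀ {a} → Unit p a → ¬ a ≋ + 0 [ p ]
  Unit⇒≢0ₚ = Unit⇒≢0 p-prime

  no-zero-divisors : ∀ a b → ¬ a ≋ + 0 [ p ] → a · b ≋ + 0 [ p ] → b ≋ + 0 [ p ]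
  no-zero-divisors a b a≢0 = ·-cancelˡ-≋0 b (≢0⇒Unit a≢0)

  zero-product : ∀ a b → a · b ≋ + 0 [ p ] → a ≋ + 0 [ p ] ⊎ b ≋ + 0 [ p ]
  zero-product a b h with a ≋? + 0 [ p ]
  ... | yes a≋0 = inj₁ a≋0
  ... | no  a≢0 = inj₂ (no-zero-divisors a b a≢0 h)

  square≋0 : ∀ {a} → a · a ≋ + 0 [ p ] → a ≋ + 0 [ p ]
  square≋0 {a} h with zero-product a a h
  ... | inj₁ e = e
  ... | inj₂ e = e

  square-roots : ∀ a b → a · a ≋ b · b [ p ] → a ≋ b [ p ] ⊎ a ≋ - b [ p ]
  square-roots a b h with zero-product (a - b) (a - - b) (≋-trans (≡⇒≋ (lemma a b)) (≋⇒minus≋0 h))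
    where
    lemma : ∀ a b → (a - b) · (a - - b) ≡ a · a - b · b
    lemma = solve-∀
  ... | inj₁ e = inj₁ (minus≋0⇒≋ e)
  ... | inj₂ e = inj₂ (minus≋0⇒≋ e)

  card-nonzero : HasCard {Fin p} (λ a → ¬ ι a ≋ + 0 [ p ]) (p ℕ.∸ 1)
  card-nonzero with card-split (card-Fin p) (λ a → ι a ≋? + 0 [ p ])
  ... | i , j , hi , hj , i+j = subst (HasCard _) j≡ (card-resp-⇔ proj₂ (λ h → tt , h) hj)
    where
    i≡1 : i ≡ 1
    i≡1 = card-unique hi (card-singleton (residue p (+ 0)) (tt , ι-residue p (+ 0))
      (λ (_ , e) → ι-injective (≋-trans e (≋-sym (ι-residue p (+ 0))))))
    j≡ : j ≡ p ℕ.∸ 1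
    j≡ = cong (ℕ._∸ 1) (trans (cong (ℕ._+ j) (sym i≡1)) i+j)

  open FiniteField.Domain (modRing p) (Unit⇒≢0ₚ Unit-1) (λ a b → a ≋? b [ p ]) no-zero-divisors
    ι (λ i j → ι-injective) (residue p) (ι-residue p) card-nonzero
    using (card-roots-of-unity)

  0<p∸1 : 0 < p ℕ.∸ 1
  0<p∸1 = ℕₚ.m<n⇒0<n∸m (ℕ.nonTrivial⇒n>1 p {{Primality.prime⇒nonTrivial p-prime}})

  card-unit-roots : ∀ e → HasCard {Fin p} (λ a → ι a ^ᶻ suc e ≋ + 1 [ p ]) (ℕGCD.gcd (suc e) (p ℕ.∸ 1))
  card-unit-roots e = card-roots-of-unity e 0<p∸1

  ^ᶻ-suc≋⇒≋1 : ∀ e a → ¬ a ≋ + 0 [ p ] → a ^ᶻ suc e ≋ a [ p ] → a ^ᶻ e ≋ + 1 [ p ]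
  ^ᶻ-suc≋⇒≋1 e a a≢0 h = ·-cancelˡ-≋ (a ^ᶻ e) (+ 1) (≢0⇒Unit a≢0) (≋-trans h (≡⇒≋ (sym (ℤₚ.*-identityʳ a))))

  ≋1⇒^ᶻ-suc≋ : ∀ e a → a ^ᶻ e ≋ + 1 [ p ] → a ^ᶻ suc e ≋ a [ p ]
  ≋1⇒^ᶻ-suc≋ e a h = ≋-trans (·-cong-≋ (≋-refl {a = a}) h) (≡⇒≋ (ℤₚ.*-identityʳ a))

  ^ᶻ-suc≋1⇒≢0 : ∀ e a → a ^ᶻ suc e ≋ + 1 [ p ] → ¬ a ≋ + 0 [ p ]
  ^ᶻ-suc≋1⇒≢0 e a h a≋0 = Unit⇒≢0ₚ Unit-1 (≋-trans (≋-sym h)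
    (≋-trans (·-cong-≋ a≋0 (≋-refl {a = a ^ᶻ e})) (≡⇒≋ (ℤₚ.*-zeroˡ (a ^ᶻ e)))))

  negate : Fin p → Fin p
  negate a = residue p (- ι a)

  ι-negate : ∀ a → ι (negate a) ≋ - ι a [ p ]
  ι-negate a = ι-residue p (- ι a)

  negate-involutive : ∀ a → negate (negate a) ≡ a
  negate-involutive a = ι-injective (≋-trans (ι-negate (negate a))
    (≋-trans (neg-cong-≋ (ι-negate a)) (≡⇒≋ (ℤₚ.neg-involutive (ι a)))))

  negate-≢0 : ∀ {a} → ¬ ι a ≋ + 0 [ p ] → ¬ ι (negate a) ≋ + 0 [ p ]
  negate-≢0 {a} a≢0 h = a≢0 (≋-trans (≡⇒≋ (sym (ℤₚ.neg-involutive (ι a))))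
    (neg-cong-≋ (≋-trans (≋-sym (ι-negate a)) h)))

  IsSquare : ℤ → Set
  IsSquare a = ∃[ x ] x · x ≋ a [ p ]

  IsSquare? : ∀ a → Dec (IsSquare a)
  IsSquare? a = Dec.map′ (λ (i , h) → ι i , h)
    (λ (x , h) → residue p x , ≋-trans (·-cong-≋ (ι-residue p x) (ι-residue p x)) h)
    (Finₚ.any? (λ i → ι i · ι i ≋? a [ p ]))

  IsSquare-resp-≋ : ∀ {a b} → a ≋ b [ p ] → IsSquare a → IsSquare b
  IsSquare-resp-≋ e (x , h) = x , ≋-trans h e

  IsSquare-ratio : ∀ a x → Unit p x → IsSquare (a · (x · x)) → IsSquare a
  IsSquare-ratio a x x-unit@(unit x⁻¹ h) (y , k) = x⁻¹ · y , ·-cancelˡ-≋ (x⁻¹ · y · (x⁻¹ · y)) a (Unit-· x-unit x-unit)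
    (≋-trans (≡⇒≋ (lemma x x⁻¹ y)) (≋-trans (·-cong-≋ (·-cong-≋ h h) (≋-refl {a = y · y}))
      (≋-trans (≡⇒≋ (lemma′ y)) (≋-trans k (≡⇒≋ (ℤₚ.*-comm a (x · x)))))))
    where
    lemma : ∀ x x⁻¹ y → x · x · (x⁻¹ · y · (x⁻¹ · y)) ≡ (x⁻¹ · x) · (x⁻¹ · x) · (y · y)
    lemma = solve-∀
    lemma′ : ∀ y → + 1 · + 1 · (y · y) ≡ y · y
    lemma′ = solve-∀

  module Odd (p≢2 : p ≢ 2) where
    2-unit : Unit p (+ 2)
    2-unit = ≢0⇒Unit 2≢0
      where
      2≢0 : ¬ + 2 ≋ + 0 [ p ]
      2≢0 h with Primality.irreducible[2] (≋0⇒∣ h)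
      ... | inj₁ refl = Primality.¬prime[1] p-prime
      ... | inj₂ p≡2  = p≢2 p≡2

    negate-≢ : ∀ {a} → ¬ ι a ≋ + 0 [ p ] → negate a ≢ a
    negate-≢ {a} a≢0 h = a≢0 (·-cancelˡ-≋0 (ι a) 2-unit (≋-trans (≡⇒≋ (lemma (ι a)))
      (≋-trans (+-cong-≋ (≋-refl {a = ι a}) (≋-trans (≡⇒≋ (cong ι (sym h))) (ι-negate a))) (≡⇒≋ (ℤₚ.+-inverseʳ (ι a))))))
      where
      lemma : ∀ a → + 2 · a ≡ a + a
      lemma = solve-∀

    -- Chooses one element from each pair {a , -a}.
    Lower : Fin p → Set
    Lower a = toℕ a < toℕ (negate a)

    Lower? : ∀ a → Dec (Lower a)
    Lower? a = toℕ a ℕ.<? toℕ (negate a)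

    Lower⇒¬Lower-negate : ∀ {a} → Lower a → ¬ Lower (negate a)
    Lower⇒¬Lower-negate {a} h h′ = ℕₚ.<-asym h (subst (λ x → toℕ (negate a) < toℕ x) (negate-involutive a) h′)

    ¬Lower⇒Lower-negate : ∀ {a} → ¬ ι a ≋ + 0 [ p ] → ¬ Lower a → Lower (negate a)
    ¬Lower⇒Lower-negate {a} a≢0 h = subst (λ x → toℕ (negate a) < toℕ x) (sym (negate-involutive a))
      (ℕₚ.≤∧≢⇒< (ℕₚ.≮⇒≥ h) (λ e → negate-≢ a≢0 (Finₚ.toℕ-injective e)))

    square-injective : ∀ {a b} → Lower a → Lower b → ι a · ι a ≋ ι b · ι b [ p ] → a ≡ b
    square-injective {a} {b} la lb h with square-roots (ι a) (ι b) h
    ... | inj₁ e = ι-injective e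
    ... | inj₂ e = contradiction (subst Lower (ι-injective (≋-trans e (≋-sym (ι-negate b)))) la) (Lower⇒¬Lower-negate lb)

    lower-representative : ∀ {a} → ¬ ι a ≋ + 0 [ p ] → ∃[ b ] (Lower b × (ι b ≋ ι a [ p ] ⊎ ι b ≋ - ι a [ p ]))
    lower-representative {a} a≢0 with Lower? a
    ... | yes l = a , l , inj₁ ≋-refl
    ... | no ¬l = negate a , ¬Lower⇒Lower-negate a≢0 ¬l , inj₂ (ι-negate a)

    square-of-representative : ∀ {a b} → b ≋ a [ p ] ⊎ b ≋ - a [ p ] → b · b ≋ a · a [ p ]
    square-of-representative (inj₁ e) = ·-cong-≋ e e
    square-of-representative {a} (inj₂ e) = ≋-trans (·-cong-≋ e e) (≡⇒≋ (lemma a))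
      where
      lemma : ∀ a → - a · - a ≡ a · a
      lemma = solve-∀

    NonzeroSquare NonSquare : Fin p → Set
    NonzeroSquare a = ¬ ι a ≋ + 0 [ p ] × IsSquare (ι a)
    NonSquare a = ¬ ι a ≋ + 0 [ p ] × ¬ IsSquare (ι a)

    private
      square : Fin p → Fin p
      square a = residue p (ι a · ι a)

      square-surjective : ∀ {b} → NonzeroSquare b → ∃[ a ] ((¬ ι a ≋ + 0 [ p ] × Lower a) × square a ≡ b)
      square-surjective {b} (b≢0 , x , x²≋b) = a , (a≢0 , la) , ι-injective (≋-trans (ι-residue p _) a²≋b)
        where
        x≢0 : ¬ ι (residue p x) ≋ + 0 [ p ]
        x≢0 h = b≢0 (≋-trans (≋-sym x²≋b) (·-cong-≋ x≋0 x≋0))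
          where x≋0 = ≋-trans (≋-sym (ι-residue p x)) h
        rep = lower-representative x≢0
        a = proj₁ rep
        la = proj₁ (proj₂ rep)
        a²≋b : ι a · ι a ≋ ι b [ p ]
        a²≋b = ≋-trans (square-of-representative (proj₂ (proj₂ rep)))
          (≋-trans (·-cong-≋ (ι-residue p x) (ι-residue p x)) x²≋b)
        a≢0 : ¬ ι a ≋ + 0 [ p ]
        a≢0 h = b≢0 (≋-trans (≋-sym a²≋b) (·-cong-≋ h h))

    -- Squaring maps the `Lower` representatives of the pairs {a , -a} bijectively onto the nonzero
    -- squares. That is half of the nonzero residues, and the other half are the non-squares.
    card-squares : ∃[ k ] (HasCard NonzeroSquare k × HasCard NonSquare k × 2 * k ≡ p ℕ.∸ 1)
    card-squares =
      let k , hk , 2k = card-half negate Lower? negate-≢0 (λ {a} _ → negate-involutive a)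
            (λ _ → Lower⇒¬Lower-negate) ¬Lower⇒Lower-negate card-nonzero
          i , j , hi , hj , i+j = card-split card-nonzero (λ a → IsSquare? (ι a))
          squares = card-map square
            (λ {a} (a≢0 , _) → (λ h → a≢0 (square≋0 (≋-trans (≋-sym (ι-residue p _)) h))) , ι a , ≋-sym (ι-residue p _))
            (λ (_ , la) (_ , lb) e → square-injective la lb
              (≋-trans (≋-sym (ι-residue p _)) (≋-trans (≡⇒≋ (cong ι e)) (ι-residue p _))))
            square-surjective hk
          j≡k = ℕₚ.+-cancelˡ-≡ k j k (trans (cong (ℕ._+ j) (card-unique squares hi))
            (trans i+j (trans (sym 2k) (cong (k ℕ.+_) (ℕₚ.+-identityʳ k)))))
      in k , squares , subst (HasCard _) j≡k hj , 2k

    non-square-exists : ∃[ D ] ¬ IsSquare D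
    non-square-exists = let k , _ , non-squares , 2k = card-squares in pick k non-squares 2k
      where
      pick : ∀ k → HasCard NonSquare k → 2 * k ≡ p ℕ.∸ 1 → ∃[ D ] ¬ IsSquare D
      pick zero    _                      2k = contradiction 2k (ℕₚ.<⇒≢ 0<p∸1)
      pick (suc k) (a ∷ _ , _ , mem , _) _  = ι a , proj₂ (Equivalence.to (mem a) (here refl))

    ¬IsSquare⇒≢0 : ∀ {a} → ¬ IsSquare a → ¬ a ≋ + 0 [ p ]
    ¬IsSquare⇒≢0 h a≋0 = h (+ 0 , ≋-sym a≋0)

    -- Multiplying the nonzero squares by D exhausts the non-squares, since both are equally many.
    non-square-ratio : ∀ {D Δ} → ¬ IsSquare D → ¬ IsSquare Δ → ∃[ w ] Δ ≋ D · (w · w) [ p ]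
    non-square-ratio {D} {Δ} D-ns Δ-ns =
      let k , squares , non-squares , _ = card-squares
          a , (_ , x , x²≋a) , e = card-⊆-≡ (image squares) non-squares image⊆ Δ-non-square
      in x , ≋-trans (≋-sym (ι-residue p Δ))
        (≋-trans (≡⇒≋ (cong ι (sym e))) (≋-trans (ι-residue p _) (·-cong-≋ (≋-refl {a = D}) (≋-sym x²≋a))))
      where
      D-unit : Unit p D
      D-unit = ≢0⇒Unit (¬IsSquare⇒≢0 D-ns)
      times : Fin p → Fin p
      times a = residue p (D · ι a)
      Image : Fin p → Set
      Image b = ∃[ a ] (NonzeroSquare a × times a ≡ b)
      image : ∀ {k} → HasCard NonzeroSquare k → HasCard Image k
      image = card-map times (λ sq → _ , sq , refl)
        (λ {a} {b} _ _ e → ι-injective (·-cancelˡ-≋ (ι a) (ι b) D-unit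
          (≋-trans (≋-sym (ι-residue p _)) (≋-trans (≡⇒≋ (cong ι e)) (ι-residue p _)))))
        id
      image⊆ : ∀ {b} → Image b → NonSquare b
      image⊆ (a , (a≢0 , x , x²≋a) , refl) = ¬IsSquare⇒≢0 ns , ns
        where
        x≢0 : ¬ x ≋ + 0 [ p ]
        x≢0 h = a≢0 (≋-trans (≋-sym x²≋a) (·-cong-≋ h h))
        ns : ¬ IsSquare (ι (times a))
        ns sq = D-ns (IsSquare-ratio D x (≢0⇒Unit x≢0) (IsSquare-resp-≋
          (≋-trans (ι-residue p _) (·-cong-≋ (≋-refl {a = D}) (≋-sym x²≋a))) sq))
      Δ-non-square : NonSquare (residue p Δ)
      Δ-non-square = (λ h → ¬IsSquare⇒≢0 Δ-ns (≋-trans (≋-sym (ι-residue p Δ)) h)) ,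
        λ sq → Δ-ns (IsSquare-resp-≋ (ι-residue p Δ) sq)

-- For `N = m = n` and symbol +1 this is equivalent to being a liar. Unlike `Liar` it restricts to
-- divisors `m` of n with the exponent kept, and it glues along coprime factors.
Good : ℕ → ℕ → ℤ → ℤ → Set
Good N m b c = Unit m (c · disc b c) × Fixed N m b c

-- Square discriminants: pairs of distinct roots in the prime field

module SplitQuadratics {p : ℕ} (p-prime : Prime p) (p≢2 : p ≢ 2) (e : ℕ) where
  open ModPrime p-prime
  open Odd p≢2

  private
    -- Writing N as e + 2 makes N - 1 the visibly positive number e + 1, and `n ∸ 1` in the
    -- definitions of g and h reduces to it.
    N = suc (suc e)
    g = ℕGCD.gcd (suc e) (p ℕ.∸ 1)

  -- The remainder s X + t of X^N takes the values α and β at α and β, and a linear polynomial is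
  -- determined by its values at two points whose difference is a unit.
  two-fixed-roots⇒Fixed : ∀ {b c} α β → Unit p (α - β) →
    α · α + b · α + c ≋ + 0 [ p ] → β · β + b · β + c ≋ + 0 [ p ] →
    α ^ᶻ N ≋ α [ p ] → β ^ᶻ N ≋ β [ p ] → Fixed N p b c
  two-fixed-roots⇒Fixed {b} {c} α β αβ-unit hα hβ fα fβ = s≋1 , t≋0
    where
    s = proj₁ (X^mod b c N)
    t = proj₂ (X^mod b c N)
    eα : α ≋ s · α + t [ p ]
    eα = ≋-trans (≋-sym fα) (root-pow α hα N)
    eβ : β ≋ s · β + t [ p ]
    eβ = ≋-trans (≋-sym fβ) (root-pow β hβ N)
    lemma : ∀ s t α β → (s · α + t) - (s · β + t) ≡ (α - β) · s
    lemma = solve-∀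
    s≋1 : s ≋ + 1 [ p ]
    s≋1 = ≋-sym (·-cancelˡ-≋ (+ 1) s αβ-unit (≋-trans (≡⇒≋ (ℤₚ.*-identityʳ (α - β)))
      (≋-trans (minus-cong-≋ eα eβ) (≡⇒≋ (lemma s t α β)))))
    lemma′ : ∀ s t α → t ≡ s · α + t - s · α
    lemma′ = solve-∀
    lemma″ : ∀ α → α - + 1 · α ≡ + 0
    lemma″ = solve-∀
    t≋0 : t ≋ + 0 [ p ]
    t≋0 = ≋-trans (≡⇒≋ (lemma′ s t α)) (≋-trans (minus-cong-≋ (≋-sym eα) (·-cong-≋ s≋1 (≋-refl {a = α}))) (≡⇒≋ (lemma″ α)))

  Fixed⇒fixed-root : ∀ {b c} α → α · α + b · α + c ≋ + 0 [ p ] → Fixed N p b c → α ^ᶻ N ≋ α [ p ]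
  Fixed⇒fixed-root α hα (hs , ht) = ≋-trans (root-pow α hα N)
    (≋-trans (+-cong-≋ (·-cong-≋ hs (≋-refl {a = α})) ht) (≡⇒≋ (lemma α)))
    where
    lemma : ∀ α → + 1 · α + + 0 ≡ α
    lemma = solve-∀

  private
    RootOfUnity : Fin p → Set
    RootOfUnity a = ι a ^ᶻ suc e ≋ + 1 [ p ]

    DistinctRoots : Fin p × Fin p → Set
    DistinctRoots (a , b) = (RootOfUnity a × RootOfUnity b) × a ≢ b

    Ordered : Fin p × Fin p → Set
    Ordered (a , b) = toℕ a < toℕ b

    card-ordered : HasCard (λ ab → DistinctRoots ab × Ordered ab) ((g * g ℕ.∸ g) ℕ./ 2)
    card-ordered =
      let k , hk , 2k = card-half (λ (a , b) → b , a) (λ (a , b) → toℕ a ℕ.<? toℕ b)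
            (λ ((ra , rb) , a≢b) → (rb , ra) , (λ h → a≢b (sym h))) (λ _ → refl) (λ _ l l′ → ℕₚ.<-asym l l′)
            (λ (_ , a≢b) l → ℕₚ.≤∧≢⇒< (ℕₚ.≮⇒≥ l) (λ h → a≢b (sym (Finₚ.toℕ-injective h))))
            (card-off-diagonal Finₚ._≟_ (card-unit-roots e))
      in subst (HasCard _) (double⇒half 2k) hk

    sumₚ productₚ : Fin p × Fin p → ℤ
    sumₚ (a , b) = - (ι a + ι b)
    productₚ (a , b) = ι a · ι b

    quadratic : Fin p × Fin p → Fin p × Fin p
    quadratic ab = residue p (sumₚ ab) , residue p (productₚ ab)

    SplitGood : Fin p × Fin p → Set
    SplitGood (b , c) = Good N p (ι b) (ι c) × IsSquare (disc (ι b) (ι c))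

    quadratic-good : ∀ ab → DistinctRoots ab → SplitGood (quadratic ab)
    quadratic-good (a , b) ((ra , rb) , a≢b) =
      ( Unit-resp-≋ (≋-sym (·-cong-≋ ec edisc)) (Unit-· (Unit-· (≢0⇒Unit (^ᶻ-suc≋1⇒≢0 e α ra)) (≢0⇒Unit (^ᶻ-suc≋1⇒≢0 e β rb)))
          (Unit-· difference difference))
      , Fixed-resp-≋ {N} (≋-sym eb) (≋-sym ec) (two-fixed-roots⇒Fixed α β difference
          (≡⇒≋ (rootα α β)) (≡⇒≋ (rootβ α β)) (≋1⇒^ᶻ-suc≋ (suc e) α ra) (≋1⇒^ᶻ-suc≋ (suc e) β rb)) )
      , α - β , ≋-sym edisc
      where
      α = ι a
      β = ι b
      eb : ι (residue p (sumₚ (a , b))) ≋ - (α + β) [ p ]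
      eb = ι-residue p _
      ec : ι (residue p (productₚ (a , b))) ≋ α · β [ p ]
      ec = ι-residue p _
      difference : Unit p (α - β)
      difference = ≢0⇒Unit (λ h → a≢b (ι-injective (minus≋0⇒≋ h)))
      lemma : ∀ α β → - (α + β) · - (α + β) - + 4 · (α · β) ≡ (α - β) · (α - β)
      lemma = solve-∀
      rootα : ∀ α β → α · α + - (α + β) · α + α · β ≡ + 0
      rootα = solve-∀
      rootβ : ∀ α β → β · β + - (α + β) · β + α · β ≡ + 0
      rootβ = solve-∀
      edisc : disc (ι (residue p (sumₚ (a , b)))) (ι (residue p (productₚ (a , b)))) ≋ (α - β) · (α - β) [ p ]
      edisc = ≋-trans (minus-cong-≋ (·-cong-≋ eb eb) (·-cong-≋ (≋-refl {a = + 4}) ec)) (≡⇒≋ (lemma α β))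

    quadratic-swap : ∀ a b → quadratic (a , b) ≡ quadratic (b , a)
    quadratic-swap a b = cong₂ _,_ (cong (residue p ∘ -_) (ℤₚ.+-comm (ι a) (ι b))) (cong (residue p) (ℤₚ.*-comm (ι a) (ι b)))

    quadratic-≡ : ∀ ab {b c} → sumₚ ab ≋ ι b [ p ] → productₚ ab ≋ ι c [ p ] → quadratic ab ≡ (b , c)
    quadratic-≡ ab eb ec = cong₂ _,_ (ι-injective (≋-trans (ι-residue p _) eb)) (ι-injective (≋-trans (ι-residue p _) ec))

    sum-≋ : ∀ ab ab′ → quadratic ab ≡ quadratic ab′ → sumₚ ab ≋ sumₚ ab′ [ p ]
    sum-≋ ab ab′ eq = ≋-trans (≋-sym (ι-residue p _)) (≋-trans (≡⇒≋ (cong (ι ∘ proj₁) eq)) (ι-residue p _))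

    product-≋ : ∀ ab ab′ → quadratic ab ≡ quadratic ab′ → productₚ ab ≋ productₚ ab′ [ p ]
    product-≋ ab ab′ eq = ≋-trans (≋-sym (ι-residue p _)) (≋-trans (≡⇒≋ (cong (ι ∘ proj₂) eq)) (ι-residue p _))

    second-root : ∀ a b a′ b′ → quadratic (a , b) ≡ quadratic (a′ , b′) → a ≡ a′ → b ≡ b′
    second-root a b _ b′ eq refl = ι-injective (≋-trans (≡⇒≋ (lemma (ι a) (ι b)))
      (≋-trans (minus-cong-≋ (neg-cong-≋ (sum-≋ (a , b) (a , b′) eq)) (≋-refl {a = ι a})) (≡⇒≋ (sym (lemma (ι a) (ι b′))))))
      where
      lemma : ∀ a b → b ≡ - - (a + b) - a
      lemma = solve-∀

    -- Equal coefficients make `a` a root of (X - a′)(X - b′), and one of the two factors vanishes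
    -- at it.
    first-root : ∀ a b a′ b′ → quadratic (a , b) ≡ quadratic (a′ , b′) → a ≡ a′ ⊎ a ≡ b′
    first-root a b a′ b′ eq = Sum.map (λ h → ι-injective (minus≋0⇒≋ h)) (λ h → ι-injective (minus≋0⇒≋ h))
      (zero-product (ι a - ι a′) (ι a - ι b′) (≋-trans (≡⇒≋ (lemma (ι a) (ι b) (ι a′) (ι b′)))
        (≋-trans (+-cong-≋ (·-cong-≋ (≋⇒minus≋0 (sum-≋ (a′ , b′) (a , b) (sym eq))) (≋-refl {a = ι a})) (≋⇒minus≋0 (product-≋ (a′ , b′) (a , b) (sym eq))))
          (≡⇒≋ (lemma′ (ι a))))))
      where
      lemma : ∀ a b a′ b′ → (a - a′) · (a - b′) ≡ (- (a′ + b′) - - (a + b)) · a + (a′ · b′ - a · b)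
      lemma = solve-∀
      lemma′ : ∀ a → + 0 · a + + 0 ≡ + 0
      lemma′ = solve-∀

    quadratic-injective : ∀ ab ab′ → Ordered ab → Ordered ab′ → quadratic ab ≡ quadratic ab′ → ab ≡ ab′
    quadratic-injective (a , b) (a′ , b′) l l′ eq with first-root a b a′ b′ eq
    ... | inj₁ a≡a′ = cong₂ _,_ a≡a′ (second-root a b a′ b′ eq a≡a′)
    ... | inj₂ a≡b′ = contradiction
      (subst₂ (λ x y → toℕ x < toℕ y) a≡b′ (second-root a b b′ a′ (trans eq (quadratic-swap a′ b′)) a≡b′) l) (ℕₚ.<-asym l′)

    order : ∀ ab {bc} → DistinctRoots ab → quadratic ab ≡ bc → ∃[ ab′ ] ((DistinctRoots ab′ × Ordered ab′) × quadratic ab′ ≡ bc)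
    order (a , b) d@((ra , rb) , a≢b) eq with ℕₚ.<-cmp (toℕ a) (toℕ b)
    ... | tri< l _ _ = (a , b) , (d , l) , eq
    ... | tri≈ _ h _ = contradiction (Finₚ.toℕ-injective h) a≢b
    ... | tri> _ _ l = (b , a) , (((rb , ra) , λ h → a≢b (sym h)) , l) , trans (quadratic-swap b a) eq

    roots : ∀ bc → SplitGood bc → ∃[ ab ] (DistinctRoots ab × quadratic ab ≡ bc)
    roots (b , c) ((cΔ-unit , fixed) , s , s²≋Δ) = (a₁ , a₂) ,
      ((root-of-unity α ex αβ-unitˡ (vieta-rootˡ α β) , root-of-unity β ex αβ-unitʳ (vieta-rootʳ α β)) , distinct) ,
      quadratic-≡ (a₁ , a₂) ex ey
      where
      -- With h = 1/2 and s a square root of Δ, the quadratic formula gives the two roots (-b + s)/2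
      -- and (-b - s)/2.
      h = Unit.inverse 2-unit
      a₁ = residue p (h · (- ι b + s))
      a₂ = residue p (h · (- ι b - s))
      α = ι a₁
      β = ι a₂
      eα : α ≋ h · (- ι b + s) [ p ]
      eα = ι-residue p _
      eβ : β ≋ h · (- ι b - s) [ p ]
      eβ = ι-residue p _
      sum-lemma : ∀ h b s → - (h · (- b + s) + h · (- b - s)) ≡ h · + 2 · b
      sum-lemma = solve-∀
      ex : - (α + β) ≋ ι b [ p ]
      ex = ≋-trans (neg-cong-≋ (+-cong-≋ eα eβ)) (≋-trans (≡⇒≋ (sum-lemma h (ι b) s))
        (≋-trans (·-cong-≋ (Unit.inverse-· 2-unit) (≋-refl {a = ι b})) (≡⇒≋ (ℤₚ.*-identityˡ (ι b)))))
      product-lemma : ∀ h b s → h · (- b + s) · (h · (- b - s)) ≡ h · h · (b · b - s · s)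
      product-lemma = solve-∀
      disc-lemma : ∀ h b c → h · h · (b · b - (b · b - + 4 · c)) ≡ (h · + 2) · (h · + 2) · c
      disc-lemma = solve-∀
      ey : α · β ≋ ι c [ p ]
      ey = ≋-trans (·-cong-≋ eα eβ) (≋-trans (≡⇒≋ (product-lemma h (ι b) s))
        (≋-trans (·-cong-≋ (≋-refl {a = h · h}) (minus-cong-≋ (≋-refl {a = ι b · ι b}) s²≋Δ))
        (≋-trans (≡⇒≋ (disc-lemma h (ι b) (ι c)))
        (≋-trans (·-cong-≋ (·-cong-≋ (Unit.inverse-· 2-unit) (Unit.inverse-· 2-unit)) (≋-refl {a = ι c}))
                 (≡⇒≋ (ℤₚ.*-identityˡ (ι c)))))))
      αβ-unit : Unit p (α · β)
      αβ-unit = Unit-resp-≋ (≋-sym ey) (Unit-·ˡ (ι c) _ cΔ-unit)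
      αβ-unitˡ = Unit-·ˡ α β αβ-unit
      αβ-unitʳ = Unit-·ʳ α β αβ-unit
      vieta-rootˡ : ∀ α β → α · α + - (α + β) · α + α · β ≡ + 0
      vieta-rootˡ = solve-∀
      vieta-rootʳ : ∀ α β → β · β + - (α + β) · β + α · β ≡ + 0
      vieta-rootʳ = solve-∀
      root-of-unity : ∀ θ → - (α + β) ≋ ι b [ p ] → Unit p θ → θ · θ + - (α + β) · θ + α · β ≡ + 0 → θ ^ᶻ suc e ≋ + 1 [ p ]
      root-of-unity θ ex θ-unit eq = ^ᶻ-suc≋⇒≋1 (suc e) θ (Unit⇒≢0ₚ θ-unit) (Fixed⇒fixed-root θ
        (≋-trans (+-cong-≋ (+-cong-≋ (≋-refl {a = θ · θ}) (·-cong-≋ (≋-sym ex) (≋-refl {a = θ}))) (≋-sym ey)) (≡⇒≋ eq)) fixed)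
      difference-lemma : ∀ h b s → h · (- b + s) - h · (- b - s) ≡ h · + 2 · s
      difference-lemma = solve-∀
      -- The roots differ by s, and s² = Δ is invertible.
      distinct : a₁ ≢ a₂
      distinct eq = Unit⇒≢0ₚ (Unit-·ʳ (ι c) _ cΔ-unit) (≋-trans (≋-sym s²≋Δ) (·-cong-≋ s≋0 s≋0))
        where
        s≋0 : s ≋ + 0 [ p ]
        s≋0 = ≋-trans (≡⇒≋ (sym (ℤₚ.*-identityˡ s))) (≋-trans (·-cong-≋ (≋-sym (Unit.inverse-· 2-unit)) (≋-refl {a = s}))
          (≋-trans (≡⇒≋ (sym (difference-lemma h (ι b) s))) (≋-trans (minus-cong-≋ (≋-sym eα) (≋-sym eβ))
            (≋⇒minus≋0 (≡⇒≋ (cong ι eq))))))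

  card-split-quadratics : HasCard {Fin p × Fin p}
    (λ (b , c) → Good N p (ι b) (ι c) × IsSquare (disc (ι b) (ι c))) ((g * g ℕ.∸ g) ℕ./ 2)
  card-split-quadratics = card-map quadratic (λ {ab} (d , _) → quadratic-good ab d)
    (λ {ab} {ab′} (_ , l) (_ , l′) → quadratic-injective ab ab′ l l′)
    (λ {bc} sg → let ab , d , eq = roots bc sg in order ab d eq)
    card-ordered

-- Non-square discriminants: conjugate pairs in the quadratic extension by a square root of D

module QuadraticExtension {p : ℕ} (p-prime : Prime p) (p≢2 : p ≢ 2) (e : ℕ)
  (D : ℤ) (D-non-square : ¬ ModPrime.IsSquare p-prime D) where
  open ModPrime p-prime
  open Odd p≢2

  private
    N = suc (suc e)
    g = ℕGCD.gcd (suc e) (p ℕ.∸ 1)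
    h = ℕGCD.gcd (suc e) (p * p ℕ.∸ 1)

    0₂ : ℤ × ℤ
    0₂ = + 0 , + 0

    D-unit : Unit p D
    D-unit = ≢0⇒Unit (¬IsSquare⇒≢0 D-non-square)

    Elt = Fin p × Fin p

    el : Elt → ℤ × ℤ
    el (i , j) = ι i , ι j

    rep : ℤ × ℤ → Elt
    rep (u , v) = residue p u , residue p v

    el-rep : ∀ x → el (rep x) ≋₂ x [ p ]
    el-rep (u , v) = ι-residue p u , ι-residue p v

    el-injective : ∀ a b → el a ≋₂ el b [ p ] → a ≡ b
    el-injective _ _ (hu , hv) = cong₂ _,_ (ι-injective hu) (ι-injective hv)

    infix 4 _≋₂?_
    _≋₂?_ : ∀ x y → Dec (x ≋₂ y [ p ])
    (u , v) ≋₂? (u′ , v′) = (u ≋? u′ [ p ]) Dec.×-dec (v ≋? v′ [ p ])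

    normₖ : ℤ × ℤ → ℤ
    normₖ = norm (+ 0) (- D)

    -- If u were invertible, v² = D u² would make D a square. So the norm vanishes only at 0, and
    -- being multiplicative it excludes zero divisors.
    norm-cancel : ∀ u v → normₖ (u , v) ≋ + 0 [ p ] → u ≋ + 0 [ p ]
    norm-cancel u v hn with u ≋? + 0 [ p ]
    ... | yes u≋0 = u≋0
    ... | no  u≢0 = contradiction (IsSquare-ratio D u (≢0⇒Unit u≢0) (v , minus≋0⇒≋ (≋-trans (≡⇒≋ (lemma u v D)) hn))) D-non-square
      where
      lemma : ∀ u v D → v · v - D · (u · u) ≡ v · v - + 0 · (u · v) + - D · (u · u)
      lemma = solve-∀

    norm≋0⇒≋0 : ∀ x → normₖ x ≋ + 0 [ p ] → x ≋₂ 0₂ [ p ]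
    norm≋0⇒≋0 (u , v) hn = u≋0 , square≋0 (≋-trans (≡⇒≋ (lemma v D))
      (≋-trans (≋-sym (norm-cong (+ 0) (- D) {u , v} {+ 0 , v} (u≋0 , ≋-refl))) hn))
      where
      u≋0 = norm-cancel u v hn
      lemma : ∀ v D → v · v ≡ v · v - + 0 · (+ 0 · v) + - D · (+ 0 · + 0)
      lemma = solve-∀

    norm-0 : ∀ {x} → x ≋₂ 0₂ [ p ] → normₖ x ≋ + 0 [ p ]
    norm-0 {x} h = ≋-trans (norm-cong (+ 0) (- D) {x} {0₂} h) (≡⇒≋ (lemma D))
      where
      lemma : ∀ D → + 0 · + 0 - + 0 · (+ 0 · + 0) + - D · (+ 0 · + 0) ≡ + 0
      lemma = solve-∀

    K-no-zero-divisors : ∀ x y → ¬ x ≋₂ 0₂ [ p ] → mulQ (+ 0) (- D) x y ≋₂ 0₂ [ p ] → y ≋₂ 0₂ [ p ]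
    K-no-zero-divisors x y x≢0 hxy = norm≋0⇒≋0 y (no-zero-divisors _ _ (x≢0 ∘ norm≋0⇒≋0 x)
      (≋-trans (≡⇒≋ (sym (norm-mulQ (+ 0) (- D) x y))) (norm-0 hxy)))

    0ₑ : Elt
    0ₑ = rep 0₂

    card-K-units : HasCard {Elt} (λ a → ¬ el a ≋₂ 0₂ [ p ]) (p * p ℕ.∸ 1)
    card-K-units =
      let i , j , hi , hj , i+j = card-split (card-× (card-Fin p) (card-Fin p)) (λ a → el a ≋₂? 0₂)
          i≡1 = card-unique hi (card-singleton 0ₑ ((tt , tt) , el-rep 0₂)
            (λ {a} (_ , h) → el-injective a 0ₑ (≋₂-trans h (≋₂-sym (el-rep 0₂)))))
      in subst (HasCard _) (cong (ℕ._∸ 1) (trans (cong (ℕ._+ j) (sym i≡1)) i+j)) (card-resp-⇔ proj₂ (λ h → (tt , tt) , h) hj)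

    1≢0 : ¬ (+ 0 , + 1) ≋₂ 0₂ [ p ]
    1≢0 (_ , h) = Unit⇒≢0ₚ Unit-1 h

    module K = FiniteField.Domain (quadRing p (+ 0) (- D)) 1≢0 _≋₂?_ K-no-zero-divisors
      el el-injective rep el-rep card-K-units

    0<p²∸1 : 0 < p * p ℕ.∸ 1
    0<p²∸1 = ℕₚ.m<n⇒0<n∸m (ℕₚ.≤-trans (ℕ.nonTrivial⇒n>1 p {{Primality.prime⇒nonTrivial p-prime}}) (ℕₚ.m≤m*n p p))

    infixr 8 _^ₖ_
    _^ₖ_ : ℤ × ℤ → ℕ → ℤ × ℤ
    _^ₖ_ = powQ (+ 0) (- D)

    RootOfUnity : Elt → Set
    RootOfUnity a = el a ^ₖ suc e ≋₂ (+ 0 , + 1) [ p ]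

    OutsidePrimeField : Elt → Set
    OutsidePrimeField (i , _) = ¬ ι i ≋ + 0 [ p ]

    scalar-^ₖ : ∀ {u} → u ≋ + 0 [ p ] → ∀ v k → (u , v) ^ₖ k ≋₂ (+ 0 , v ^ᶻ k) [ p ]
    scalar-^ₖ u≋0 v zero    = ≡⇒≋₂ refl
    scalar-^ₖ {u} u≋0 v (suc k) = ≋₂-trans (mulQ-cong (+ 0) (- D) {u , v} {+ 0 , v} (u≋0 , ≋-refl) (scalar-^ₖ u≋0 v k))
      (≡⇒≋₂ (cong₂ _,_ (first v (v ^ᶻ k)) (second v (v ^ᶻ k) D)))
      where
      first : ∀ v w → + 0 · w + v · + 0 - + 0 · (+ 0 · + 0) ≡ + 0
      first = solve-∀
      second : ∀ v w D → v · w - - D · (+ 0 · + 0) ≡ v · w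
      second = solve-∀

    -- The roots of unity with vanishing X-coefficient are those of the prime field, of which there
    -- are g.
    card-outside : HasCard (λ a → RootOfUnity a × OutsidePrimeField a) (h ℕ.∸ g)
    card-outside =
      let i , j , hi , hj , i+j = card-split (K.card-roots-of-unity e 0<p²∸1) (λ (i , _) → ι i ≋? + 0 [ p ])
          i≡g = card-unique hi (card-map {P = λ b → ι b ^ᶻ suc e ≋ + 1 [ p ]} (λ b → residue p (+ 0) , b)
            (λ {b} r → ≋₂-trans (scalar-^ₖ (ι-residue p (+ 0)) (ι b) (suc e)) (≋-refl , r) , ι-residue p (+ 0))
            (λ _ _ → cong proj₂)
            (λ {(a , b)} (r , a≋0) → b , ≋-trans (≋-sym (proj₂ (scalar-^ₖ a≋0 (ι b) (suc e)))) (proj₂ r) ,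
              cong (_, b) (ι-injective (≋-trans (ι-residue p (+ 0)) (≋-sym a≋0))))
            (card-unit-roots e))
      in subst (HasCard _) (trans (sym (ℕₚ.m+n∸m≡n i j)) (cong₂ ℕ._∸_ i+j i≡g)) hj

    FixedOutside : Elt → Set
    FixedOutside a = el a ^ₖ N ≋₂ el a [ p ] × OutsidePrimeField a

    card-fixed-outside : HasCard FixedOutside (h ℕ.∸ g)
    card-fixed-outside = card-resp-⇔
      (λ {a} (r , o) → ≋₂-trans (mulQ-cong (+ 0) (- D) {el a} {el a} (≡⇒≋₂ refl) r)
        (≡⇒≋₂ (trans (mulQ-comm (+ 0) (- D) (el a) (+ 0 , + 1)) (mulQ-identityˡ (+ 0) (- D) (el a)))) , o)
      (λ {a} (f , o) → K.*-cancelʳ {el a ^ₖ suc e} {+ 0 , + 1} {el a} (o ∘ proj₁)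
        (≋₂-trans (≡⇒≋₂ (mulQ-comm (+ 0) (- D) (el a ^ₖ suc e) (el a)))
          (≋₂-trans f (≡⇒≋₂ (sym (mulQ-identityˡ (+ 0) (- D) (el a)))))) , o)
      card-outside

    -- The characteristic polynomial of u X + v over ℤ[X]/(X² - D).
    linear constant : ℤ × ℤ → ℤ
    linear x = - trace (+ 0) x
    constant = normₖ

    constant-cong : ∀ x y → x ≋₂ y [ p ] → constant x ≋ constant y [ p ]
    constant-cong x y h = norm-cong (+ 0) (- D) {x} {y} h

    linear-≡ : ∀ u v → linear (u , v) ≡ - (+ 2 · v)
    linear-≡ = lemma
      where
      lemma : ∀ u v → - (+ 2 · v - + 0 · u) ≡ - (+ 2 · v)
      lemma = solve-∀

    constant-≡ : ∀ u v → constant (u , v) ≡ v · v - D · (u · u)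
    constant-≡ u v = lemma u v D
      where
      lemma : ∀ u v D → v · v - + 0 · (u · v) + - D · (u · u) ≡ v · v - D · (u · u)
      lemma = solve-∀

    disc-≡ : ∀ u v → disc (linear (u , v)) (constant (u , v)) ≡ D · (+ 2 · u · (+ 2 · u))
    disc-≡ u v = lemma u v D
      where
      lemma : ∀ u v D → - (+ 2 · v - + 0 · u) · - (+ 2 · v - + 0 · u) - + 4 · (v · v - + 0 · (u · v) + - D · (u · u))
        ≡ D · (+ 2 · u · (+ 2 · u))
      lemma = solve-∀

    conjugate : Elt → Elt
    conjugate (i , j) = negate i , j

    conjugate-linear : ∀ a → linear (el (conjugate a)) ≋ linear (el a) [ p ]
    conjugate-linear (i , j) = ≡⇒≋ (trans (linear-≡ (ι (negate i)) (ι j)) (sym (linear-≡ (ι i) (ι j))))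

    conjugate-constant : ∀ a → constant (el (conjugate a)) ≋ constant (el a) [ p ]
    conjugate-constant (i , j) = ≋-trans (constant-cong (ι (negate i) , ι j) (- ι i , ι j) (ι-negate i , ≋-refl)) (≡⇒≋ (lemma (ι i) (ι j) D))
      where
      lemma : ∀ u v D → v · v - + 0 · (- u · v) + - D · (- u · - u) ≡ v · v - + 0 · (u · v) + - D · (u · u)
      lemma = solve-∀

    Fixed-charpoly : ∀ {a} → FixedOutside a → Fixed N p (linear (el a)) (constant (el a))
    Fixed-charpoly {i , j} (f , o) = powQ-fixed⇒Fixed N (+ 0) (- D) (ι i) (ι j) (≢0⇒Unit o) f

    -- Outside the prime field, α^N = α is a property of the characteristic polynomial alone, and
    -- conjugates share it.
    conjugate-fixed : ∀ {a} → FixedOutside a → FixedOutside (conjugate a)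
    conjugate-fixed {a@(i , j)} f@(_ , o) =
      Fixed⇒powQ-fixed N (+ 0) (- D) (ι (negate i)) (ι j)
        (Fixed-resp-≋ {N} (≋-sym (conjugate-linear a)) (≋-sym (conjugate-constant a)) (Fixed-charpoly {a} f)) ,
      negate-≢0 {i} o

    LowerElt : Elt → Set
    LowerElt (i , _) = Lower i

    card-lower : HasCard (λ a → FixedOutside a × LowerElt a) ((h ℕ.∸ g) ℕ./ 2)
    card-lower =
      let k , hk , 2k = card-half conjugate (λ (i , _) → Lower? i) (λ {a} → conjugate-fixed {a})
            (λ {(i , j)} _ → cong (_, j) (negate-involutive i))
            (λ {(i , _)} _ → Lower⇒¬Lower-negate {i}) (λ {(i , _)} (_ , o) → ¬Lower⇒Lower-negate {i} o) card-fixed-outside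
      in subst (HasCard _) (double⇒half 2k) hk

    charpoly : Elt → Fin p × Fin p
    charpoly a = residue p (linear (el a)) , residue p (constant (el a))

    InertGood : Fin p × Fin p → Set
    InertGood (b , c) = Good N p (ι b) (ι c) × ¬ IsSquare (disc (ι b) (ι c))

    charpoly-good : ∀ a → FixedOutside a → InertGood (charpoly a)
    charpoly-good a@(i , j) f@(_ , o) =
      ( Unit-resp-≋ (≋-sym (·-cong-≋ ec edisc)) (Unit-· (≢0⇒Unit (o ∘ norm-cancel u v))
          (Unit-· D-unit (Unit-· 2u-unit 2u-unit)))
      , Fixed-resp-≋ {N} (≋-sym eb) (≋-sym ec) (Fixed-charpoly {a} f) )
      , λ sq → D-non-square (IsSquare-ratio D (+ 2 · u) 2u-unit (IsSquare-resp-≋ edisc sq))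
      where
      u = ι i
      v = ι j
      2u-unit : Unit p (+ 2 · u)
      2u-unit = Unit-· 2-unit (≢0⇒Unit o)
      eb : ι (residue p (linear (u , v))) ≋ linear (u , v) [ p ]
      eb = ι-residue p _
      ec : ι (residue p (constant (u , v))) ≋ constant (u , v) [ p ]
      ec = ι-residue p _
      edisc : disc (ι (residue p (linear (u , v)))) (ι (residue p (constant (u , v)))) ≋ D · (+ 2 · u · (+ 2 · u)) [ p ]
      edisc = ≋-trans (minus-cong-≋ (·-cong-≋ eb eb) (·-cong-≋ (≋-refl {a = + 4}) ec)) (≡⇒≋ (disc-≡ u v))

    -- The trace determines v, then the norm determines u². The remaining sign is the choice between
    -- an element and its conjugate, which `LowerElt` settles.
    charpoly-injective : ∀ a b → LowerElt a → LowerElt b → charpoly a ≡ charpoly b → a ≡ b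
    charpoly-injective (i , j) (i′ , j′) l l′ eq = cong₂ _,_ (square-injective l l′ u²≋u′²) (ι-injective v≋v′)
      where
      u = ι i
      v = ι j
      u′ = ι i′
      v′ = ι j′
      elinear : - (+ 2 · v) ≋ - (+ 2 · v′) [ p ]
      elinear = ≋-trans (≡⇒≋ (sym (linear-≡ u v))) (≋-trans (≋-sym (ι-residue p _))
        (≋-trans (≡⇒≋ (cong (ι ∘ proj₁) eq)) (≋-trans (ι-residue p _) (≡⇒≋ (linear-≡ u′ v′)))))
      econstant : v · v - D · (u · u) ≋ v′ · v′ - D · (u′ · u′) [ p ]
      econstant = ≋-trans (≡⇒≋ (sym (constant-≡ u v))) (≋-trans (≋-sym (ι-residue p _))
        (≋-trans (≡⇒≋ (cong (ι ∘ proj₂) eq)) (≋-trans (ι-residue p _) (≡⇒≋ (constant-≡ u′ v′)))))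
      v≋v′ : v ≋ v′ [ p ]
      v≋v′ = ·-cancelˡ-≋ v v′ 2-unit (≋-trans (≡⇒≋ (sym (ℤₚ.neg-involutive (+ 2 · v))))
        (≋-trans (neg-cong-≋ elinear) (≡⇒≋ (ℤₚ.neg-involutive (+ 2 · v′)))))
      lemma : ∀ v w → w ≡ v · v - (v · v - w)
      lemma = solve-∀
      u²≋u′² : u · u ≋ u′ · u′ [ p ]
      u²≋u′² = ·-cancelˡ-≋ (u · u) (u′ · u′) D-unit (≋-trans (≡⇒≋ (lemma v (D · (u · u))))
        (≋-trans (minus-cong-≋ (·-cong-≋ v≋v′ v≋v′) econstant) (≡⇒≋ (sym (lemma v′ (D · (u′ · u′)))))))

    -- Every non-square discriminant is D w² for some w, so one extension serves for all of these
    -- quadratics: their roots are -b/2 ± (w/2) √D.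
    charpoly-surjective : ∀ bc → InertGood bc → ∃[ a ] ((FixedOutside a × LowerElt a) × charpoly a ≡ bc)
    charpoly-surjective (b , c) ((cΔ-unit , fixed) , Δ-non-square) =
      let w , Δ≋Dw² = non-square-ratio D-non-square Δ-non-square in go w Δ≋Dw²
      where
      β = ι b
      γ = ι c
      Δ = disc β γ
      go : ∀ w → Δ ≋ D · (w · w) [ p ] → ∃[ a ] ((FixedOutside a × LowerElt a) × charpoly a ≡ (b , c))
      go w Δ≋Dw² = (i , j) , ((fixed-power , u≢0) , proj₁ (proj₂ lower)) ,
        cong₂ _,_ (ι-injective (≋-trans (ι-residue p _) elinear)) (ι-injective (≋-trans (ι-residue p _) econstant))
        where
        h₂ = Unit.inverse 2-unit
        2h₂≋1 = Unit.inverse-· 2-unit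
        h₂w = residue p (h₂ · w)
        eh₂w : ι h₂w ≋ h₂ · w [ p ]
        eh₂w = ι-residue p _
        h₂w≢0 : ¬ ι h₂w ≋ + 0 [ p ]
        h₂w≢0 h = ¬IsSquare⇒≢0 Δ-non-square (≋-trans Δ≋Dw² (≋-trans (·-cong-≋ (≋-refl {a = D}) (·-cong-≋ w≋0 w≋0)) (≡⇒≋ (ℤₚ.*-zeroʳ D))))
          where
          lemma : ∀ h w → h · + 2 · w ≡ + 2 · (h · w)
          lemma = solve-∀
          w≋0 : w ≋ + 0 [ p ]
          w≋0 = ≋-trans (≡⇒≋ (sym (ℤₚ.*-identityˡ w))) (≋-trans (·-cong-≋ (≋-sym 2h₂≋1) (≋-refl {a = w}))
            (≋-trans (≡⇒≋ (lemma h₂ w)) (·-cong-≋ (≋-refl {a = + 2}) (≋-trans (≋-sym eh₂w) h))))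
        -- This chooses the sign of w/2; only its square enters the norm.
        lower = lower-representative h₂w≢0
        i = proj₁ lower
        j = residue p (- (h₂ · β))
        u = ι i
        v = ι j
        ev : v ≋ - (h₂ · β) [ p ]
        ev = ι-residue p _
        eu² : u · u ≋ h₂ · w · (h₂ · w) [ p ]
        eu² = ≋-trans (square-of-representative (proj₂ (proj₂ lower))) (·-cong-≋ eh₂w eh₂w)
        u≢0 : ¬ u ≋ + 0 [ p ]
        u≢0 h = h₂w≢0 (square≋0 (≋-trans (·-cong-≋ eh₂w eh₂w) (≋-trans (≋-sym eu²) (·-cong-≋ h h))))
        linear-lemma : ∀ h b → - (+ 2 · - (h · b)) ≡ h · + 2 · b
        linear-lemma = solve-∀
        elinear : linear (u , v) ≋ β [ p ]
        elinear = ≋-trans (≡⇒≋ (linear-≡ u v)) (≋-trans (neg-cong-≋ (·-cong-≋ (≋-refl {a = + 2}) ev))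
          (≋-trans (≡⇒≋ (linear-lemma h₂ β)) (≋-trans (·-cong-≋ 2h₂≋1 (≋-refl {a = β})) (≡⇒≋ (ℤₚ.*-identityˡ β)))))
        constant-lemma : ∀ h b w D → - (h · b) · - (h · b) - D · (h · w · (h · w)) ≡ h · h · (b · b - D · (w · w))
        constant-lemma = solve-∀
        disc-lemma : ∀ h b c → h · h · (b · b - (b · b - + 4 · c)) ≡ (h · + 2) · (h · + 2) · c
        disc-lemma = solve-∀
        econstant : constant (u , v) ≋ γ [ p ]
        econstant = ≋-trans (≡⇒≋ (constant-≡ u v)) (≋-trans (minus-cong-≋ (·-cong-≋ ev ev) (·-cong-≋ (≋-refl {a = D}) eu²))
          (≋-trans (≡⇒≋ (constant-lemma h₂ β w D))
          (≋-trans (·-cong-≋ (≋-refl {a = h₂ · h₂}) (minus-cong-≋ (≋-refl {a = β · β}) (≋-sym Δ≋Dw²)))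
          (≋-trans (≡⇒≋ (disc-lemma h₂ β γ))
          (≋-trans (·-cong-≋ (·-cong-≋ 2h₂≋1 2h₂≋1) (≋-refl {a = γ})) (≡⇒≋ (ℤₚ.*-identityˡ γ)))))))
        fixed-power : (u , v) ^ₖ N ≋₂ (u , v) [ p ]
        fixed-power = Fixed⇒powQ-fixed N (+ 0) (- D) u v (Fixed-resp-≋ {N} (≋-sym elinear) (≋-sym econstant) fixed)

  card-inert-quadratics : HasCard {Fin p × Fin p}
    (λ (b , c) → Good N p (ι b) (ι c) × ¬ IsSquare (disc (ι b) (ι c))) ((h ℕ.∸ g) ℕ./ 2)
  card-inert-quadratics = card-map charpoly (λ {a} (f , _) → charpoly-good a f)
    (λ {a} {b} (_ , l) (_ , l′) → charpoly-injective a b l l′)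
    (λ {bc} → charpoly-surjective bc)
    card-lower

card-inert-quadratics : ∀ {p} (p-prime : Prime p) → p ≢ 2 → ∀ e → HasCard {Fin p × Fin p}
  (λ (b , c) → Good (suc (suc e)) p (ι b) (ι c) × ¬ ModPrime.IsSquare p-prime (disc (ι b) (ι c)))
  ((ℕGCD.gcd (suc e) (p * p ℕ.∸ 1) ℕ.∸ ℕGCD.gcd (suc e) (p ℕ.∸ 1)) ℕ./ 2)
card-inert-quadratics p-prime p≢2 e = let D , D-non-square = ModPrime.Odd.non-square-exists p-prime p≢2 in
  QuadraticExtension.card-inert-quadratics p-prime p≢2 e D D-non-square

-- Symbols of discriminants and the prime 2

-1ℤ : ℤ
-1ℤ = - (+ 1)

disc-cong : ∀ {m b b′ c c′} → b ≋ b′ [ m ] → c ≋ c′ [ m ] → disc b c ≋ disc b′ c′ [ m ]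
disc-cong eb ec = minus-cong-≋ (·-cong-≋ eb eb) (·-cong-≋ (≋-refl {a = + 4}) ec)

Good-resp-≋ : ∀ N {m} b b′ c c′ → b ≋ b′ [ m ] → c ≋ c′ [ m ] → Good N m b c → Good N m b′ c′
Good-resp-≋ N b b′ c c′ eb ec (u , f) =
  Unit-resp-≋ (·-cong-≋ ec (disc-cong {b = b} {b′} {c} {c′} eb ec)) u , Fixed-resp-≋ {N} {b = b} {b′} {c} {c′} eb ec f

parity : ∀ a → a ≋ + 0 [ 2 ] ⊎ a ≋ + 1 [ 2 ]
parity a with residue 2 a | ι-residue 2 a
... | Fin.zero         | h = inj₁ (≋-sym h)
... | Fin.suc Fin.zero | h = inj₂ (≋-sym h)

Unit2⇒≋1 : ∀ {a} → Unit 2 a → a ≋ + 1 [ 2 ]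
Unit2⇒≋1 {a} u with parity a
... | inj₁ h = contradiction h (Unit⇒≢0 Primality.prime[2] u)
... | inj₂ h = h

Unit2-disc : ∀ b c → Unit 2 (disc b c) → b ≋ + 1 [ 2 ]
Unit2-disc b c u with parity b
... | inj₂ h = h
... | inj₁ h = contradiction (≋-trans (minus-cong-≋ (·-cong-≋ h h) (·-cong-≋ 4≋0 (≋-refl {a = c}))) (≡⇒≋ (lemma c)))
    (Unit⇒≢0 Primality.prime[2] u)
  where
  4≋0 : + 4 ≋ + 0 [ 2 ]
  4≋0 = by (+ 2) refl
  lemma : ∀ c → + 0 · + 0 - + 0 · c ≡ + 0
  lemma = solve-∀

consecutive-even : ∀ k → k · k + k ≋ + 0 [ 2 ]
consecutive-even k with parity k
... | inj₁ h = +-cong-≋ (·-cong-≋ h h) h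
... | inj₂ h = ≋-trans (+-cong-≋ (·-cong-≋ h h) h) (m≋0 2)

-- b = 1 + 2k and c = 1 + 2l give b² - 4c = -3 + 4k(k + 1) - 8l.
disc≋5[8] : ∀ b c → Unit 2 (c · disc b c) → disc b c ≋ + 5 [ 8 ]
disc≋5[8] b c u with Unit2-disc b c (Unit-·ʳ c (disc b c) u) | Unit2⇒≋1 (Unit-·ˡ c (disc b c) u)
... | by k refl | by l refl with consecutive-even k
... | by j e = by (j - l - + 1) (trans (lemma k l) (trans (cong (λ x → - + 3 + + 4 · x - + 8 · l) e) (lemma′ j l)))
  where
  lemma : ∀ k l → (+ 1 + k · + 2) · (+ 1 + k · + 2) - + 4 · (+ 1 + l · + 2) ≡ - + 3 + + 4 · (k · k + k) - + 8 · l
  lemma = solve-∀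
  lemma′ : ∀ j l → - + 3 + + 4 · (+ 0 + j · + 2) - + 8 · l ≡ + 5 + (j - l - + 1) · + 8
  lemma′ = solve-∀

module Symbols {p : ℕ} (p-prime : Prime p) where
  open ModPrime p-prime

  private
    mod-square : ∀ {a} → (∃[ x ] (x · x ≡ a [mod p ])) → IsSquare a
    mod-square {a} (x , h) = x , mod⇒≋ (x · x) a h

    -- An odd cΔ forces Δ ≡ 5 modulo 8, which contradicts evenness and the residues 1 and 7.
    2-symbol : ∀ {b c s} → p ≡ 2 → Unit p (c · disc b c) → PrimeSym (disc b c) p s → s ≡ -1ℤ
    2-symbol refl u (odd-div p≢2 _)    = contradiction refl p≢2
    2-symbol refl u (odd-res p≢2 _ _)  = contradiction refl p≢2
    2-symbol refl u (odd-nres p≢2 _ _) = contradiction refl p≢2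
    2-symbol {b} {c} refl u (two-even _ h) = contradiction (∣⇒≋0 {2} {disc b c} h) (Unit⇒≢0 Primality.prime[2] (Unit-·ʳ c (disc b c) u))
    2-symbol {b} {c} refl u (two-pm1 _ (inj₁ h)) = contradiction (≋⇒mod {8} {+ 5} {+ 1} (≋-trans (≋-sym (disc≋5[8] b c u)) (mod⇒≋ (disc b c) (+ 1) h))) 8∤4
      where
      8∤4 : ¬ 8 ℕ∣.∣ 4
      8∤4 = ℕ∣.>⇒∤ (ℕₚ.m≤m+n 5 3)
    2-symbol {b} {c} refl u (two-pm1 _ (inj₂ h)) = contradiction (≋⇒mod {8} {+ 5} {+ 7} (≋-trans (≋-sym (disc≋5[8] b c u)) (mod⇒≋ (disc b c) (+ 7) h))) 8∤2
      where
      8∤2 : ¬ 8 ℕ∣.∣ 2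
      8∤2 = ℕ∣.>⇒∤ (ℕₚ.m≤m+n 3 5)
    2-symbol refl u (two-pm3 _ _) = refl

    odd-symbol : ∀ {a s} → p ≢ 2 → Unit p a → PrimeSym a p s → (s ≡ + 1 × IsSquare a) ⊎ (s ≡ -1ℤ × ¬ IsSquare a)
    odd-symbol {a} p≢2 u (odd-div _ h)    = contradiction (∣⇒≋0 {p} {a} h) (Unit⇒≢0ₚ u)
    odd-symbol p≢2 u (odd-res _ _ h)  = inj₁ (refl , mod-square h)
    odd-symbol p≢2 u (odd-nres _ _ h) = inj₂ (refl , λ (x , k) → h (x , ≋⇒mod k))
    odd-symbol p≢2 u (two-even e _)   = contradiction e p≢2
    odd-symbol p≢2 u (two-pm1 e _)    = contradiction e p≢2
    odd-symbol p≢2 u (two-pm3 e _)    = contradiction e p≢2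

  square⇒symbol : ∀ {a} → p ≢ 2 → Unit p a → IsSquare a → PrimeSym a p (+ 1)
  square⇒symbol p≢2 u (x , h) = odd-res p≢2 (λ d → Unit⇒≢0ₚ u (∣⇒≋0 d)) (x , ≋⇒mod h)

  symbol⇒square : ∀ {a} → p ≢ 2 → Unit p a → PrimeSym a p (+ 1) → IsSquare a
  symbol⇒square p≢2 u h with odd-symbol p≢2 u h
  ... | inj₁ (_ , sq) = sq

  non-square⇒symbol : ∀ {a} → p ≢ 2 → Unit p a → ¬ IsSquare a → PrimeSym a p -1ℤ
  non-square⇒symbol p≢2 u ns = odd-nres p≢2 (λ d → Unit⇒≢0ₚ u (∣⇒≋0 d)) (λ h → ns (mod-square h))

  symbol⇒non-square : ∀ {a} → p ≢ 2 → Unit p a → PrimeSym a p -1ℤ → ¬ IsSquare a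
  symbol⇒non-square p≢2 u h with odd-symbol p≢2 u h
  ... | inj₂ (_ , ns) = ns

  -- The symbol at 2 depends on Δ modulo 8, while the coefficients agree only modulo 2. The claim
  -- therefore concerns discriminants with invertible cΔ instead of arbitrary integers: at 2 all of
  -- these have symbol -1.
  symbol-unique : ∀ b b′ c c′ {s s′} → Unit p (c · disc b c) → b ≋ b′ [ p ] → c ≋ c′ [ p ] →
    PrimeSym (disc b c) p s → PrimeSym (disc b′ c′) p s′ → s ≡ s′
  symbol-unique b b′ c c′ {s} {s′} u eb ec h h′ = by-parity (p ℕ.≟ 2)
    where
    Δ≋Δ′ : disc b c ≋ disc b′ c′ [ p ]
    Δ≋Δ′ = disc-cong {b = b} {b′} {c} {c′} eb ec
    u′ : Unit p (c′ · disc b′ c′)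
    u′ = Unit-resp-≋ (·-cong-≋ ec Δ≋Δ′) u
    odd-case : (s ≡ + 1 × IsSquare (disc b c)) ⊎ (s ≡ -1ℤ × ¬ IsSquare (disc b c)) →
      (s′ ≡ + 1 × IsSquare (disc b′ c′)) ⊎ (s′ ≡ -1ℤ × ¬ IsSquare (disc b′ c′)) → s ≡ s′
    odd-case (inj₁ (e , _))  (inj₁ (e′ , _))  = trans e (sym e′)
    odd-case (inj₂ (e , _))  (inj₂ (e′ , _))  = trans e (sym e′)
    odd-case (inj₁ (_ , sq)) (inj₂ (_ , ns))  = contradiction (IsSquare-resp-≋ Δ≋Δ′ sq) ns
    odd-case (inj₂ (_ , ns)) (inj₁ (_ , sq))  = contradiction (IsSquare-resp-≋ (≋-sym Δ≋Δ′) sq) ns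
    by-parity : Dec (p ≡ 2) → s ≡ s′
    by-parity (yes p≡2) = trans (2-symbol {b} {c} p≡2 u h) (sym (2-symbol {b′} {c′} p≡2 u′ h′))
    by-parity (no p≢2)  = odd-case (odd-symbol p≢2 (Unit-·ʳ c (disc b c) u) h) (odd-symbol p≢2 (Unit-·ʳ c′ (disc b′ c′) u′) h′)

  symbol-exists : ∀ b c → Unit p (c · disc b c) → PrimeSym (disc b c) p (+ 1) ⊎ PrimeSym (disc b c) p -1ℤ
  symbol-exists b c u = by-parity (p ℕ.≟ 2)
    where
    odd-case : p ≢ 2 → Dec (IsSquare (disc b c)) → PrimeSym (disc b c) p (+ 1) ⊎ PrimeSym (disc b c) p -1ℤ
    odd-case p≢2 (yes sq) = inj₁ (square⇒symbol p≢2 (Unit-·ʳ c (disc b c) u) sq)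
    odd-case p≢2 (no ns)  = inj₂ (non-square⇒symbol p≢2 (Unit-·ʳ c (disc b c) u) ns)
    by-parity : Dec (p ≡ 2) → PrimeSym (disc b c) p (+ 1) ⊎ PrimeSym (disc b c) p -1ℤ
    by-parity (yes p≡2) = inj₂ (two-pm3 p≡2 (inj₂ (≋⇒mod {8} {disc b c} {+ 5} (disc≋5[8] b c (subst (λ q → Unit q (c · disc b c)) p≡2 u)))))
    by-parity (no p≢2)  = odd-case p≢2 (IsSquare? (disc b c))

  symbol-resp-≋ : ∀ b b′ c c′ {s} → Unit p (c · disc b c) → b ≋ b′ [ p ] → c ≋ c′ [ p ] →
    PrimeSym (disc b c) p s → PrimeSym (disc b′ c′) p s
  symbol-resp-≋ b b′ c c′ {s} u eb ec h = Sum.[ transport , transport ]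
    (symbol-exists b′ c′ (Unit-resp-≋ (·-cong-≋ ec (disc-cong {b = b} {b′} {c} {c′} eb ec)) u))
    where
    transport : ∀ {s′} → PrimeSym (disc b′ c′) p s′ → PrimeSym (disc b′ c′) p s
    transport h′ = subst (PrimeSym (disc b′ c′) p) (sym (symbol-unique b b′ c c′ u eb ec h h′)) h′

  symbol-±1 : ∀ b c {s} → Unit p (c · disc b c) → PrimeSym (disc b c) p s → s ≡ + 1 ⊎ s ≡ -1ℤ
  symbol-±1 b c u h = Sum.map (symbol-unique b b c c u ≋-refl ≋-refl h) (symbol-unique b b c c u ≋-refl ≋-refl h)
    (symbol-exists b c u)

  2-symbol-≢1 : ∀ b c → p ≡ 2 → Unit p (c · disc b c) → ¬ PrimeSym (disc b c) p (+ 1)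
  2-symbol-≢1 b c p≡2 u h with () ← 2-symbol {b} {c} p≡2 u h

-- The symbol is taken at the prime `p` even when the modulus `m` is a power of it, so that lifting
-- from p to m preserves it.
GoodWithSymbol : ℕ → ℕ → ℕ → ℤ → ∀ {m} → Fin m × Fin m → Set
GoodWithSymbol N m p s (b , c) = Good N m (ι b) (ι c) × PrimeSym (disc (ι b) (ι c)) p s

-- X² + X + 1 divides X³ - 1.
X^mod-period : ∀ r q → X^mod (+ 1) (+ 1) (r ℕ.+ q * 3) ≡ X^mod (+ 1) (+ 1) r
X^mod-period r zero    = cong (X^mod (+ 1) (+ 1)) (ℕₚ.+-identityʳ r)
X^mod-period r (suc q) = trans (cong (X^mod (+ 1) (+ 1)) (trans (ℕₚ.+-comm r (3 ℕ.+ q * 3)) (cong (3 ℕ.+_) (ℕₚ.+-comm (q * 3) r))))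
  (trans (three (r ℕ.+ q * 3)) (X^mod-period r q))
  where
  three : ∀ k → X^mod (+ 1) (+ 1) (3 ℕ.+ k) ≡ X^mod (+ 1) (+ 1) k
  three k = let u , v = X^mod (+ 1) (+ 1) k in cong₂ _,_ (first u v) (second u v)
    where
    first : ∀ u v → - (+ 1 · (v - + 1 · u)) - + 1 · (- (+ 1 · u) - + 1 · (v - + 1 · u)) ≡ u
    first = solve-∀
    second : ∀ u v → - (+ 1 · (- (+ 1 · u) - + 1 · (v - + 1 · u))) ≡ v
    second = solve-∀

-- By the period 3 only N modulo 3 matters. The remainders 0, 1 and 2 give 1, X and -X - 1, and of
-- these only X is congruent to X modulo 2.
Fixed₂⇔ : ∀ e → Fixed (suc (suc e)) 2 (+ 1) (+ 1) ⇔ 3 ℕ∣.∣ suc e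
Fixed₂⇔ e = mk⇔
  (cases ((suc (suc e)) ℕDivMod.% 3) (suc (suc e) ℕDivMod./ 3) (ℕDivMod.m%n<n (suc (suc e)) 3) (ℕDivMod.m≡m%n+[m/n]*n (suc (suc e)) 3))
  λ { (ℕ∣.divides q eq) → ≡⇒≋₂ (trans (cong (X^mod (+ 1) (+ 1) ∘ suc) eq) (X^mod-period 1 q)) }
  where
  1≢0 : ¬ + 1 ≋ + 0 [ 2 ]
  1≢0 = Unit⇒≢0 Primality.prime[2] Unit-1
  at : ∀ r q → suc (suc e) ≡ r ℕ.+ q * 3 → Fixed (suc (suc e)) 2 (+ 1) (+ 1) → Fixed r 2 (+ 1) (+ 1)
  at r q eq = subst (_≋₂ (+ 1 , + 0) [ 2 ]) (trans (cong (X^mod (+ 1) (+ 1)) eq) (X^mod-period r q))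
  cases : ∀ r q → r < 3 → suc (suc e) ≡ r ℕ.+ q * 3 → Fixed (suc (suc e)) 2 (+ 1) (+ 1) → 3 ℕ∣.∣ suc e
  cases 0 q _ eq f = contradiction (proj₂ (at 0 q eq f)) 1≢0
  cases 1 q _ eq f = ℕ∣.divides q (ℕₚ.suc-injective eq)
  cases 2 q _ eq f = contradiction (≋-trans (by (+ 1) refl) (proj₂ (at 2 q eq f))) 1≢0
  cases (suc (suc (suc _))) _ (s≤s (s≤s (s≤s ()))) _ _

private
  one : Fin 2
  one = Fin.suc Fin.zero

  ≡one : ∀ b c → Unit 2 (ι {2} c · disc (ι {2} b) (ι {2} c)) → (b , c) ≡ (one , one)
  ≡one b                  Fin.zero           u = contradiction (≡⇒≋ refl) (Unit⇒≢0 Primality.prime[2] u)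
  ≡one Fin.zero           (Fin.suc Fin.zero) u = contradiction (by (- + 2) refl) (Unit⇒≢0 Primality.prime[2] u)
  ≡one (Fin.suc Fin.zero) (Fin.suc Fin.zero) _ = refl

  unit₂ : Unit 2 (+ 1 · disc (+ 1) (+ 1))
  unit₂ = unit (+ 1) (by (- + 2) refl)

  Inert₂ : ℕ → Fin 2 × Fin 2 → Set
  Inert₂ e = GoodWithSymbol (suc (suc e)) 2 2 -1ℤ

  -- X² + X + 1 is the only candidate, and the formula evaluates to 1 or 0 according to whether 3
  -- divides N - 1.
  card₂ : ∀ e → Dec (3 ℕ∣.∣ suc e) → HasCard (Inert₂ e) ((ℕGCD.gcd (suc e) 3 ℕ.∸ 1) ℕ./ 2)
  card₂ e (yes 3∣) = subst (λ g → HasCard (Inert₂ e) ((g ℕ.∸ 1) ℕ./ 2))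
    (ℕ∣.∣-antisym (ℕGCD.gcd-greatest 3∣ ℕ∣.∣-refl) (ℕGCD.gcd[m,n]∣n (suc e) 3))
    (card-singleton {P = Inert₂ e} (one , one)
      ((unit₂ , Equivalence.from (Fixed₂⇔ e) 3∣) , two-pm3 refl (inj₂ (≋⇒mod {8} { - + 3} {+ 5} (by (- + 1) refl))))
      (λ {(b , c)} ((u , _) , _) → ≡one b c u))
  card₂ e (no 3∤) = subst (λ g → HasCard (Inert₂ e) ((g ℕ.∸ 1) ℕ./ 2)) (sym gcd≡1) (card-empty (λ {bc} → none bc))
    where
    gcd≡1 : ℕGCD.gcd (suc e) 3 ≡ 1
    gcd≡1 = Sum.[_,_]′ id (λ g≡3 → contradiction (subst (ℕ∣._∣ suc e) g≡3 (ℕGCD.gcd[m,n]∣m (suc e) 3)) 3∤)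
      (Primality.prime⇒irreducible (Dec.toWitness {a? = Primality.prime? 3} _) (ℕGCD.gcd[m,n]∣n (suc e) 3))
    none : ∀ bc → ¬ GoodWithSymbol (suc (suc e)) 2 2 -1ℤ bc
    none (b , c) ((u , f) , _) = 3∤ (Equivalence.to (Fixed₂⇔ e)
      (subst (λ (b , c) → Fixed (suc (suc e)) 2 (ι b) (ι c)) (≡one b c u) f))

card-symbol+ : ∀ {p} → Prime p → ∀ e → HasCard {Fin p × Fin p} (GoodWithSymbol (suc (suc e)) p p (+ 1)) (Aᵢ (suc (suc e)) p)
card-symbol+ {p} p-prime e = by-parity (p ℕ.≟ 2)
  where
  open Symbols p-prime
  by-parity : Dec (p ≡ 2) → HasCard {Fin p × Fin p} (GoodWithSymbol (suc (suc e)) p p (+ 1)) (Aᵢ (suc (suc e)) p)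
  by-parity (yes p≡2) = subst (HasCard _) (sym A≡0) (card-empty (λ {(b , c)} ((u , _) , h) → 2-symbol-≢1 (ι b) (ι c) p≡2 u h))
    where
    -- At p = 2 one has g = gcd(N - 1, 1) = 1, matching the absence of discriminants with symbol +1.
    A≡0 : Aᵢ (suc (suc e)) p ≡ 0
    A≡0 = cong (λ g → (g * g ℕ.∸ g) ℕ./ 2) (trans (cong (λ q → ℕGCD.gcd (suc e) (q ℕ.∸ 1)) p≡2) (ℕGCD.gcd-zeroʳ (suc e)))
  by-parity (no p≢2) = card-resp-⇔
    (λ {(b , c)} (good , sq) → good , square⇒symbol p≢2 (Unit-·ʳ (ι c) _ (proj₁ good)) sq)
    (λ {(b , c)} (good , h) → good , symbol⇒square p≢2 (Unit-·ʳ (ι c) _ (proj₁ good)) h)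
    (SplitQuadratics.card-split-quadratics p-prime p≢2 e)

card-symbol- : ∀ {p} → Prime p → ∀ e → HasCard {Fin p × Fin p} (GoodWithSymbol (suc (suc e)) p p -1ℤ) (Bᵢ (suc (suc e)) p)
card-symbol- {p} p-prime e = by-parity (p ℕ.≟ 2)
  where
  open Symbols p-prime
  by-parity : Dec (p ≡ 2) → HasCard {Fin p × Fin p} (GoodWithSymbol (suc (suc e)) p p -1ℤ) (Bᵢ (suc (suc e)) p)
  by-parity (yes refl) = subst (λ g → HasCard (Inert₂ e) ((ℕGCD.gcd (suc e) 3 ℕ.∸ g) ℕ./ 2)) (sym (ℕGCD.gcd-zeroʳ (suc e))) (card₂ e (3 ℕ∣.∣? suc e))
  by-parity (no p≢2) = card-resp-⇔
    (λ {(b , c)} (good , ns) → good , non-square⇒symbol p≢2 (Unit-·ʳ (ι c) _ (proj₁ good)) ns)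
    (λ {(b , c)} (good , h) → good , symbol⇒non-square p≢2 (Unit-·ʳ (ι c) _ (proj₁ good)) h)
    (card-inert-quadratics p-prime p≢2 e)

-- Kronecker symbols and the count modulo n

abstract
  -- Opposite in direction to `card-map`: the known count is that of the target, as for reduction
  -- maps. A list for `Q` is assembled from the preimages that surjectivity provides.
  card-pullback : ∀ {A B : Set} {P : A → Set} {Q : B → Set} {k} (f : B → A) →
    (∀ {b} → Q b → P (f b)) → (∀ {b b′} → Q b → Q b′ → f b ≡ f b′ → b ≡ b′) →
    (∀ {a} → P a → ∃[ b ] (Q b × f b ≡ a)) → HasCard P k → HasCard Q k
  card-pullback {A} {B} {P} {Q} f resp inj surj (xs , u , mem , len) =
    let ys , qs , eq = preimages xs (All.tabulate (λ a∈ → Equivalence.to (mem _) a∈)) in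
    ys , unique-preimages ys (subst Unique (sym eq) u) ,
    (λ b → mk⇔ (All.lookup qs) (λ qb → member ys qs qb (subst (f b ∈_) (sym eq) (Equivalence.from (mem (f b)) (resp qb))))) ,
    trans (sym (Listₚ.length-map f ys)) (trans (cong length eq) len)
    where
    preimages : ∀ xs → All P xs → ∃[ ys ] (All Q ys × map f ys ≡ xs)
    preimages []       []       = [] , [] , refl
    preimages (x ∷ xs) (p ∷ ps) = let b , q , e = surj p
                                      ys , qs , eq = preimages xs ps
                                  in b ∷ ys , q ∷ qs , cong₂ _∷_ e eq
    unique-preimages : ∀ ys → Unique (map f ys) → Unique ys
    unique-preimages []       _        = []
    unique-preimages (y ∷ ys) (y∉ ∷ u) = All.tabulate (λ z∈ eq → All.lookup y∉ (∈ₚ.∈-map⁺ f z∈) (cong f eq)) ∷ unique-preimages ys u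
    member : ∀ ys → All Q ys → ∀ {b} → Q b → f b ∈ map f ys → b ∈ ys
    member ys qs {b} qb fb∈ = let y , y∈ , e = ∈ₚ.∈-map⁻ f fb∈ in subst (_∈ ys) (sym (inj qb (All.lookup qs y∈) e)) y∈

residue₂ : ∀ m .{{_ : ℕ.NonZero m}} → ℤ × ℤ → Fin m × Fin m
residue₂ m (b , c) = residue m b , residue m c

ι₂ : ∀ {m} → Fin m × Fin m → ℤ × ℤ
ι₂ (b , c) = ι b , ι c

residue₂-≋ : ∀ {m} .{{_ : ℕ.NonZero m}} x y → residue₂ m x ≡ residue₂ m y → x ≋₂ y [ m ]
residue₂-≋ {m} (b , c) (b′ , c′) eq =
  ≋-trans (≋-sym (ι-residue m b)) (≋-trans (≡⇒≋ (cong (ι ∘ proj₁) eq)) (ι-residue m b′)) ,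
  ≋-trans (≋-sym (ι-residue m c)) (≋-trans (≡⇒≋ (cong (ι ∘ proj₂) eq)) (ι-residue m c′))

ι₂-residue₂ : ∀ m .{{_ : ℕ.NonZero m}} x → ι₂ (residue₂ m x) ≋₂ x [ m ]
ι₂-residue₂ m (b , c) = ι-residue m b , ι-residue m c

ι₂-injective : ∀ {m} {x y : Fin m × Fin m} → ι₂ x ≋₂ ι₂ y [ m ] → x ≡ y
ι₂-injective (eb , ec) = cong₂ _,_ (ι-injective eb) (ι-injective ec)

Good-mod-∣ : ∀ N {m m′} b c → m ℕ∣.∣ m′ → Good N m′ b c → Good N m b c
Good-mod-∣ N b c d (u , f) = Unit-mod-∣ d u , ≋₂-mod-∣ {x = X^mod b c N} {+ 1 , + 0} d f

module _ {p N : ℕ} (p-prime : Prime p) (p∣N : p ℕ∣.∣ N) (r : ℕ) where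
  open ModPrime p-prime using (p-nonZero)
  open Symbols p-prime
  private
    m = p ℕ.^ suc r
    p∣m : p ℕ∣.∣ m
    p∣m = ℕ∣.m∣m*n (p ℕ.^ r)
    instance
      m-nonZero : ℕ.NonZero m
      m-nonZero = ℕₚ.m^n≢0 p (suc r)

    reduce : Fin m × Fin m → Fin p × Fin p
    reduce x = residue₂ p (ι₂ x)

    reduce-≋ : ∀ x → ι₂ (reduce x) ≋₂ ι₂ x [ p ]
    reduce-≋ x = ι₂-residue₂ p (ι₂ x)

  card-lift : ∀ {s k} → HasCard {Fin p × Fin p} (GoodWithSymbol N p p s) k → HasCard {Fin m × Fin m} (GoodWithSymbol N m p s) k
  card-lift {s} = card-pullback reduce
    (λ {x} → resp x) (λ {x} {y} → inj x y) (λ {x} → surj x)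
    where
    resp : ∀ x → GoodWithSymbol N m p s x → GoodWithSymbol N p p s (reduce x)
    resp x@(b , c) (good , sym-s) =
      let eb , ec = ≋₂-sym (reduce-≋ x)
          good′ = Good-mod-∣ N (ι b) (ι c) p∣m good
      in Good-resp-≋ N (ι b) _ (ι c) _ eb ec good′ , symbol-resp-≋ (ι b) _ (ι c) _ (proj₁ good′) eb ec sym-s
    inj : ∀ x y → GoodWithSymbol N m p s x → GoodWithSymbol N m p s y → reduce x ≡ reduce y → x ≡ y
    inj x y ((_ , fx) , _) ((_ , fy) , _) eq =
      let eb , ec = residue₂-≋ (ι₂ x) (ι₂ y) eq in
      ι₂-injective (Fixed-lift-unique p∣N r fy fx eb ec)
    surj : ∀ y → GoodWithSymbol N p p s y → ∃[ x ] (GoodWithSymbol N m p s x × reduce x ≡ y)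
    surj y@(b , c) ((u , f) , sym-s) =
      let b′ , c′ , f′ , eb , ec = Fixed-lift-exists p∣N r {ι b} {ι c} f
          x = residue₂ m (b′ , c′)
          xb , xc = ι₂-residue₂ m (b′ , c′)
          yb = ≋-trans (≋-mod-∣ p∣m xb) eb
          yc = ≋-trans (≋-mod-∣ p∣m xc) ec
          -- Being a unit modulo p suffices for being a unit modulo any power of p, so this half of
          -- `Good` lifts by itself.
          u′ = Unit-resp-≋ (≋-sym (·-cong-≋ yc (disc-cong {c = ι (proj₂ x)} yb yc))) u
      in x , (((Unit-mod-^ (suc r) u′ , Fixed-resp-≋ {N} {b = b′} {c = c′} (≋-sym xb) (≋-sym xc) f′) ,
                symbol-resp-≋ (ι b) _ (ι c) _ u (≋-sym yb) (≋-sym yc) sym-s) ,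
              ι₂-injective (≋₂-trans (reduce-≋ x) (yb , yc)))

-- A derivation lists the prime factors in some order; Euclid's lemma locates p in it, and p is
-- moved to the front. The equation `n ≡ p * m` keeps the index of `KronRel` a variable, so that the
-- derivation can be matched.
PrimeSym-factor : ∀ {a n s} → KronRel a n s → ∀ {p} → Prime p → ∀ m → n ≡ p * m →
  ∃[ t ] ∃[ u ] (PrimeSym a p t × KronRel a m u × s ≡ t · u)
PrimeSym-factor kr-one {p} p-prime m eq =
  contradiction (subst Prime (ℕₚ.m*n≡1⇒m≡1 p m (sym eq)) p-prime) Primality.¬prime[1]
PrimeSym-factor {a} (kr-step {q} {m′} {s} {t} q-prime q-sym rest) {p} p-prime m eq =
  cases (Primality.euclidsLemma q m′ p-prime (ℕ∣.divides m (trans eq (ℕₚ.*-comm p m))))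
  where
  Result = ∃[ v ] ∃[ u ] (PrimeSym a p v × KronRel a m u × s · t ≡ v · u)
  same : q ≡ p → Result
  same refl = s , t , q-sym , subst (λ k → KronRel a k t)
    (ℕₚ.*-cancelˡ-≡ m′ m p {{Primality.prime⇒nonZero p-prime}} eq) rest , refl
  divides-q : p ≡ 1 ⊎ p ≡ q → Result
  divides-q (inj₁ p≡1) = contradiction (subst Prime p≡1 p-prime) Primality.¬prime[1]
  divides-q (inj₂ p≡q) = same (sym p≡q)
  lemma : ∀ s v u → s · (v · u) ≡ v · (s · u)
  lemma = solve-∀
  cases : p ℕ∣.∣ q ⊎ p ℕ∣.∣ m′ → Result
  cases (inj₁ p∣q) = divides-q (Primality.prime⇒irreducible q-prime p∣q)
  cases (inj₂ (ℕ∣.divides m″ m′≡)) =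
    let v , u , p-sym , rest′ , t≡ = PrimeSym-factor rest p-prime m″ (trans m′≡ (ℕₚ.*-comm m″ p))
    in v , s · u , p-sym , subst (λ k → KronRel a k (s · u)) (m≡ m″ m′≡) (kr-step q-prime q-sym rest′) ,
       trans (cong (s ·_) t≡) (lemma s v u)
    where
    m≡ : ∀ m″ → m′ ≡ m″ * p → q * m″ ≡ m
    m≡ m″ m′≡ = ℕₚ.*-cancelˡ-≡ (q * m″) m p {{Primality.prime⇒nonZero p-prime}}
      (trans (ℕₚ.*-comm p (q * m″)) (trans (ℕₚ.*-assoc q m″ p) (trans (cong (q *_) (sym m′≡)) eq)))

module _ (b b′ c c′ : ℤ) where
  KronRel-resp-≋ : ∀ {m s} → Unit m (c · disc b c) → b ≋ b′ [ m ] → c ≋ c′ [ m ] →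
    KronRel (disc b c) m s → KronRel (disc b′ c′) m s
  KronRel-resp-≋ u eb ec kr-one = kr-one
  KronRel-resp-≋ u eb ec (kr-step {p} {m} p-prime h k) = kr-step p-prime
    (Symbols.symbol-resp-≋ p-prime b b′ c c′ (Unit-mod-∣ p∣ u) (≋-mod-∣ p∣ eb) (≋-mod-∣ p∣ ec) h)
    (KronRel-resp-≋ (Unit-mod-∣ m∣ u) (≋-mod-∣ m∣ eb) (≋-mod-∣ m∣ ec) k)
    where
    p∣ = ℕ∣.m∣m*n {p} m
    m∣ = ℕ∣.n∣m*n p {m}

module _ (b c : ℤ) where
  -- The two derivations may order the primes differently, so the first prime of one is extracted
  -- from the other before the symbols at it are compared.
  KronRel-unique : ∀ {m s s′} → Unit m (c · disc b c) → KronRel (disc b c) m s → KronRel (disc b c) m s′ → s ≡ s′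
  KronRel-unique u kr-one k′ = go k′ refl
    where
    go : ∀ {m s′} → KronRel (disc b c) m s′ → m ≡ 1 → + 1 ≡ s′
    go kr-one _ = refl
    go (kr-step {p} {m} p-prime _ _) eq = contradiction (subst Prime (ℕₚ.m*n≡1⇒m≡1 p m eq) p-prime) Primality.¬prime[1]
  KronRel-unique u (kr-step {p} {m} p-prime h k) k′ =
    let t , v , h′ , k″ , eq = PrimeSym-factor k′ p-prime m refl in
    trans (cong₂ _·_
      (Symbols.symbol-unique p-prime b b c c (Unit-mod-∣ (ℕ∣.m∣m*n {p} m) u) ≋-refl ≋-refl h h′)
      (KronRel-unique (Unit-mod-∣ (ℕ∣.n∣m*n p {m}) u) k k″)) (sym eq)

  KronRel-±1 : ∀ {m s} → Unit m (c · disc b c) → KronRel (disc b c) m s → s ≡ + 1 ⊎ s ≡ -1ℤ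
  KronRel-±1 u kr-one = inj₁ refl
  KronRel-±1 u (kr-step {p} {m} p-prime h k) = combine
    (Symbols.symbol-±1 p-prime b c (Unit-mod-∣ (ℕ∣.m∣m*n {p} m) u) h)
    (KronRel-±1 (Unit-mod-∣ (ℕ∣.n∣m*n p {m}) u) k)
    where
    combine : ∀ {s t} → s ≡ + 1 ⊎ s ≡ -1ℤ → t ≡ + 1 ⊎ t ≡ -1ℤ → s · t ≡ + 1 ⊎ s · t ≡ -1ℤ
    combine (inj₁ refl) (inj₁ refl) = inj₁ refl
    combine (inj₁ refl) (inj₂ refl) = inj₂ refl
    combine (inj₂ refl) (inj₁ refl) = inj₂ refl
    combine (inj₂ refl) (inj₂ refl) = inj₁ refl

KronRel-* : ∀ {a m m′ s t} → KronRel a m s → KronRel a m′ t → KronRel a (m * m′) (s · t)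
KronRel-* {a} {m′ = m′} {t = t} kr-one k′ = subst₂ (KronRel a) (sym (ℕₚ.*-identityˡ m′)) (sym (ℤₚ.*-identityˡ t)) k′
KronRel-* {a} {m′ = m′} {t = t} (kr-step {p} {m} {u} {v} p-prime h k) k′ =
  subst₂ (KronRel a) (sym (ℕₚ.*-assoc p m m′)) (sym (ℤₚ.*-assoc u v t)) (kr-step p-prime h (KronRel-* k k′))

KronRel-split : ∀ {a p} → Prime p → ∀ r m {s} → KronRel a (p ℕ.^ r * m) s →
  ∃[ t ] ∃[ u ] (KronRel a (p ℕ.^ r) t × KronRel a m u × s ≡ t · u)
KronRel-split {a} p-prime zero m {s} k = + 1 , s , kr-one , subst (λ j → KronRel a j s) (ℕₚ.*-identityˡ m) k , sym (ℤₚ.*-identityˡ s)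
KronRel-split {a} {p} p-prime (suc r) m k =
  let t , s′ , h , k′ , eq = PrimeSym-factor k p-prime (p ℕ.^ r * m) (ℕₚ.*-assoc p (p ℕ.^ r) m)
      t′ , u , h′ , k″ , eq′ = KronRel-split p-prime r m k′
  in t · t′ , u , kr-step p-prime h h′ , k″ , trans eq (trans (cong (t ·_) eq′) (sym (ℤₚ.*-assoc t t′ u)))

KronRel-^ : ∀ {a p s} → Prime p → PrimeSym a p s → ∀ r → KronRel a (p ℕ.^ r) (s ^ᶻ r)
KronRel-^ p-prime h zero    = kr-one
KronRel-^ p-prime h (suc r) = kr-step p-prime h (KronRel-^ p-prime h r)

-- Counting by the sign of the symbol

GoodKron : ℕ → ℕ → ℤ → ∀ {m} → Fin m × Fin m → Set
GoodKron N m s (b , c) = Good N m (ι b) (ι c) × KronRel (disc (ι b) (ι c)) m s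

1≢-1 : + 1 ≢ -1ℤ
1≢-1 ()

1^ᶻ : ∀ r → (+ 1) ^ᶻ r ≡ + 1
1^ᶻ zero    = refl
1^ᶻ (suc r) = trans (ℤₚ.*-identityˡ _) (1^ᶻ r)

-1^ᶻ : ∀ r → (r ℕDivMod.% 2 ≡ 0 × -1ℤ ^ᶻ r ≡ + 1) ⊎ (r ℕDivMod.% 2 ≡ 1 × -1ℤ ^ᶻ r ≡ -1ℤ)
-1^ᶻ zero          = inj₁ (refl , refl)
-1^ᶻ (suc zero)    = inj₂ (refl , refl)
-1^ᶻ (suc (suc r)) = Sum.map (λ (h , e) → h , trans (lemma _) e) (λ (h , e) → h , trans (lemma _) e) (-1^ᶻ r)
  where
  lemma : ∀ x → -1ℤ · (-1ℤ · x) ≡ x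
  lemma = solve-∀

parityFactor-even : ∀ n p r → r ℕDivMod.% 2 ≡ 0 → parityFactor n p r ≡ + Aᵢ n p + + Bᵢ n p
parityFactor-even n p r h rewrite h = refl

parityFactor-odd : ∀ n p r → r ℕDivMod.% 2 ≡ 1 → parityFactor n p r ≡ + Aᵢ n p - + Bᵢ n p
parityFactor-odd n p r h rewrite h = refl

SignedCount : ∀ {A : Set} → (ℤ → A → Set) → ℤ → ℤ → Set
SignedCount G total signed = ∃[ P ] ∃[ Q ] (HasCard (G (+ 1)) P × HasCard (G -1ℤ) Q × + P + + Q ≡ total × + P - + Q ≡ signed)

module _ {p : ℕ} (p-prime : Prime p) (e : ℕ) (p∣N : p ℕ∣.∣ suc (suc e)) (r : ℕ) where
  open Symbols p-prime
  private
    N = suc (suc e)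
    m = p ℕ.^ suc r
    A = Aᵢ N p
    B = Bᵢ N p

    p-unit : ∀ {x : Fin m × Fin m} → Good N m (ι (proj₁ x)) (ι (proj₂ x)) → Unit p (ι (proj₂ x) · disc (ι (proj₁ x)) (ι (proj₂ x)))
    p-unit (u , _) = Unit-mod-∣ (ℕ∣.m∣m*n (p ℕ.^ r)) u

    card+ : HasCard {Fin m × Fin m} (GoodWithSymbol N m p (+ 1)) A
    card+ = card-lift p-prime p∣N r (card-symbol+ p-prime e)

    card- : HasCard {Fin m × Fin m} (GoodWithSymbol N m p -1ℤ) B
    card- = card-lift p-prime p∣N r (card-symbol- p-prime e)

    symbol : ∀ x → Good N m (ι (proj₁ x)) (ι (proj₂ x)) → GoodWithSymbol N m p (+ 1) {m} x ⊎ GoodWithSymbol N m p -1ℤ {m} x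
    symbol x@(b , c) good = Sum.map (good ,_) (good ,_) (symbol-exists (ι b) (ι c) (p-unit {x} good))

    raise : ∀ s {t} → s ^ᶻ suc r ≡ t → ∀ x → GoodWithSymbol N m p s {m} x → GoodKron N m t {m} x
    raise s refl x (good , h) = good , KronRel-^ p-prime h (suc r)

    clash : ∀ s {t} → s ^ᶻ suc r ≡ t → ∀ x {t′} → t ≢ t′ → GoodKron N m t′ {m} x → ¬ GoodWithSymbol N m p s {m} x
    clash s e x@(b , c) t≢t′ ((u , _) , k) h = t≢t′ (KronRel-unique (ι b) (ι c) u (proj₂ (raise s e x h)) k)

    disjoint : ∀ x → GoodWithSymbol N m p (+ 1) {m} x → GoodWithSymbol N m p -1ℤ {m} x → ⊥
    disjoint x@(b , c) (good , h) (_ , h′) =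
      1≢-1 (symbol-unique (ι b) (ι b) (ι c) (ι c) (p-unit {x} good) ≋-refl ≋-refl h h′)

    even-case : suc r ℕDivMod.% 2 ≡ 0 → -1ℤ ^ᶻ suc r ≡ + 1 → SignedCount (λ s → GoodKron N m s {m}) (+ (A ℕ.+ B)) (parityFactor N p (suc r))
    even-case h e = A ℕ.+ B , 0 ,
      card-resp-⇔ (λ {x} → Sum.[_,_]′ (raise (+ 1) (1^ᶻ (suc r)) x) (raise -1ℤ e x)) (λ {x} (good , _) → symbol x good)
        (card-⊎ (λ {x} → disjoint x) card+ card-) ,
      card-empty (λ {x} k → Sum.[_,_]′ (clash (+ 1) (1^ᶻ (suc r)) x 1≢-1 k) (clash -1ℤ e x 1≢-1 k) (symbol x (proj₁ k))) ,
      ℤₚ.+-identityʳ _ ,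
      trans (ℤₚ.+-identityʳ _) (sym (parityFactor-even N p (suc r) h))

    odd-case : suc r ℕDivMod.% 2 ≡ 1 → -1ℤ ^ᶻ suc r ≡ -1ℤ → SignedCount (λ s → GoodKron N m s {m}) (+ (A ℕ.+ B)) (parityFactor N p (suc r))
    odd-case h e = A , B ,
      card-resp-⇔ (λ {x} → raise (+ 1) (1^ᶻ (suc r)) x)
        (λ {x} k → Sum.[_,_]′ id (λ h → contradiction h (clash -1ℤ e x (1≢-1 ∘ sym) k)) (symbol x (proj₁ k))) card+ ,
      card-resp-⇔ (λ {x} → raise -1ℤ e x)
        (λ {x} k → Sum.[_,_]′ (λ h → contradiction h (clash (+ 1) (1^ᶻ (suc r)) x 1≢-1 k)) id (symbol x (proj₁ k))) card- ,
      refl ,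
      sym (parityFactor-odd N p (suc r) h)

  -- The symbol modulo p^(r+1) is a power of the one modulo p. An even exponent sends both signs to
  -- +1, giving the counts A + B and 0; an odd one keeps them apart as A and B.
  prime-power-count : SignedCount (λ s → GoodKron N m s {m}) (+ (A ℕ.+ B)) (parityFactor N p (suc r))
  prime-power-count = Sum.[_,_]′ (λ (h , e) → even-case h e) (λ (h , e) → odd-case h e) (-1^ᶻ (suc r))

module _ (N : ℕ) {p : ℕ} (p-prime : Prime p) (r m₂ : ℕ) (coprime : Unit m₂ (+ (p ℕ.^ r)))
  {{m₁-nonZero : ℕ.NonZero (p ℕ.^ r)}} {{m₂-nonZero : ℕ.NonZero m₂}} where
  private
    m₁ = p ℕ.^ r
    m = m₁ * m₂
    instance
      m-nonZero : ℕ.NonZero m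
      m-nonZero = ℕₚ.m*n≢0 m₁ m₂
    m₁∣m : m₁ ℕ∣.∣ m
    m₁∣m = ℕ∣.m∣m*n m₂
    m₂∣m : m₂ ℕ∣.∣ m
    m₂∣m = ℕ∣.n∣m*n m₁

    Pairs = (Fin m₁ × Fin m₁) × (Fin m₂ × Fin m₂)

    split : Fin m × Fin m → Pairs
    split x = residue₂ m₁ (ι₂ x) , residue₂ m₂ (ι₂ x)

    Component : ℤ → ℤ → Pairs → Set
    Component s t (x , y) = GoodKron N m₁ s {m₁} x × GoodKron N m₂ t {m₂} y

    -- The symbol modulo m₁ m₂ is the product of the two symbols, and s factors into signs only as 1
    -- · s or (-1) · (-s).
    Components : ℤ → Pairs → Set
    Components s xy = Component (+ 1) s xy ⊎ Component -1ℤ (- s) xy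

    card-components : ∀ s {P₁ Q₁ P₂ Q₂} → HasCard (GoodKron N m₁ (+ 1) {m₁}) P₁ → HasCard (GoodKron N m₁ -1ℤ {m₁}) Q₁ →
      HasCard (GoodKron N m₂ s {m₂}) P₂ → HasCard (GoodKron N m₂ (- s) {m₂}) Q₂ → HasCard (Components s) (P₁ * P₂ ℕ.+ Q₁ * Q₂)
    card-components s p₁ q₁ p₂ q₂ = card-⊎ {P = Component (+ 1) s} {Q = Component -1ℤ (- s)}
      (λ { {((b , c) , _)} (((u , _) , k) , _) ((_ , k′) , _) → 1≢-1 (KronRel-unique (ι b) (ι c) u k k′) })
      (card-× p₁ p₂) (card-× q₁ q₂)

    transfer : ∀ {j k} (x : Fin j × Fin j) (y : Fin k × Fin k) m′ {s} → ι₂ x ≋₂ ι₂ y [ m′ ] →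
      Good N m′ (ι (proj₁ x)) (ι (proj₂ x)) → KronRel (disc (ι (proj₁ x)) (ι (proj₂ x))) m′ s →
      Good N m′ (ι (proj₁ y)) (ι (proj₂ y)) × KronRel (disc (ι (proj₁ y)) (ι (proj₂ y))) m′ s
    transfer (b , c) (b′ , c′) m′ (eb , ec) good k =
      Good-resp-≋ N (ι b) (ι b′) (ι c) (ι c′) eb ec good , KronRel-resp-≋ (ι b) (ι b′) (ι c) (ι c′) (proj₁ good) eb ec k

    split-components : ∀ s x → GoodKron N m s x → Components s (split x)
    split-components s x@(b , c) (good , k) =
      let t , u , k₁ , k₂ , eq = KronRel-split p-prime r m₂ k in
      assemble t u k₁ k₂ eq (KronRel-±1 (ι b) (ι c) (proj₁ good-mod₁) k₁)
      where
      good-mod₁ = Good-mod-∣ N (ι b) (ι c) m₁∣m good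
      good-mod₂ = Good-mod-∣ N (ι b) (ι c) m₂∣m good
      lemma : ∀ u → u ≡ - (-1ℤ · u)
      lemma = solve-∀
      assemble : ∀ t u → KronRel (disc (ι b) (ι c)) m₁ t → KronRel (disc (ι b) (ι c)) m₂ u → s ≡ t · u →
        t ≡ + 1 ⊎ t ≡ -1ℤ → Components s (split x)
      assemble t u k₁ k₂ eq (inj₁ refl) = inj₁
        ( transfer x _ m₁ (≋₂-sym (ι₂-residue₂ m₁ (ι₂ x))) good-mod₁ k₁
        , transfer x _ m₂ (≋₂-sym (ι₂-residue₂ m₂ (ι₂ x))) good-mod₂ (subst (KronRel _ m₂) (sym (trans eq (ℤₚ.*-identityˡ u))) k₂))
      assemble t u k₁ k₂ eq (inj₂ refl) = inj₂
        ( transfer x _ m₁ (≋₂-sym (ι₂-residue₂ m₁ (ι₂ x))) good-mod₁ k₁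
        , transfer x _ m₂ (≋₂-sym (ι₂-residue₂ m₂ (ι₂ x))) good-mod₂ (subst (KronRel _ m₂) (trans (lemma u) (cong -_ (sym eq))) k₂))

    ≋₂-mod-* : ∀ x y → x ≋₂ y [ m₁ ] → x ≋₂ y [ m₂ ] → x ≋₂ y [ m ]
    ≋₂-mod-* _ _ (eb , ec) (eb′ , ec′) = ≋-mod-* coprime eb eb′ , ≋-mod-* coprime ec ec′

    split-injective : ∀ x y → split x ≡ split y → x ≡ y
    split-injective x y eq = ι₂-injective (≋₂-mod-* (ι₂ x) (ι₂ y)
      (residue₂-≋ (ι₂ x) (ι₂ y) (cong proj₁ eq)) (residue₂-≋ (ι₂ x) (ι₂ y) (cong proj₂ eq)))

    join : ∀ s xy → Components s xy → ∃[ z ] (GoodKron N m s z × split z ≡ xy)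
    join s (x@(b , c) , y@(b′ , c′)) h = z , combines h ,
      cong₂ _,_ (ι₂-injective (≋₂-trans (ι₂-residue₂ m₁ (ι₂ z)) z≋x)) (ι₂-injective (≋₂-trans (ι₂-residue₂ m₂ (ι₂ z)) z≋y))
      where
      w = crt coprime (ι b) (ι b′) , crt coprime (ι c) (ι c′)
      z = residue₂ m w
      z≋x : ι₂ z ≋₂ ι₂ x [ m₁ ]
      z≋x = ≋₂-trans (≋₂-mod-∣ {x = ι₂ z} {w} m₁∣m (ι₂-residue₂ m w)) (crt-≋ˡ coprime (ι b) (ι b′) , crt-≋ˡ coprime (ι c) (ι c′))
      z≋y : ι₂ z ≋₂ ι₂ y [ m₂ ]
      z≋y = ≋₂-trans (≋₂-mod-∣ {x = ι₂ z} {w} m₂∣m (ι₂-residue₂ m w)) (crt-≋ʳ coprime (ι b) (ι b′) , crt-≋ʳ coprime (ι c) (ι c′))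
      lemma : ∀ s → -1ℤ · - s ≡ s
      lemma = solve-∀
      combine : ∀ t u → t · u ≡ s → GoodKron N m₁ t x × GoodKron N m₂ u y → GoodKron N m s z
      combine t u refl ((good₁ , k₁) , (good₂ , k₂)) =
        let (u₁ , f₁) , k₁′ = transfer x z m₁ (≋₂-sym z≋x) good₁ k₁
            (u₂ , f₂) , k₂′ = transfer y z m₂ (≋₂-sym z≋y) good₂ k₂
        in (Unit-mod-* u₁ u₂ , ≋₂-mod-* (X^mod (ι (proj₁ z)) (ι (proj₂ z)) N) (+ 1 , + 0) f₁ f₂) , KronRel-* k₁′ k₂′
      combines : Components s (x , y) → GoodKron N m s z
      combines (inj₁ h) = combine (+ 1) s (ℤₚ.*-identityˡ s) h
      combines (inj₂ h) = combine -1ℤ (- s) (lemma s) h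

    card-join : ∀ s {k} → HasCard (Components s) k → HasCard (GoodKron N m s {m}) k
    card-join s = card-pullback split (λ {x} → split-components s x) (λ {x} {y} _ _ → split-injective x y) (λ {xy} → join s xy)

  product-count : ∀ {t₁ s₁ t₂ s₂} → SignedCount (λ s → GoodKron N m₁ s {m₁}) t₁ s₁ →
    SignedCount (λ s → GoodKron N m₂ s {m₂}) t₂ s₂ → SignedCount (λ s → GoodKron N m s {m}) (t₁ · t₂) (s₁ · s₂)
  product-count (P₁ , Q₁ , p₁ , q₁ , refl , refl) (P₂ , Q₂ , p₂ , q₂ , refl , refl) =
    P₁ * P₂ ℕ.+ Q₁ * Q₂ , P₁ * Q₂ ℕ.+ Q₁ * P₂ ,
    card-join (+ 1) (card-components (+ 1) p₁ q₁ p₂ q₂) ,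
    -- For symbol -1 the second factor must have the opposite sign to the first, hence the exchange
    -- of `p₂` and `q₂`.
    card-join -1ℤ (card-components -1ℤ p₁ q₁ q₂ p₂) ,
    trans (cong₂ _+_ (cong₂ _+_ (ℤₚ.pos-* P₁ P₂) (ℤₚ.pos-* Q₁ Q₂)) (cong₂ _+_ (ℤₚ.pos-* P₁ Q₂) (ℤₚ.pos-* Q₁ P₂)))
      (total (+ P₁) (+ Q₁) (+ P₂) (+ Q₂)) ,
    trans (cong₂ _-_ (cong₂ _+_ (ℤₚ.pos-* P₁ P₂) (ℤₚ.pos-* Q₁ Q₂)) (cong₂ _+_ (ℤₚ.pos-* P₁ Q₂) (ℤₚ.pos-* Q₁ P₂)))
      (signed (+ P₁) (+ Q₁) (+ P₂) (+ Q₂))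
    where
    total : ∀ a b c d → (a · c + b · d) + (a · d + b · c) ≡ (a + b) · (c + d)
    total = solve-∀
    signed : ∀ a b c d → (a · c + b · d) - (a · d + b · c) ≡ (a - b) · (c - d)
    signed = solve-∀

IsFactorisation-tail : ∀ {n p r fs} → IsFactorisation n ((p , r) ∷ fs) →
  ∃[ m ] (IsFactorisation m fs × Prime p × 1 ≤ r × All (p ≢_) (map proj₁ fs) × n ≡ p ℕ.^ r * m)
IsFactorisation-tail (((p-prime , 1≤r) ∷ ps) , (p∉ ∷ u) , eq) = _ , (ps , u , refl) , p-prime , 1≤r , p∉ , eq

IsFactorisation⇒nonZero : ∀ {n} fs → IsFactorisation n fs → ℕ.NonZero n
IsFactorisation⇒nonZero []             (_ , _ , refl) = _
IsFactorisation⇒nonZero ((p , r) ∷ fs) h = let m , h′ , p-prime , _ , _ , eq = IsFactorisation-tail h in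
  subst ℕ.NonZero (sym eq) (ℕₚ.m*n≢0 (p ℕ.^ r) m {{ℕₚ.m^n≢0 p r {{Primality.prime⇒nonZero p-prime}}}} {{IsFactorisation⇒nonZero fs h′}})

Unit-^ : ∀ {m p} → Unit m (+ p) → ∀ r → Unit m (+ (p ℕ.^ r))
Unit-^ u zero            = Unit-1
Unit-^ {m} {p} u (suc r) = subst (Unit m) (sym (ℤₚ.pos-* p (p ℕ.^ r))) (Unit-· u (Unit-^ u r))

distinct-primes-unit : ∀ {p q} → Prime p → Prime q → p ≢ q → Unit q (+ p)
distinct-primes-unit {p} {q} p-prime q-prime p≢q = prime-∤⇒Unit q-prime (+ p) λ h →
  Sum.[_,_]′ (λ q≡1 → Primality.¬prime[1] (subst Prime q≡1 q-prime)) (λ q≡p → p≢q (sym q≡p))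
    (Primality.prime⇒irreducible p-prime (≋0⇒∣ {q} {+ p} h))

coprime-factor : ∀ {p m} → Prime p → ∀ fs → IsFactorisation m fs → All (p ≢_) (map proj₁ fs) → Unit m (+ p)
coprime-factor p-prime []             (_ , _ , refl) _         = unit (+ 0) ≋₁
coprime-factor {p} p-prime ((q , r) ∷ fs) h (p≢q ∷ p∉) =
  let m , h′ , q-prime , _ , _ , eq = IsFactorisation-tail h in
  subst (λ n → Unit n (+ p)) (sym eq)
    (Unit-mod-* (Unit-mod-^ r (distinct-primes-unit p-prime q-prime p≢q)) (coprime-factor p-prime fs h′ p∉))

-- The exponent is fixed while the induction shrinks `m`. Divisibility of the exponent by `m` is the
-- invariant that supplies p ∣ N for the lifting at each prime.
factorisation-count : ∀ e {m} fs → IsFactorisation m fs → m ℕ∣.∣ suc (suc e) →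
  SignedCount (λ s → GoodKron (suc (suc e)) m s {m}) (prodAB (suc (suc e)) fs) (prodParity (suc (suc e)) fs)
-- Modulo 1 there is a single pair of coefficients and the empty symbol is +1, so both products
-- start at 1.
factorisation-count e [] (_ , _ , refl) _ = 1 , 0 ,
  card-singleton (Fin.zero , Fin.zero) ((unit (+ 0) ≋₁ , ≋₁ , ≋₁) , kr-one) (λ { {Fin.zero , Fin.zero} _ → refl }) ,
  card-empty (λ {(b , c)} ((u , _) , k) → 1≢-1 (KronRel-unique (ι b) (ι c) u kr-one k)) , refl , refl
factorisation-count e {n} ((p , r) ∷ fs) h n∣N = step r (IsFactorisation-tail h)
  where
  step : ∀ r → ∃[ m ] (IsFactorisation m fs × Prime p × 1 ≤ r × All (p ≢_) (map proj₁ fs) × n ≡ p ℕ.^ r * m) →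
    SignedCount (λ s → GoodKron (suc (suc e)) n s {n}) (prodAB (suc (suc e)) ((p , r) ∷ fs)) (prodParity (suc (suc e)) ((p , r) ∷ fs))
  step (suc r) (m , h′ , p-prime , _ , p∉ , refl) = product-count (suc (suc e)) p-prime (suc r) m
    (Unit-^ (coprime-factor p-prime fs h′ p∉) (suc r))
    {{ℕₚ.m^n≢0 p (suc r) {{Primality.prime⇒nonZero p-prime}}}} {{IsFactorisation⇒nonZero fs h′}}
    (prime-power-count p-prime e (ℕ∣.∣-trans (ℕ∣.m∣m*n (p ℕ.^ r)) (ℕ∣.∣-trans (ℕ∣.m∣m*n m) n∣N)) r)
    (factorisation-count e fs h′ (ℕ∣.∣-trans (ℕ∣.n∣m*n (p ℕ.^ suc r)) n∣N))

-- Polynomials and liars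

coeff-+ₚ : ∀ p q i → coeff (p +ₚ q) i ≡ coeff p i + coeff q i
coeff-+ₚ []      q       i       = sym (ℤₚ.+-identityˡ _)
coeff-+ₚ (a ∷ p) []      i       = sym (ℤₚ.+-identityʳ _)
coeff-+ₚ (a ∷ p) (b ∷ q) zero    = refl
coeff-+ₚ (a ∷ p) (b ∷ q) (suc i) = coeff-+ₚ p q i

coeff-scale : ∀ a p i → coeff (scale a p) i ≡ a · coeff p i
coeff-scale a []      i       = sym (ℤₚ.*-zeroʳ a)
coeff-scale a (b ∷ p) zero    = refl
coeff-scale a (b ∷ p) (suc i) = coeff-scale a p i

coeff--ₚ : ∀ p i → coeff (-ₚ p) i ≡ - coeff p i
coeff--ₚ []      i       = refl
coeff--ₚ (b ∷ p) zero    = refl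
coeff--ₚ (b ∷ p) (suc i) = coeff--ₚ p i

coeff-minus : ∀ p q i → coeff (p -ₚ q) i ≡ coeff p i - coeff q i
coeff-minus p q i = trans (coeff-+ₚ p (-ₚ q) i) (cong (λ x → coeff p i + x) (coeff--ₚ q i))

coeff-*ₚ : ∀ a p q i → coeff ((a ∷ p) *ₚ q) i ≡ a · coeff q i + coeff (+ 0 ∷ p *ₚ q) i
coeff-*ₚ a p q i = trans (coeff-+ₚ (scale a q) (+ 0 ∷ p *ₚ q) i) (cong (_+ coeff (+ 0 ∷ p *ₚ q) i) (coeff-scale a q i))

coeff-zero-list : ∀ i → coeff (+ 0 ∷ []) i ≡ + 0
coeff-zero-list zero    = refl
coeff-zero-list (suc i) = refl

coeff-oneₚ-* : ∀ q i → coeff (oneₚ *ₚ q) i ≡ coeff q i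
coeff-oneₚ-* q i = trans (coeff-*ₚ (+ 1) [] q i)
  (trans (cong₂ _+_ (ℤₚ.*-identityˡ (coeff q i)) (coeff-zero-list i)) (ℤₚ.+-identityʳ _))

coeff-*-oneₚ : ∀ p i → coeff (p *ₚ oneₚ) i ≡ coeff p i
coeff-*-oneₚ []      i       = refl
coeff-*-oneₚ (a ∷ p) zero    = trans (coeff-*ₚ a p oneₚ zero) (trans (ℤₚ.+-identityʳ _) (ℤₚ.*-identityʳ a))
coeff-*-oneₚ (a ∷ p) (suc i) = trans (coeff-*ₚ a p oneₚ (suc i))
  (trans (cong₂ _+_ (ℤₚ.*-zeroʳ a) (coeff-*-oneₚ p i)) (ℤₚ.+-identityˡ _))

infix 4 _≋ₚ_[_]
_≋ₚ_[_] : Poly → Poly → ℕ → Set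
p ≋ₚ q [ n ] = ∀ i → coeff p i ≋ coeff q i [ n ]

≈⇒≋ₚ : ∀ {n} p q → p ≈ q [mod n ] → p ≋ₚ q [ n ]
≈⇒≋ₚ p q h i = mod⇒≋ (coeff p i) (coeff q i) (h i)

≡⇒≈ : ∀ {n} p q → (∀ i → coeff p i ≡ coeff q i) → p ≈ q [mod n ]
≡⇒≈ p q h i = ≋⇒mod {a = coeff p i} {coeff q i} (≡⇒≋ (h i))

record HasDegree (n : ℕ) (p : Poly) (d : ℕ) : Set where
  constructor hasDegree
  field
    leading : coeff p d ≋ + 1 [ n ]
    above   : ∀ i → d < i → coeff p i ≋ + 0 [ n ]

MonicDeg⇒HasDegree : ∀ {n} p d → MonicDeg n p d → HasDegree n p d
MonicDeg⇒HasDegree p d (h , h′) = hasDegree (mod⇒≋ (coeff p d) (+ 1) h) (λ i d<i → mod⇒≋ (coeff p i) (+ 0) (h′ i d<i))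

HasDegree-resp-≋ₚ : ∀ {n} p q {d} → p ≋ₚ q [ n ] → HasDegree n p d → HasDegree n q d
HasDegree-resp-≋ₚ p q {d} e (hasDegree l a) =
  hasDegree (≋-trans (≋-sym (e d)) l) (λ i d<i → ≋-trans (≋-sym (e i)) (a i d<i))

zero-*ₚ : ∀ {n} p q → (∀ i → coeff p i ≋ + 0 [ n ]) → ∀ i → coeff (p *ₚ q) i ≋ + 0 [ n ]
zero-*ₚ []      q h i = ≋-refl
zero-*ₚ (a ∷ p) q h i = ≋-trans (≡⇒≋ (coeff-*ₚ a p q i))
  (≋-trans (+-cong-≋ (·-cong-≋ (h 0) (≋-refl {a = coeff q i})) (shifted i)) (≡⇒≋ (trans (ℤₚ.+-identityʳ _) (ℤₚ.*-zeroˡ (coeff q i)))))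
  where
  shifted : ∀ i → coeff (+ 0 ∷ p *ₚ q) i ≋ + 0 [ _ ]
  shifted zero    = ≋-refl
  shifted (suc i) = zero-*ₚ p q (λ j → h (suc j)) i

HasDegree-* : ∀ {n} p q {d e} → HasDegree n p d → HasDegree n q e → HasDegree n (p *ₚ q) (d ℕ.+ e)
-- A leading coefficient 1 of the empty list means 0 ≡ 1 modulo n, and the same congruence serves
-- for the product.
HasDegree-* []      q         (hasDegree l _) _ = hasDegree l (λ _ _ → ≋-refl)
HasDegree-* {n} (a ∷ p) q {zero} {e} (hasDegree l above) (hasDegree l′ above′) = hasDegree
  (≋-trans (value e) l′) (λ i e<i → ≋-trans (value i) (above′ i e<i))
  where
  shifted : ∀ i → coeff (+ 0 ∷ p *ₚ q) i ≋ + 0 [ n ]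
  shifted zero    = ≋-refl
  shifted (suc i) = zero-*ₚ p q (λ j → above (suc j) (s≤s z≤n)) i
  value : ∀ i → coeff ((a ∷ p) *ₚ q) i ≋ coeff q i [ n ]
  value i = ≋-trans (≡⇒≋ (coeff-*ₚ a p q i)) (≋-trans (+-cong-≋ (·-cong-≋ l (≋-refl {a = coeff q i})) (shifted i))
    (≡⇒≋ (trans (ℤₚ.+-identityʳ _) (ℤₚ.*-identityˡ (coeff q i)))))
HasDegree-* {n} (a ∷ p) q {suc d} {e} (hasDegree l above) hq@(hasDegree l′ above′) = hasDegree
  (≋-trans (value (d ℕ.+ e) (s≤s (ℕₚ.m≤n+m e d))) (HasDegree.leading ih))
  (λ { (suc i) (s≤s d+e<i) → ≋-trans (value i (ℕₚ.m≤n⇒m≤1+n (ℕₚ.≤-trans (s≤s (ℕₚ.m≤n+m e d)) d+e<i))) (HasDegree.above ih i d+e<i) })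
  where
  ih : HasDegree n (p *ₚ q) (d ℕ.+ e)
  ih = HasDegree-* p q (hasDegree l (λ i d<i → above (suc i) (s≤s d<i))) hq
  value : ∀ i → e < suc i → coeff ((a ∷ p) *ₚ q) (suc i) ≋ coeff (p *ₚ q) i [ n ]
  value i e<i = ≋-trans (≡⇒≋ (coeff-*ₚ a p q (suc i)))
    (≋-trans (+-cong-≋ (·-cong-≋ (≋-refl {a = a}) (above′ (suc i) e<i)) ≋-refl)
      (≡⇒≋ (trans (cong (_+ coeff (p *ₚ q) i) (ℤₚ.*-zeroʳ a)) (ℤₚ.+-identityˡ _))))

HasDegree-≤ : ∀ {n} p {d e} → ¬ (+ 1 ≋ + 0 [ n ]) → HasDegree n p d → HasDegree n p e → d ≤ e
HasDegree-≤ p {d} {e} 1≢0 (hasDegree l _) (hasDegree _ above) =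
  ℕₚ.≮⇒≥ (λ e<d → 1≢0 (≋-trans (≋-sym l) (above d e<d)))

quadPoly-degree : ∀ {n} b c → MonicDeg n (quadPoly b c) 2
quadPoly-degree {n} b c = ≋⇒mod {n} {+ 1} {+ 1} ≋-refl , λ { (suc zero) (s≤s ()) ; (suc (suc zero)) (s≤s (s≤s ())) ; (suc (suc (suc i))) _ → ≋⇒mod {n} {+ 0} {+ 0} ≋-refl }

oneₚ-degree : ∀ {n} → MonicDeg n oneₚ 0
oneₚ-degree {n} = ≋⇒mod {n} {+ 1} {+ 1} ≋-refl , λ { (suc i) _ → ≋⇒mod {n} {+ 0} {+ 0} ≋-refl }

-- The quotient by the quadratic and division with remainder

module Evaluation (b c : ℤ) where
  private
    X : ℤ × ℤ
    X = + 1 , + 0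

  -- The class in ℤ[X]/(X² + bX + c), by Horner's rule. It is computed over ℤ, so the identities for
  -- sums and products are equalities, and a modulus enters only through `eval-cong`.
  eval : Poly → ℤ × ℤ
  eval []      = + 0 , + 0
  eval (a ∷ p) = (+ 0 , a) +₂ mulQ b c X (eval p)

  private
    X*0 : mulQ b c X (+ 0 , + 0) ≡ (+ 0 , + 0)
    X*0 = cong₂ _,_ (lemma b) (lemma′ c)
      where
      lemma : ∀ b → + 1 · + 0 + + 0 · + 0 - b · (+ 1 · + 0) ≡ + 0
      lemma = solve-∀
      lemma′ : ∀ c → + 0 · + 0 - c · (+ 1 · + 0) ≡ + 0
      lemma′ = solve-∀

  eval-zero : ∀ {n} p → (∀ i → coeff p i ≋ + 0 [ n ]) → eval p ≋₂ (+ 0 , + 0) [ n ]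
  eval-zero []      h = ≡⇒≋₂ refl
  eval-zero (a ∷ p) h =
    let eu , ev = ≋₂-trans (mulQ-cong b c {X} (≡⇒≋₂ refl) (eval-zero p (λ i → h (suc i)))) (≡⇒≋₂ X*0)
    in +-cong-≋ (≋-refl {a = + 0}) eu , +-cong-≋ (h 0) ev

  eval-cong : ∀ {n} p q → p ≋ₚ q [ n ] → eval p ≋₂ eval q [ n ]
  eval-cong []      q       h = ≋₂-sym (eval-zero q (λ i → ≋-sym (h i)))
  eval-cong (a ∷ p) []      h = eval-zero (a ∷ p) h
  eval-cong (a ∷ p) (a′ ∷ q) h =
    let eu , ev = mulQ-cong b c {X} (≡⇒≋₂ refl) (eval-cong p q (λ i → h (suc i)))
    in +-cong-≋ (≋-refl {a = + 0}) eu , +-cong-≋ (h 0) ev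

  private
    interchange : ∀ x y z w → (x +₂ y) +₂ (z +₂ w) ≡ (x +₂ z) +₂ (y +₂ w)
    interchange (x , x′) (y , y′) (z , z′) (w , w′) = cong₂ _,_ (lemma x y z w) (lemma x′ y′ z′ w′)
      where
      lemma : ∀ x y z w → (x + y) + (z + w) ≡ (x + z) + (y + w)
      lemma = solve-∀

    scalar-* : ∀ a u v → mulQ b c (+ 0 , a) (u , v) ≡ (a · u , a · v)
    scalar-* a u v = cong₂ _,_ (lemma a b u v) (lemma′ a c u v)
      where
      lemma : ∀ a b u v → + 0 · v + a · u - b · (+ 0 · u) ≡ a · u
      lemma = solve-∀
      lemma′ : ∀ a c u v → a · v - c · (+ 0 · u) ≡ a · v
      lemma′ = solve-∀

    mulQ-distribʳ : ∀ x y z → mulQ b c (y +₂ z) x ≡ mulQ b c y x +₂ mulQ b c z x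
    mulQ-distribʳ x y z = trans (mulQ-comm b c (y +₂ z) x)
      (trans (mulQ-distribˡ b c x y z) (cong₂ _+₂_ (mulQ-comm b c x y) (mulQ-comm b c x z)))

  +₂-identityˡ : ∀ x → (+ 0 , + 0) +₂ x ≡ x
  +₂-identityˡ (u , v) = cong₂ _,_ (ℤₚ.+-identityˡ u) (ℤₚ.+-identityˡ v)

  +₂-identityʳ : ∀ x → x +₂ (+ 0 , + 0) ≡ x
  +₂-identityʳ (u , v) = cong₂ _,_ (ℤₚ.+-identityʳ u) (ℤₚ.+-identityʳ v)

  eval-+ₚ : ∀ p q → eval (p +ₚ q) ≡ eval p +₂ eval q
  eval-+ₚ []      q       = sym (+₂-identityˡ (eval q))
  eval-+ₚ (a ∷ p) []      = sym (+₂-identityʳ (eval (a ∷ p)))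
  eval-+ₚ (a ∷ p) (a′ ∷ q) = trans
    (cong ((+ 0 , a + a′) +₂_) (trans (cong (mulQ b c X) (eval-+ₚ p q)) (mulQ-distribˡ b c X (eval p) (eval q))))
    (interchange (+ 0 , a) (+ 0 , a′) (mulQ b c X (eval p)) (mulQ b c X (eval q)))

  eval-scale : ∀ a p → eval (scale a p) ≡ mulQ b c (+ 0 , a) (eval p)
  eval-scale a []      = sym (trans (scalar-* a (+ 0) (+ 0)) (cong₂ _,_ (ℤₚ.*-zeroʳ a) (ℤₚ.*-zeroʳ a)))
  eval-scale a (a′ ∷ p) = begin
    (+ 0 , a · a′) +₂ mulQ b c X (eval (scale a p))
      ≡⟨ cong₂ _+₂_ (sym (trans (scalar-* a (+ 0) a′) (cong (_, a · a′) (ℤₚ.*-zeroʳ a)))) (cong (mulQ b c X) (eval-scale a p)) ⟩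
    mulQ b c (+ 0 , a) (+ 0 , a′) +₂ mulQ b c X (mulQ b c (+ 0 , a) (eval p))
      ≡⟨ cong (mulQ b c (+ 0 , a) (+ 0 , a′) +₂_) (swap X (+ 0 , a) (eval p)) ⟩
    mulQ b c (+ 0 , a) (+ 0 , a′) +₂ mulQ b c (+ 0 , a) (mulQ b c X (eval p))
      ≡⟨ mulQ-distribˡ b c (+ 0 , a) (+ 0 , a′) (mulQ b c X (eval p)) ⟨
    mulQ b c (+ 0 , a) (eval (a′ ∷ p)) ∎
    where
    open ≡-Reasoning
    swap : ∀ x y z → mulQ b c x (mulQ b c y z) ≡ mulQ b c y (mulQ b c x z)
    swap x y z = trans (sym (mulQ-assoc b c x y z)) (trans (cong (λ w → mulQ b c w z) (mulQ-comm b c x y)) (mulQ-assoc b c y x z))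

  eval-*ₚ : ∀ p q → eval (p *ₚ q) ≡ mulQ b c (eval p) (eval q)
  eval-*ₚ []      q = let u , v = eval q in sym (trans (scalar-* (+ 0) u v) (cong₂ _,_ (ℤₚ.*-zeroˡ u) (ℤₚ.*-zeroˡ v)))
  eval-*ₚ (a ∷ p) q = begin
    eval (scale a q +ₚ (+ 0 ∷ p *ₚ q))
      ≡⟨ eval-+ₚ (scale a q) (+ 0 ∷ p *ₚ q) ⟩
    eval (scale a q) +₂ eval (+ 0 ∷ p *ₚ q)
      ≡⟨ cong₂ _+₂_ (eval-scale a q) (+₂-identityˡ _) ⟩
    mulQ b c (+ 0 , a) (eval q) +₂ mulQ b c X (eval (p *ₚ q))
      ≡⟨ cong (mulQ b c (+ 0 , a) (eval q) +₂_) (trans (cong (mulQ b c X) (eval-*ₚ p q)) (sym (mulQ-assoc b c X (eval p) (eval q)))) ⟩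
    mulQ b c (+ 0 , a) (eval q) +₂ mulQ b c (mulQ b c X (eval p)) (eval q)
      ≡⟨ mulQ-distribʳ (eval q) (+ 0 , a) (mulQ b c X (eval p)) ⟨
    mulQ b c (eval (a ∷ p)) (eval q) ∎
    where open ≡-Reasoning

  eval--ₚ : ∀ p → eval (-ₚ p) ≡ -₂ eval p
  eval--ₚ []      = refl
  eval--ₚ (a ∷ p) = let u , v = eval p in
    trans (cong (λ x → (+ 0 , - a) +₂ mulQ b c X x) (eval--ₚ p)) (cong₂ _,_ (lemma b u v) (lemma′ a c u v))
    where
    lemma : ∀ b u v → + 0 + (+ 1 · - v + + 0 · - u - b · (+ 1 · - u)) ≡ - (+ 0 + (+ 1 · v + + 0 · u - b · (+ 1 · u)))
    lemma = solve-∀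
    lemma′ : ∀ a c u v → - a + (+ 0 · - v - c · (+ 1 · - u)) ≡ - (a + (+ 0 · v - c · (+ 1 · u)))
    lemma′ = solve-∀

  eval-X^ : ∀ k → eval (X^ k) ≡ X^mod b c k
  eval-X^ zero    = cong ((+ 0 , + 1) +₂_) X*0
  eval-X^ (suc k) = let u , v = X^mod b c k in trans (+₂-identityˡ _)
    (trans (cong (mulQ b c X) (eval-X^ k)) (cong₂ _,_ (lemma b u v) (lemma′ c u v)))
    where
    lemma : ∀ b u v → + 1 · v + + 0 · u - b · (+ 1 · u) ≡ v - b · u
    lemma = solve-∀
    lemma′ : ∀ c u v → + 0 · v - c · (+ 1 · u) ≡ - (c · u)
    lemma′ = solve-∀

  eval-oneₚ : eval oneₚ ≡ (+ 0 , + 1)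
  eval-oneₚ = eval-X^ 0

  eval-quadPoly : eval (quadPoly b c) ≡ (+ 0 , + 0)
  eval-quadPoly = trans (cong (λ x → (+ 0 , c) +₂ mulQ b c X ((+ 0 , b) +₂ mulQ b c X x)) eval-oneₚ)
    (cong₂ _,_ (lemma b c) (lemma′ b c))
    where
    lemma : ∀ b c → + 0 + (+ 1 · (b + (+ 0 · + 1 - c · (+ 1 · + 0))) + + 0 · (+ 0 + (+ 1 · + 1 + + 0 · + 0 - b · (+ 1 · + 0)))
      - b · (+ 1 · (+ 0 + (+ 1 · + 1 + + 0 · + 0 - b · (+ 1 · + 0))))) ≡ + 0
    lemma = solve-∀
    lemma′ : ∀ b c → c + (+ 0 · (b + (+ 0 · + 1 - c · (+ 1 · + 0))) - c · (+ 1 · (+ 0 + (+ 1 · + 1 + + 0 · + 0 - b · (+ 1 · + 0))))) ≡ + 0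
    lemma′ = solve-∀

  -- Long division of X^k by the quadratic. Multiplying the previous step by X turns its remainder
  -- into u X² + v X, which takes one more subtraction of u times the quadratic; hence the new
  -- constant coefficient u.
  quotient : ℕ → Poly
  quotient zero    = []
  quotient (suc k) = proj₁ (X^mod b c k) ∷ quotient k

  remainder : ℕ → Poly
  remainder k = let u , v = X^mod b c k in v ∷ u ∷ []

  division : ∀ k i → coeff (X^ k) i ≡ coeff (quotient k *ₚ quadPoly b c) i + coeff (remainder k) i
  division zero    zero          = refl
  division zero    (suc zero)    = refl
  division zero    (suc (suc i)) = refl
  division (suc k) i = trans (step i) (cong (_+ coeff (remainder (suc k)) i) (sym (coeff-*ₚ u (quotient k) (quadPoly b c) i)))
    where
    u = proj₁ (X^mod b c k)
    v = proj₂ (X^mod b c k)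
    lemma₀ : ∀ c u → + 0 ≡ u · c + + 0 + - (c · u)
    lemma₀ = solve-∀
    lemma₁ : ∀ b u v q → q + v ≡ u · b + q + (v - b · u)
    lemma₁ = solve-∀
    lemma₂ : ∀ u q → q + u ≡ u · + 1 + q + + 0
    lemma₂ = solve-∀
    lemma₃ : ∀ u q → q + + 0 ≡ u · + 0 + q + + 0
    lemma₃ = solve-∀
    step : ∀ i → coeff (X^ (suc k)) i ≡
      u · coeff (quadPoly b c) i + coeff (+ 0 ∷ quotient k *ₚ quadPoly b c) i + coeff (remainder (suc k)) i
    step zero                = lemma₀ c u
    step (suc zero)          = trans (division k 0) (lemma₁ b u v (coeff (quotient k *ₚ quadPoly b c) 0))
    step (suc (suc zero))    = trans (division k 1) (lemma₂ u (coeff (quotient k *ₚ quadPoly b c) 1))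
    step (suc (suc (suc i))) = trans (division k (suc (suc i))) (lemma₃ u (coeff (quotient k *ₚ quadPoly b c) (suc (suc i))))

  Fixed⇒quadPoly-divides : ∀ N {n} → Fixed N n b c → InIdeal₁ n (quadPoly b c) (X^ N -ₚ X^ 1)
  Fixed⇒quadPoly-divides N {n} (hu , hv) = quotient N , λ i → ≋⇒mod {n} {coeff (quotient N *ₚ quadPoly b c) i} (≋-sym (step i))
    where
    remainder≋X : ∀ i → coeff (remainder N) i ≋ coeff (X^ 1) i [ n ]
    remainder≋X zero          = hv
    remainder≋X (suc zero)    = hu
    remainder≋X (suc (suc i)) = ≋-refl
    lemma : ∀ q x → q + x - x ≡ q
    lemma = solve-∀
    step : ∀ i → coeff (X^ N -ₚ X^ 1) i ≋ coeff (quotient N *ₚ quadPoly b c) i [ n ]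
    step i = ≋-trans (≡⇒≋ (trans (coeff-minus (X^ N) (X^ 1) i) (cong (_- coeff (X^ 1) i) (division N i))))
      (≋-trans (minus-cong-≋ (+-cong-≋ (≋-refl {a = coeff (quotient N *ₚ quadPoly b c) i}) (remainder≋X i)) (≋-refl {a = coeff (X^ 1) i}))
        (≡⇒≋ (lemma (coeff (quotient N *ₚ quadPoly b c) i) (coeff (X^ 1) i))))

-- Liars with symbol +1

module _ (n : ℕ) (b c : ℤ) (1≢0 : ¬ + 1 ≋ + 0 [ n ]) where
  open Evaluation b c
  private
    f = quadPoly b c
    Δ = disc b c

  HasDegree-0⇒≋oneₚ : ∀ p → HasDegree n p 0 → p ≋ₚ oneₚ [ n ]
  HasDegree-0⇒≋oneₚ p (hasDegree l above) zero    = l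
  HasDegree-0⇒≋oneₚ p (hasDegree l above) (suc i) = above (suc i) (s≤s z≤n)

  -- Everything is evaluated in the quotient by f. Once F₂ = 1, also f₁ has value 1; then F₁ f₁ = f
  -- gives F₁ the value 0, and X^n - X is a multiple of F₁.
  Liar⇒Good : Liar n b c → KronRel Δ n (+ 1) → Good n n b c
  Liar⇒Good (gcd≡1 , F₁ , f₁ , F₂ , f₂ , ((d₁ , F₁-monic) , _ , (a , aF₁≈) , _) , f≈ , _ , f₁≈ , f₂≈1 , _ , (d , m , F₂-monic , d≡2m , kr)) k =
    cΔ-unit , fixed
    where
    cΔ-unit : Unit n (c · Δ)
    cΔ-unit = coprime⇒Unit (c · Δ) (Coprime.gcd≡1⇒coprime (ℤₚ.+-injective gcd≡1))

    f₂-degree : HasDegree n f₂ 0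
    f₂-degree = HasDegree-resp-≋ₚ oneₚ f₂ (λ i → ≋-sym (≈⇒≋ₚ f₂ oneₚ f₂≈1 i)) (MonicDeg⇒HasDegree oneₚ 0 oneₚ-degree)

    f-degree : HasDegree n f (d₁ ℕ.+ (d ℕ.+ 0))
    f-degree = HasDegree-resp-≋ₚ (F₁ *ₚ f₁) f (λ i → ≋-sym (≈⇒≋ₚ f (F₁ *ₚ f₁) f≈ i))
      (HasDegree-* F₁ f₁ (MonicDeg⇒HasDegree F₁ d₁ F₁-monic)
        (HasDegree-resp-≋ₚ (F₂ *ₚ f₂) f₁ (λ i → ≋-sym (≈⇒≋ₚ f₁ (F₂ *ₚ f₂) f₁≈ i))
          (HasDegree-* F₂ f₂ (MonicDeg⇒HasDegree F₂ d F₂-monic) f₂-degree)))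

    d≤2 : d ≤ 2
    d≤2 = ℕₚ.≤-trans (ℕₚ.≤-trans (ℕₚ.m≤m+n d 0) (ℕₚ.m≤n+m (d ℕ.+ 0) d₁))
      (HasDegree-≤ f 1≢0 f-degree (MonicDeg⇒HasDegree f 2 (quadPoly-degree b c)))

    -- The bound d ≤ 2 leaves m = 0 and m = 1, and m = 1 would make the symbol -1.
    d≡0 : ∀ m → d ≡ 2 * m → KronRel Δ n (negOnePow m) → d ≡ 0
    d≡0 zero          e _  = e
    d≡0 (suc zero)    _ kr = contradiction (KronRel-unique b c cΔ-unit k kr) 1≢-1
    d≡0 (suc (suc m)) e _  = contradiction (ℕₚ.≤-trans (ℕₚ.*-monoʳ-≤ 2 {2} {suc (suc m)} (s≤s (s≤s z≤n))) (subst (_≤ 2) e d≤2)) λ { (s≤s (s≤s ())) }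

    F₂-value : eval F₂ ≋₂ (+ 0 , + 1) [ n ]
    F₂-value = ≋₂-trans (eval-cong F₂ oneₚ (HasDegree-0⇒≋oneₚ F₂ (subst (HasDegree n F₂) (d≡0 m d≡2m kr) (MonicDeg⇒HasDegree F₂ d F₂-monic))))
      (≡⇒≋₂ eval-oneₚ)

    f₁-value : eval f₁ ≋₂ (+ 0 , + 1) [ n ]
    f₁-value = ≋₂-trans (eval-cong f₁ (F₂ *ₚ f₂) (≈⇒≋ₚ f₁ (F₂ *ₚ f₂) f₁≈)) (≋₂-trans (≡⇒≋₂ (eval-*ₚ F₂ f₂))
      (≋₂-trans (mulQ-cong b c F₂-value (≋₂-trans (eval-cong f₂ oneₚ (≈⇒≋ₚ f₂ oneₚ f₂≈1)) (≡⇒≋₂ eval-oneₚ)))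
        (≡⇒≋₂ (mulQ-identityˡ b c (+ 0 , + 1)))))

    F₁-value : eval F₁ ≋₂ (+ 0 , + 0) [ n ]
    F₁-value = ≋₂-trans (≡⇒≋₂ (sym (trans (mulQ-comm b c (eval F₁) (+ 0 , + 1)) (mulQ-identityˡ b c (eval F₁)))))
      (≋₂-trans (mulQ-cong b c (≡⇒≋₂ {x = eval F₁} refl) (≋₂-sym f₁-value))
      (≋₂-trans (≡⇒≋₂ (sym (eval-*ₚ F₁ f₁)))
      (≋₂-trans (≋₂-sym (eval-cong f (F₁ *ₚ f₁) (≈⇒≋ₚ f (F₁ *ₚ f₁) f≈))) (≡⇒≋₂ eval-quadPoly))))

    mulQ-zeroʳ : ∀ x → mulQ b c x (+ 0 , + 0) ≡ (+ 0 , + 0)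
    mulQ-zeroʳ (u , v) = cong₂ _,_ (lemma b u v) (lemma′ c u v)
      where
      lemma : ∀ b u v → u · + 0 + v · + 0 - b · (u · + 0) ≡ + 0
      lemma = solve-∀
      lemma′ : ∀ c u v → v · + 0 - c · (u · + 0) ≡ + 0
      lemma′ = solve-∀

    difference-value : X^mod b c n +₂ (-₂ X^mod b c 1) ≋₂ (+ 0 , + 0) [ n ]
    difference-value = ≋₂-trans (≡⇒≋₂ (sym (trans (eval-+ₚ (X^ n) (-ₚ X^ 1))
        (cong₂ _+₂_ (eval-X^ n) (trans (eval--ₚ (X^ 1)) (cong -₂_ (eval-X^ 1)))))))
      (≋₂-trans (≋₂-sym (eval-cong (a *ₚ F₁) (X^ n -ₚ X^ 1) (≈⇒≋ₚ (a *ₚ F₁) (X^ n -ₚ X^ 1) aF₁≈)))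
      (≋₂-trans (≡⇒≋₂ (eval-*ₚ a F₁))
      (≋₂-trans (mulQ-cong b c (≡⇒≋₂ {x = eval a} refl) F₁-value) (≡⇒≋₂ (mulQ-zeroʳ (eval a))))))

    fixed : Fixed n n b c
    fixed = ≋₂-trans (minus≋0⇒≋ (proj₁ difference-value) , minus≋0⇒≋ (proj₂ difference-value))
      (≡⇒≋₂ (cong₂ _,_ (lemma b) (lemma′ c)))
      where
      lemma : ∀ b → + 1 - b · + 0 ≡ + 1
      lemma = solve-∀
      lemma′ : ∀ c → - (c · + 0) ≡ + 0
      lemma′ = solve-∀

  Good⇒Liar : Good n n b c → KronRel Δ n (+ 1) → Liar n b c
  Good⇒Liar (u , fixed) k =
    -- As f divides X^n - X, it is itself the first gcmd, which leaves f₁ = F₂ = f₂ = 1.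
    cong +_ (Coprime.coprime⇒gcd≡1 (Unit⇒coprime (c · Δ) u)) , f , oneₚ , oneₚ , oneₚ ,
    ( (2 , quadPoly-degree b c)
    , ([] , oneₚ , ≡⇒≈ (oneₚ *ₚ f) f (coeff-oneₚ-* f))
    , Fixed⇒quadPoly-divides n fixed
    , (oneₚ , ≡⇒≈ (oneₚ *ₚ f) f (coeff-oneₚ-* f))) ,
    ≡⇒≈ f (f *ₚ oneₚ) (λ i → sym (coeff-*-oneₚ f i)) ,
    ( (0 , oneₚ-degree)
    , ([] , oneₚ , ≡⇒≈ (oneₚ *ₚ oneₚ) oneₚ (coeff-*-oneₚ oneₚ))
    , oneₚ-divides (X^ (n * n) -ₚ X^ 1)
    , oneₚ-divides oneₚ) ,
    ≡⇒≈ oneₚ (oneₚ *ₚ oneₚ) (λ i → sym (coeff-*-oneₚ oneₚ i)) ,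
    ≡⇒≈ oneₚ oneₚ (λ _ → refl) ,
    oneₚ-divides (oneₚ ∘ₚ X^ n) ,
    (0 , 0 , oneₚ-degree , refl , k)
    where
    oneₚ-divides : ∀ p → InIdeal₁ n oneₚ p
    oneₚ-divides p = p , ≡⇒≈ (p *ₚ oneₚ) p (coeff-*-oneₚ p)

card-L2+Member : ∀ e {P} → HasCard (GoodKron (suc (suc e)) (suc (suc e)) (+ 1) {suc (suc e)}) P →
  HasCard (L2+Member (suc (suc e))) P
card-L2+Member e = card-resp-⇔
  (λ {(b , c)} (good , k) → Good⇒Liar (suc (suc e)) (ι b) (ι c) 1≢0 good k , k)
  (λ {(b , c)} (liar , k) → Liar⇒Good (suc (suc e)) (ι b) (ι c) 1≢0 liar k , k)
  where
  1≢0 : ¬ + 1 ≋ + 0 [ suc (suc e) ]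
  1≢0 h = contradiction (ℕ∣.∣1⇒≡1 (≋0⇒∣ {suc (suc e)} {+ 1} h)) λ ()


theorem3p4 : (n : ℕ) (fs : List (ℕ × ℕ)) → Composite n → IsFactorisation n fs →
    ∃[ L ] (HasCard (L2+Member n) L × + (2 * L) ≡ prodAB n fs + prodParity n fs)
theorem3p4 zero          fs n-composite _ = contradiction n-composite Primality.¬composite[0]
theorem3p4 (suc zero)    fs n-composite _ = contradiction n-composite Primality.¬composite[1]
theorem3p4 (suc (suc e)) fs _           h =
  let P , Q , hP , _ , total , signed = factorisation-count e fs h ℕ∣.∣-refl
  in P , card-L2+Member e hP ,
     trans (ℤₚ.pos-* 2 P) (trans (lemma (+ P) (+ Q)) (cong₂ _+_ total signed))
  where
  lemma : ∀ x y → + 2 · x ≡ (x + y) + (x - y)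
  lemma = solve-∀
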